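{- Let $t$ be a positive integer. The existence of the following are equivalent: (i) a skew-symmetric Seidel matrix with characteristic polynomial $(x^2+4t+3)^{2t+2}$; (ii) a skew-symmetric Seidel matrix with characteristic polynomial $x(x^2+4t+3)^{2t+1}$; (iii) a skew-symmetric Seidel matrix with characteristic polynomial $(x^2+1)(x^2+4t+3)^{2t}$; (iv) a skew-symmetric Seidel matrix with characteristic polynomial $x(x^2+3)(x^2+4t+3)^{2t-1}$.
   Context: A Seidel matrix is a square $\{0,\pm1\}$-matrix $S$ with zero diagonal, all off-diagonal entries nonzero, and $S=\pm S^\top$; it is skew-symmetric if $S^\top=-S$. The characteristic polynomial of $S$ is $\det(xI-S)$. -}

module Defs where

open import Data.Nat as ℕ using (ℕ; zero; suc)
open import Data.Integer as ℤ using (ℤ; +_; -_; 0ℤ; 1ℤ)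
open import Data.Fin using (Fin; zero; suc; punchIn)
open import Data.List using (List; []; _∷_)
open import Data.Sum using (_⊎_)
open import Data.Product using (_×_; Σ)
open import Relation.Binary.PropositionalEquality using (_≡_; _≢_)

-- Integer polynomials as coefficient lists, lowest degree first.
Poly : Set
Poly = List ℤ

coeff : Poly → ℕ → ℤ
coeff []       _       = 0ℤ
coeff (a ∷ p)  zero    = a
coeff (a ∷ p)  (suc k) = coeff p k

-- Polynomial equality: all coefficients agree (ignores trailing zeros).
_≈ₚ_ : Poly → Poly → Set
p ≈ₚ q = ∀ k → coeff p k ≡ coeff q k

infixl 6 _+ₚ_
infixl 7 _*ₚ_ _·ₚ_

_+ₚ_ : Poly → Poly → Poly
[]      +ₚ q       = q
(a ∷ p) +ₚ []      = a ∷ p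
(a ∷ p) +ₚ (b ∷ q) = (a ℤ.+ b) ∷ (p +ₚ q)

_·ₚ_ : ℤ → Poly → Poly
c ·ₚ []      = []
c ·ₚ (a ∷ p) = (c ℤ.* a) ∷ (c ·ₚ p)

_*ₚ_ : Poly → Poly → Poly
[]      *ₚ q = []
(a ∷ p) *ₚ q = (a ·ₚ q) +ₚ (0ℤ ∷ (p *ₚ q))

negₚ : Poly → Poly
negₚ p = (- 1ℤ) ·ₚ p

constₚ : ℤ → Poly
constₚ c = c ∷ []

X : Poly
X = 0ℤ ∷ 1ℤ ∷ []

_^ₚ_ : Poly → ℕ → Poly
p ^ₚ zero  = constₚ 1ℤ
p ^ₚ suc n = p *ₚ (p ^ₚ n)

Matrix : Set → ℕ → Set
Matrix A n = Fin n → Fin n → A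

-- Determinant of a polynomial matrix, by Laplace expansion along the first row:
-- det M = Σ_j (-1)^j M 0 j det(M with row 0 and column j deleted).
minor : ∀ {A : Set} {n} → Matrix A (suc n) → Fin (suc n) → Matrix A n
minor M j r c = M (suc r) (punchIn j c)

det : ∀ n → Matrix Poly n → Poly
det zero    M = constₚ 1ℤ
det (suc n) M = go (suc n) (λ j → j) 1ℤ
  where
  go : ∀ k → (Fin k → Fin (suc n)) → ℤ → Poly
  go zero    f s = []
  go (suc k) f s = (s ·ₚ (M zero (f zero) *ₚ det n (minor M (f zero))))
                   +ₚ go k (λ i → f (suc i)) (- s)

δ : ∀ {n} → Fin n → Fin n → ℤ
δ zero    zero    = 1ℤ
δ zero    (suc j) = 0ℤ
δ (suc i) zero    = 0ℤ
δ (suc i) (suc j) = δ i j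

charPoly : ∀ n → Matrix ℤ n → Poly
charPoly n S = det n (λ i j → (δ i j ·ₚ X) +ₚ negₚ (constₚ (S i j)))

IsSeidelEntries : ∀ {n} → Matrix ℤ n → Set
IsSeidelEntries {n} S =
  (∀ i → S i i ≡ 0ℤ) ×
  (∀ i j → i ≢ j → (S i j ≡ 1ℤ) ⊎ (S i j ≡ - 1ℤ))

IsSkewSeidel : ∀ {n} → Matrix ℤ n → Set
IsSkewSeidel {n} S = IsSeidelEntries S × (∀ i j → S j i ≡ - S i j)

HasSkewSeidelWithCharPoly : Poly → Set
HasSkewSeidelWithCharPoly p =
  Σ ℕ λ n → Σ (Matrix ℤ n) λ S → IsSkewSeidel S × (charPoly n S ≈ₚ p)

{-# OPTIONS --safe #-}
-- Write n = 4t + 3 and q = x² + n. By Cayley–Hamilton and the semisimplicity of skew matrices, a characteristic polynomial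
-- f qᵏ forces f(S) q(S) = 0. For f = 1 this says S Sᵀ = n, and then the characteristic polynomials of the submatrices of S
-- follow from Jacobi's complementary minor identity, since (x - S)(x + S) = q. Conversely, M = q(S) = n - S Sᵀ is positive
-- semidefinite of rank r = 1, 2 or 3 with constant diagonal r and entries known modulo 2 or 4, which forces M = A Aᵀ for an
-- r-column matrix A with entries ±1 that spans an S-invariant space. Bordering S by A and the matrix of S on this space gives
-- S' with S' S'ᵀ = n, whose characteristic polynomial p is a monic square root of p² = det(x - S') det(x + S') = q⁴ᵗ⁺⁴.
module Submission where

open import Defs
open import Algebra.Bundles using (CommutativeRing)
open import Data.Fin using (Fin; zero; suc; punchIn; punchOut; splitAt; _↑ˡ_; _↑ʳ_)
open import Data.Fin.Properties using (_≟_; any?; punchIn-punchOut; splitAt-↑ˡ; splitAt-↑ʳ; ↑ˡ-injective; ↑ʳ-injective)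
open import Data.Nat as ℕ using (ℕ; zero; suc)
open import Data.Product using (_×_; _,_; proj₁; proj₂; ∃; Σ)
open import Data.Sum using (_⊎_; inj₁; inj₂; [_,_]′)
open import Function using (_∘_)
open import Relation.Nullary using (yes; no; contradiction; ¬?)

-- No eigenvalue, rank or square root of a number is ever formed. Positivity always means a sum of
-- integer squares, which is nonnegative and, if zero, has only zero terms; the rank of M is
-- replaced by polynomial relations modulo f q. For f = x and f = x² + 1 these make M a multiple of
-- a projection, and the equality case of Cauchy-Schwarz forces rows to be proportional. For f = x
-- (x² + 3) the nonzero eigenvalues of M are 4t + 3 once and 4t twice, so M first has to be split
-- into two parts that are such multiples. Even then A must be found by counting: up to signs M is
-- 4P - J for an equivalence relation P, and the relations leave only the class sizes t + 1, t, t,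
-- t. The columns of A are the three ways of splitting these four classes into two pairs. The
-- congruences come from the rows of S + I: for vectors with entries ±1, (x + y)(x + z) is divisible
-- by 4 entrywise. If several columns are added, the corner must itself be a Seidel matrix; this
-- holds because skewness determines S on the span of A up to one coefficient, whose square is fixed
-- as well.

-- Determinants over a commutative ring, by way of alternating multilinear forms.

module Determinant {c ℓ} (R : CommutativeRing c ℓ) where

  open import Data.Vec.Functional using (Vector; []; _∷_; head; tail; map; insertAt)
  open import Level using (Lift; lift; _⊔_)
  open import Data.Unit using (⊤)
  open import Relation.Binary.PropositionalEquality using (_≢_)
  import Relation.Binary.PropositionalEquality as ≡
  open CommutativeRing R hiding (zero)
  open import Algebra.Properties.Ring ring using (-‿distribˡ-*; -‿distribʳ-*; -‿involutive; -0#≈0#; -‿+-comm; -1*x≈-x)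
  open import Algebra.Properties.AbelianGroup +-abelianGroup using (inverseˡ-unique)
  open import Algebra.Properties.CommutativeSemigroup +-commutativeSemigroup using () renaming (interchange to +-interchange)
  open import Algebra.Properties.CommutativeSemigroup *-commutativeSemigroup using (x∙yz≈y∙xz)
  import Algebra.Properties.Semiring.Sum semiring as Sum
  open import Relation.Binary.Reasoning.Setoid setoid

  Vec : ℕ → Set c
  Vec = Vector Carrier

  -- Sums are kept from unfolding so that unification can read off the summand.
  abstract
    ∑ : ∀ n → Vec n → Carrier
    ∑ n t = Sum.sum t

    ∑-zero : ∀ t → ∑ zero t ≈ 0#
    ∑-zero t = refl

    ∑-suc : ∀ {n} t → ∑ (suc n) t ≈ t zero + ∑ n (t ∘ suc)
    ∑-suc t = refl

    ∑-cong : ∀ {n} {s t : Vec n} → (∀ i → s i ≈ t i) → ∑ n s ≈ ∑ n t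
    ∑-cong {n} e = Sum.sum-cong-≋ e

    ∑-+ : ∀ {n} (s t : Vec n) → ∑ n (λ i → s i + t i) ≈ ∑ n s + ∑ n t
    ∑-+ s t = Sum.∑-distrib-+ s t

    ∑-*ˡ : ∀ {n} a (t : Vec n) → ∑ n (λ i → a * t i) ≈ a * ∑ n t
    ∑-*ˡ a t = sym (Sum.*-distribˡ-sum a t)

    ∑-*ʳ : ∀ {n} a (t : Vec n) → ∑ n (λ i → t i * a) ≈ ∑ n t * a
    ∑-*ʳ a t = sym (Sum.*-distribʳ-sum a t)

    ∑-comm : ∀ {m n} (t : Fin m → Fin n → Carrier) → ∑ m (λ i → ∑ n (t i)) ≈ ∑ n (λ j → ∑ m (λ i → t i j))
    ∑-comm t = Sum.∑-comm t

    ∑-0 : ∀ {n} {t : Vec n} → (∀ i → t i ≈ 0#) → ∑ n t ≈ 0#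
    ∑-0 {n} t≈0 = trans (Sum.sum-cong-≋ t≈0) (Sum.sum-replicate-zero n)

  _≋ᵛ_ : ∀ {m} → Vec m → Vec m → Set ℓ
  u ≋ᵛ v = ∀ i → u i ≈ v i

  _≋ᵐ_ : ∀ {m n} → Vector (Vec m) n → Vector (Vec m) n → Set ℓ
  A ≋ᵐ B = ∀ i → A i ≋ᵛ B i

  _+ᵛ_ : ∀ {m} → Vec m → Vec m → Vec m
  (u +ᵛ v) i = u i + v i

  _*ᵛ_ : ∀ {m} → Carrier → Vec m → Vec m
  (a *ᵛ v) i = a * v i

  Form : ℕ → ℕ → Set c
  Form m n = Vector (Vec m) n → Carrier

  Cong : ∀ {m n} → Form m n → Set (c ⊔ ℓ)
  Cong f = ∀ {A B} → A ≋ᵐ B → f A ≈ f B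

  ∷-cong : ∀ {m n} {x y : Vec m} {A B : Vector (Vec m) n} → x ≋ᵛ y → A ≋ᵐ B → (x ∷ A) ≋ᵐ (y ∷ B)
  ∷-cong x≋y A≋B zero    = x≋y
  ∷-cong x≋y A≋B (suc i) = A≋B i

  ∷-η : ∀ {m n} (A : Vector (Vec m) (suc n)) → (head A ∷ tail A) ≋ᵐ A
  ∷-η A zero    j = refl
  ∷-η A (suc i) j = refl

  -- Vanishing on two equal leading rows; in `Alt` the first of them is already filled in. Without a
  -- second row the condition is vacuous, and this case split lets `Alt` treat every positive number
  -- of rows alike.
  Null : ∀ {m} n → Form m n → Vec m → Set (c ⊔ ℓ)
  Null {m} zero    f x = Lift (c ⊔ ℓ) ⊤
  Null {m} (suc n) f x = ∀ r → f (x ∷ r) ≈ 0#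

  -- Alternation is only required between adjacent rows.
  data Alt {m} : ∀ n → Form m n → Set (c ⊔ ℓ) where
    alt₀ : ∀ {f} → Cong f → Alt zero f
    altₛ : ∀ {n f} →
           (∀ x y r → f ((x +ᵛ y) ∷ r) ≈ f (x ∷ r) + f (y ∷ r)) →
           (∀ a x r → f ((a *ᵛ x) ∷ r) ≈ a * f (x ∷ r)) →
           (∀ x → Null n (λ r → f (x ∷ r)) x) →
           Cong f →
           (∀ x → Alt n (λ r → f (x ∷ r))) → Alt (suc n) f

  cong : ∀ {m n} {f : Form m n} → Alt n f → Cong f
  cong (alt₀ c)         = c
  cong (altₛ _ _ _ c _) = c

  module _ {m n} {f : Form m (suc n)} where

    add : Alt (suc n) f → ∀ x y r → f ((x +ᵛ y) ∷ r) ≈ f (x ∷ r) + f (y ∷ r)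
    add (altₛ p _ _ _ _) = p

    scale : Alt (suc n) f → ∀ a x r → f ((a *ᵛ x) ∷ r) ≈ a * f (x ∷ r)
    scale (altₛ _ p _ _ _) = p

    null : Alt (suc n) f → ∀ x → Null n (λ r → f (x ∷ r)) x
    null (altₛ _ _ p _ _) = p

    fix : Alt (suc n) f → ∀ x → Alt n (λ r → f (x ∷ r))
    fix (altₛ _ _ _ _ p) = p

    zero-row : Alt (suc n) f → ∀ {x} r → (∀ i → x i ≈ 0#) → f (x ∷ r) ≈ 0#
    zero-row a {x} r x≈0 = begin
      f (x ∷ r)         ≈⟨ cong a (∷-cong (λ i → trans (x≈0 i) (sym (zeroˡ (x i)))) (λ i j → refl)) ⟩
      f ((0# *ᵛ x) ∷ r) ≈⟨ scale a 0# x r ⟩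
      0# * f (x ∷ r)    ≈⟨ zeroˡ _ ⟩
      0#                ∎

    combination : Alt (suc n) f → ∀ {k} (a : Vec k) (X : Vector (Vec m) k) r →
                  f ((λ i → ∑ k (λ j → a j * X j i)) ∷ r) ≈ ∑ k (λ j → a j * f (X j ∷ r))
    combination alt {zero}  a X r = trans (zero-row alt r (λ i → ∑-zero _)) (sym (∑-zero _))
    combination alt {suc k} a X r =
      trans (cong alt (∷-cong (λ i → ∑-suc _) (λ _ _ → refl)))
        (trans (add alt (head a *ᵛ head X) _ r) (trans (+-cong (scale alt _ _ _) (combination alt (tail a) (tail X) r)) (sym (∑-suc _))))

  -- Polarisation: the form vanishes when both leading rows are x + y, and of its four terms the two
  -- with equal rows vanish as well.
  swap : ∀ {m n} {f : Form m (suc (suc n))} → Alt (suc (suc n)) f → ∀ x y r → f (x ∷ y ∷ r) ≈ - f (y ∷ x ∷ r)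
  swap {f = f} a x y r = inverseˡ-unique _ _ (begin
    f (x ∷ y ∷ r) + f (y ∷ x ∷ r)
      ≈⟨ +-cong (+-identityˡ _) (+-identityʳ _) ⟨
    (0# + f (x ∷ y ∷ r)) + (f (y ∷ x ∷ r) + 0#)
      ≈⟨ +-cong (+-congʳ (null a x r)) (+-congˡ (null a y r)) ⟨
    (f (x ∷ x ∷ r) + f (x ∷ y ∷ r)) + (f (y ∷ x ∷ r) + f (y ∷ y ∷ r))
      ≈⟨ +-cong (add (fix a x) x y r) (add (fix a y) x y r) ⟨
    f (x ∷ (x +ᵛ y) ∷ r) + f (y ∷ (x +ᵛ y) ∷ r)
      ≈⟨ add a x y ((x +ᵛ y) ∷ r) ⟨
    f ((x +ᵛ y) ∷ (x +ᵛ y) ∷ r)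
      ≈⟨ null a (x +ᵛ y) r ⟩
    0# ∎)

  repeated : ∀ {m n} {f : Form m (suc n)} → Alt (suc n) f → ∀ x r j → r j ≋ᵛ x → f (x ∷ r) ≈ 0#
  repeated {n = suc n} {f} a x r zero    r≋x = trans
    (cong a (∷-cong (λ _ → refl) (λ i j → trans (sym (∷-η r i j)) (∷-cong {A = tail r} r≋x (λ _ _ → refl) i j))))
    (null a x (tail r))
  repeated {n = suc n} {f} a x r (suc j) r≋x = begin
    f (x ∷ r)                ≈⟨ cong a (∷-cong (λ _ → refl) (λ i j → sym (∷-η r i j))) ⟩
    f (x ∷ head r ∷ tail r)  ≈⟨ swap a x (head r) (tail r) ⟩
    - f (head r ∷ x ∷ tail r) ≈⟨ -‿cong (repeated (fix a (head r)) x (tail r) j r≋x) ⟩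
    - 0#                     ≈⟨ -0#≈0# ⟩
    0#                       ∎

  -- Each added multiple of `x` contributes a form in which `x` occurs twice. Only the row next to
  -- `x` is treated directly; then `x` is swapped past it and the recursion works on the rows below.
  shear : ∀ {m n} {f : Form m (suc n)} → Alt (suc n) f → ∀ x r r′ (a : Vec n) →
          (∀ i → r′ i ≋ᵛ (r i +ᵛ (a i *ᵛ x))) → f (x ∷ r′) ≈ f (x ∷ r)
  shear {n = zero}  alt x r r′ a eq = cong alt (∷-cong (λ _ → refl) (λ ()))
  shear {n = suc n} {f} alt x r r′ a eq = begin
    f (x ∷ r′)
      ≈⟨ cong alt (∷-cong (λ _ → refl) (λ i j → sym (∷-η r′ i j))) ⟩
    f (x ∷ y′ ∷ tail r′)
      ≈⟨ cong alt (∷-cong (λ _ → refl) (∷-cong (eq zero) (λ _ _ → refl))) ⟩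
    f (x ∷ (y +ᵛ (a zero *ᵛ x)) ∷ tail r′)
      ≈⟨ add (fix alt x) y (a zero *ᵛ x) (tail r′) ⟩
    f (x ∷ y ∷ tail r′) + f (x ∷ (a zero *ᵛ x) ∷ tail r′)
      ≈⟨ +-congˡ (trans (scale (fix alt x) (a zero) x (tail r′)) (trans (*-congˡ (null alt x (tail r′))) (zeroʳ _))) ⟩
    f (x ∷ y ∷ tail r′) + 0#
      ≈⟨ +-identityʳ _ ⟩
    f (x ∷ y ∷ tail r′)
      ≈⟨ swap alt x y (tail r′) ⟩
    - f (y ∷ x ∷ tail r′)
      ≈⟨ -‿cong (shear (fix alt y) x (tail r) (tail r′) (tail a) (eq ∘ suc)) ⟩
    - f (y ∷ x ∷ tail r)
      ≈⟨ swap alt x y (tail r) ⟨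
    f (x ∷ y ∷ tail r)
      ≈⟨ cong alt (∷-cong (λ _ → refl) (∷-η r)) ⟩
    f (x ∷ r) ∎
    where
    y = head r
    y′ = head r′

  sgn : ∀ {n} → Fin n → Carrier
  sgn zero    = 1#
  sgn (suc i) = - sgn i

  -- Row `j` reaches the front by adjacent swaps, one for each row above it.
  cycle : ∀ {m n} {f : Form m (suc n)} → Alt (suc n) f → ∀ (A : Vector (Vec m) (suc n)) j →
          f (A j ∷ (A ∘ punchIn j)) ≈ sgn j * f A
  cycle {f = f} alt A zero = trans (cong alt (∷-η A)) (sym (*-identityˡ _))
  cycle {n = suc n} {f} alt A (suc j) = begin
    f (A (suc j) ∷ (A ∘ punchIn (suc j)))
      ≈⟨ cong alt (∷-cong (λ _ → refl) (λ i k → sym (∷-η (A ∘ punchIn (suc j)) i k))) ⟩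
    f (A (suc j) ∷ head A ∷ (tail A ∘ punchIn j))
      ≈⟨ swap alt _ _ _ ⟩
    - f (head A ∷ A (suc j) ∷ (tail A ∘ punchIn j))
      ≈⟨ -‿cong (cycle (fix alt (head A)) (tail A) j) ⟩
    - (sgn j * f (head A ∷ tail A))
      ≈⟨ -‿distribˡ-* _ _ ⟩
    - sgn j * f (head A ∷ tail A)
      ≈⟨ *-congˡ (cong alt (∷-η A)) ⟩
    - sgn j * f A ∎

  Alt-resp : ∀ {m n} {f g : Form m n} → (∀ A → f A ≈ g A) → Alt n f → Alt n g
  Alt-resp f≈g (alt₀ c) = alt₀ (λ e → trans (sym (f≈g _)) (trans (c e) (f≈g _)))
  Alt-resp {n = suc n} {f} {g} f≈g a@(altₛ p q r c s) = altₛ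
    (λ x y r → trans (sym (f≈g _)) (trans (p x y r) (+-cong (f≈g _) (f≈g _))))
    (λ a x r → trans (sym (f≈g _)) (trans (q a x r) (*-congˡ (f≈g _))))
    (nul n f≈g (null a))
    (λ e → trans (sym (f≈g _)) (trans (c e) (f≈g _)))
    (λ x → Alt-resp (λ A → f≈g (x ∷ A)) (s x))
    where
    nul : ∀ n {f g : Form _ (suc n)} → (∀ A → f A ≈ g A) →
          (∀ x → Null n (λ r → f (x ∷ r)) x) → ∀ x → Null n (λ r → g (x ∷ r)) x
    nul zero    _  _ x   = lift _
    nul (suc n) eq h x r = trans (sym (eq _)) (h x r)

  Alt-linear : ∀ {m n} {f g : Form m n} a b → Alt n f → Alt n g → Alt n (λ A → a * f A + b * g A)
  Alt-linear a b (alt₀ p) (alt₀ q) = alt₀ (λ e → +-cong (*-congˡ (p e)) (*-congˡ (q e)))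
  Alt-linear {n = suc n} {f} {g} a b F@(altₛ _ _ _ _ _) G@(altₛ _ _ _ _ _) = altₛ
    (λ x y r → begin
      a * f ((x +ᵛ y) ∷ r) + b * g ((x +ᵛ y) ∷ r)
        ≈⟨ +-cong (*-congˡ (add F x y r)) (*-congˡ (add G x y r)) ⟩
      a * (f (x ∷ r) + f (y ∷ r)) + b * (g (x ∷ r) + g (y ∷ r))
        ≈⟨ +-cong (distribˡ _ _ _) (distribˡ _ _ _) ⟩
      (a * f (x ∷ r) + a * f (y ∷ r)) + (b * g (x ∷ r) + b * g (y ∷ r))
        ≈⟨ +-interchange _ _ _ _ ⟩
      (a * f (x ∷ r) + b * g (x ∷ r)) + (a * f (y ∷ r) + b * g (y ∷ r)) ∎)
    (λ c x r → begin
      a * f ((c *ᵛ x) ∷ r) + b * g ((c *ᵛ x) ∷ r)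
        ≈⟨ +-cong (*-congˡ (scale F c x r)) (*-congˡ (scale G c x r)) ⟩
      a * (c * f (x ∷ r)) + b * (c * g (x ∷ r))
        ≈⟨ +-cong (x∙yz≈y∙xz _ _ _) (x∙yz≈y∙xz _ _ _) ⟩
      c * (a * f (x ∷ r)) + c * (b * g (x ∷ r))
        ≈⟨ distribˡ _ _ _ ⟨
      c * (a * f (x ∷ r) + b * g (x ∷ r)) ∎)
    (nul n {f} {g} (null F) (null G))
    (λ e → +-cong (*-congˡ (cong F e)) (*-congˡ (cong G e)))
    (λ x → Alt-linear a b (fix F x) (fix G x))
    where
    nul : ∀ n {f g : Form _ (suc n)} → (∀ x → Null n (λ r → f (x ∷ r)) x) →
          (∀ x → Null n (λ r → g (x ∷ r)) x) → ∀ x → Null n (λ r → a * f (x ∷ r) + b * g (x ∷ r)) x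
    nul zero    _ _ x   = lift _
    nul (suc n) p q x r = trans (+-cong (trans (*-congˡ (p x r)) (zeroʳ a)) (trans (*-congˡ (q x r)) (zeroʳ b))) (+-identityˡ 0#)

  record Linear {m m′} (φ : Vec m → Vec m′) : Set (c ⊔ ℓ) where
    field
      φ-cong : ∀ {u v} → u ≋ᵛ v → φ u ≋ᵛ φ v
      φ-add : ∀ u v → φ (u +ᵛ v) ≋ᵛ (φ u +ᵛ φ v)
      φ-scale : ∀ a u → φ (a *ᵛ u) ≋ᵛ (a *ᵛ φ u)

  map-∷ : ∀ {m m′ n} (φ : Vec m → Vec m′) (x : Vec m) (r : Vector (Vec m) n) →
          (φ ∘ (x ∷ r)) ≋ᵐ (φ x ∷ (φ ∘ r))
  map-∷ φ x r zero    j = refl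
  map-∷ φ x r (suc i) j = refl

  -- Needed for three maps on rows: `tail`, `insert₀ j`, and multiplication by a matrix.
  Alt-∘ : ∀ {m m′ n} {f : Form m′ n} {φ : Vec m → Vec m′} → Linear φ → Alt n f → Alt n (λ A → f (φ ∘ A))
  Alt-∘ φ-lin (alt₀ c) = alt₀ (λ e → c (λ ()))
  Alt-∘ {n = suc n} {f} {φ} φ-lin F@(altₛ _ _ _ _ _) = altₛ
    (λ x y r → begin
      f (φ ∘ ((x +ᵛ y) ∷ r))          ≈⟨ cong F (map-∷ φ _ r) ⟩
      f (φ (x +ᵛ y) ∷ (φ ∘ r))        ≈⟨ cong F (∷-cong (φ-add x y) (λ _ _ → refl)) ⟩
      f ((φ x +ᵛ φ y) ∷ (φ ∘ r))      ≈⟨ add F _ _ _ ⟩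
      f (φ x ∷ (φ ∘ r)) + f (φ y ∷ (φ ∘ r)) ≈⟨ +-cong (cong F (map-∷ φ x r)) (cong F (map-∷ φ y r)) ⟨
      f (φ ∘ (x ∷ r)) + f (φ ∘ (y ∷ r)) ∎)
    (λ a x r → begin
      f (φ ∘ ((a *ᵛ x) ∷ r))          ≈⟨ cong F (map-∷ φ _ r) ⟩
      f (φ (a *ᵛ x) ∷ (φ ∘ r))        ≈⟨ cong F (∷-cong (φ-scale a x) (λ _ _ → refl)) ⟩
      f ((a *ᵛ φ x) ∷ (φ ∘ r))        ≈⟨ scale F _ _ _ ⟩
      a * f (φ x ∷ (φ ∘ r))           ≈⟨ *-congˡ (cong F (map-∷ φ x r)) ⟨
      a * f (φ ∘ (x ∷ r)) ∎)
    (nul n (cong F) (null F))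
    (λ e → cong F (λ i → φ-cong (e i)))
    (λ x → Alt-resp (λ A → cong F (λ i j → sym (map-∷ φ x A i j))) (Alt-∘ φ-lin (fix F (φ x))))
    where
    open Linear φ-lin
    nul : ∀ n {f : Form _ (suc n)} → Cong f → (∀ x → Null n (λ r → f (x ∷ r)) x) →
          ∀ x → Null n (λ r → f (φ ∘ (x ∷ r))) x
    nul zero    _  _ x   = lift _
    nul (suc n) cf h x r = trans
      (cf λ { zero j → refl ; (suc zero) j → refl ; (suc (suc i)) j → refl })
      (h (φ x) (φ ∘ r))

  -- Laplace expansion along the first column.
  Δ : ∀ {m} n → Form m n → Form (suc m) (suc n)
  Δ zero    f A = A zero zero * f []
  Δ (suc n) f A = A zero zero * f (map tail (tail A)) - Δ n (λ r → f (tail (A zero) ∷ r)) (tail A)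

  D : ∀ n → Form n n
  D zero    A = 1#
  D (suc n) A = Δ n (D n) A

  Δ-resp : ∀ {m n} {f g : Form m n} → (∀ A → f A ≈ g A) → ∀ A → Δ n f A ≈ Δ n g A
  Δ-resp {n = zero}  f≈g A = *-congˡ (f≈g [])
  Δ-resp {n = suc n} f≈g A = +-cong (*-congˡ (f≈g _)) (-‿cong (Δ-resp (λ r → f≈g _) (tail A)))

  Δ-cong : ∀ {m n} {f : Form m n} → Cong f → Cong (Δ n f)
  Δ-cong {n = zero}  c e = *-congʳ (e zero zero)
  Δ-cong {n = suc n} {f} c {A} {B} e = +-cong (*-cong (e zero zero) (c (λ i j → e (suc i) (suc j))))
    (-‿cong (trans (Δ-resp (λ r → c (∷-cong (λ j → e zero (suc j)) (λ _ _ → refl))) (tail A))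
                   (Δ-cong (λ e′ → c (∷-cong (λ _ → refl) e′)) (λ i j → e (suc i) j))))

  Δ-+ : ∀ {m n} (f g : Form m n) A → Δ n (λ r → f r + g r) A ≈ Δ n f A + Δ n g A
  Δ-+ {n = zero}  f g A = distribˡ _ _ _
  Δ-+ {n = suc n} f g A = begin
    x * (F + G) - Δ n _ (tail A)        ≈⟨ +-cong (distribˡ _ _ _) (-‿cong (Δ-+ _ _ (tail A))) ⟩
    (x * F + x * G) - (ΔF + ΔG)         ≈⟨ +-congˡ (-‿+-comm _ _) ⟨
    (x * F + x * G) + (- ΔF + - ΔG)     ≈⟨ +-interchange _ _ _ _ ⟩
    (x * F - ΔF) + (x * G - ΔG)         ∎
    where
    x = A zero zero
    F = f (map tail (tail A))
    G = g (map tail (tail A))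
    ΔF = Δ n (λ r → f (tail (A zero) ∷ r)) (tail A)
    ΔG = Δ n (λ r → g (tail (A zero) ∷ r)) (tail A)

  Δ-* : ∀ {m n} a (f : Form m n) A → Δ n (λ r → a * f r) A ≈ a * Δ n f A
  Δ-* {n = zero}  a f A = x∙yz≈y∙xz _ _ _
  Δ-* {n = suc n} a f A = begin
    A zero zero * (a * f _) - Δ n _ (tail A)
      ≈⟨ +-cong (x∙yz≈y∙xz _ _ _) (-‿cong (Δ-* a _ (tail A))) ⟩
    a * (A zero zero * f _) - a * Δ n _ (tail A)
      ≈⟨ +-congˡ (-‿distribʳ-* _ _) ⟩
    a * (A zero zero * f _) + a * - Δ n _ (tail A)
      ≈⟨ distribˡ _ _ _ ⟨
    a * Δ (suc n) f A ∎

  Δ-0 : ∀ {m n} {f : Form m n} → (∀ r → f r ≈ 0#) → ∀ A → Δ n f A ≈ 0#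
  Δ-0 {n = zero}  f≈0 A = trans (*-congˡ (f≈0 _)) (zeroʳ _)
  Δ-0 {n = suc n} f≈0 A = trans
    (+-cong (trans (*-congˡ (f≈0 _)) (zeroʳ _)) (trans (-‿cong (Δ-0 (λ _ → f≈0 _) (tail A))) -0#≈0#))
    (+-identityʳ 0#)

  Δ-0-column : ∀ {m n} {f : Form m n} A → (∀ i → A i zero ≈ 0#) → Δ n f A ≈ 0#
  Δ-0-column {n = zero}  A A≈0 = trans (*-congʳ (A≈0 zero)) (zeroˡ _)
  Δ-0-column {n = suc n} A A≈0 = trans
    (+-cong (trans (*-congʳ (A≈0 zero)) (zeroˡ _)) (trans (-‿cong (Δ-0-column (tail A) (A≈0 ∘ suc))) -0#≈0#))
    (+-identityʳ 0#)

  tail-linear : ∀ {m} → Linear {suc m} tail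
  tail-linear = record { φ-cong = λ e i → e (suc i) ; φ-add = λ _ _ _ → refl ; φ-scale = λ _ _ _ → refl }

  -- For a fixed first row, `Δ (suc n) f` is a combination of the pullback of `f` along `tail` and a
  -- smaller `Δ`, both alternating in the remaining rows. If the two leading rows are equal, the two
  -- outer terms cancel and the inner `Δ` expands a form that is zero.
  Alt-Δ : ∀ {m} n {f : Form m n} → Alt n f → Alt (suc n) (Δ n f)
  Alt-Δ zero {f} F = altₛ
    (λ x y r → distribʳ _ _ _)
    (λ a x r → *-assoc _ _ _)
    (λ _ → lift _)
    (Δ-cong (cong F))
    (λ x → alt₀ (λ _ → refl))
  Alt-Δ (suc n) {f} F = altₛ
    (λ x y r → begin
      (x zero + y zero) * T r - Δ n (λ r′ → f (tail (x +ᵛ y) ∷ r′)) r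
        ≈⟨ +-cong (distribʳ _ _ _) (-‿cong (trans (Δ-resp (λ r′ → add F (tail x) (tail y) r′) r) (Δ-+ _ _ r))) ⟩
      (x zero * T r + y zero * T r) - (Δx x r + Δx y r)
        ≈⟨ +-congˡ (-‿+-comm _ _) ⟨
      (x zero * T r + y zero * T r) + (- Δx x r + - Δx y r)
        ≈⟨ +-interchange _ _ _ _ ⟩
      (x zero * T r - Δx x r) + (y zero * T r - Δx y r) ∎)
    (λ a x r → begin
      (a * x zero) * T r - Δ n (λ r′ → f (tail (a *ᵛ x) ∷ r′)) r
        ≈⟨ +-cong (*-assoc _ _ _) (-‿cong (trans (Δ-resp (λ r′ → scale F a (tail x) r′) r) (Δ-* a _ r))) ⟩
      a * (x zero * T r) - a * Δx x r
        ≈⟨ +-congˡ (-‿distribʳ-* _ _) ⟩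
      a * (x zero * T r) + a * - Δx x r
        ≈⟨ distribˡ _ _ _ ⟨
      a * (x zero * T r - Δx x r) ∎)
    (nul n F)
    (Δ-cong (cong F))
    (λ x → Alt-resp
      (λ r → +-congˡ (-1*x≈-x _))
      (Alt-linear (x zero) (- 1#) (Alt-∘ tail-linear F) (Alt-Δ n (fix F (tail x)))))
    where
    T : Form _ (suc n)
    T r = f (map tail r)
    Δx : Vec _ → Form _ (suc n)
    Δx x r = Δ n (λ r′ → f (tail x ∷ r′)) r
    nul : ∀ {m} n {f : Form m (suc n)} → Alt (suc n) f → ∀ x r → Δ (suc n) f (x ∷ x ∷ r) ≈ 0#
    nul zero F x r = trans
      (+-congˡ (-‿cong (*-congˡ (cong F λ { zero j → refl }))))
      (-‿inverseʳ _)
    nul (suc n) {f} F x r = begin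
      x zero * f (map tail (x ∷ r)) - (x zero * f (tail x ∷ map tail r) - Δ n (λ r′ → f (tail x ∷ tail x ∷ r′)) r)
        ≈⟨ +-cong (*-congˡ (cong F (map-∷ tail x r))) (-‿cong (+-congˡ (-‿cong (Δ-0 (null F (tail x)) r)))) ⟩
      x zero * f (tail x ∷ map tail r) - (x zero * f (tail x ∷ map tail r) - 0#)
        ≈⟨ +-congˡ (-‿cong (trans (+-congˡ -0#≈0#) (+-identityʳ _))) ⟩
      x zero * f (tail x ∷ map tail r) - x zero * f (tail x ∷ map tail r)
        ≈⟨ -‿inverseʳ _ ⟩
      0# ∎

  D-alt : ∀ n → Alt n (D n)
  D-alt zero    = alt₀ (λ _ → refl)
  D-alt (suc n) = Alt-Δ n (D-alt n)

  D-cong : ∀ {n} → Cong (D n)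
  D-cong {n} = cong (D-alt n)

  minorᵣ : ∀ {n} → Vector (Vec (suc n)) (suc n) → Fin (suc n) → Vector (Vec n) n
  minorᵣ A k i j = A (punchIn k i) (suc j)

  Δ-expand : ∀ {m n} {f : Form m n} → Cong f → ∀ A →
             Δ n f A ≈ ∑ (suc n) (λ k → sgn k * (A k zero * f (λ i j → A (punchIn k i) (suc j))))
  Δ-expand {n = zero}  c A = trans (*-congˡ (c (λ ()))) (sym (trans (∑-suc _) (trans (+-congˡ (∑-zero _)) (trans (+-identityʳ _) (*-identityˡ _)))))
  Δ-expand {n = suc n} {f} c A = trans (+-cong (sym (*-identityˡ _)) (begin
    - Δ n (λ r → f (tail (A zero) ∷ r)) (tail A)
      ≈⟨ -‿cong (Δ-expand (λ e → c (∷-cong (λ _ → refl) e)) (tail A)) ⟩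
    - (∑ (suc n) t)
      ≈⟨ -1*x≈-x _ ⟨
    - 1# * (∑ (suc n) t)
      ≈⟨ ∑-*ˡ _ t ⟨
    ∑ (suc n) (λ k → - 1# * t k)
      ≈⟨ ∑-cong (λ k → trans (-1*x≈-x (t k)) (trans (-‿distribˡ-* _ _) (*-congˡ (*-congˡ (c (eq k)))))) ⟩
    ∑ (suc n) (λ k → sgn (suc k) * (A (suc k) zero * f (λ i j → A (punchIn (suc k) i) (suc j)))) ∎)) (sym (∑-suc _))
    where
    t : Fin (suc n) → Carrier
    t k = sgn k * (A (suc k) zero * f (tail (A zero) ∷ (λ i j → A (suc (punchIn k i)) (suc j))))
    eq : ∀ k → (tail (A zero) ∷ (λ i j → A (suc (punchIn k i)) (suc j))) ≋ᵐ (λ i j → A (punchIn (suc k) i) (suc j))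
    eq k zero    j = refl
    eq k (suc i) j = refl

  ι : ∀ {n} → Fin n → Vec n
  ι zero    zero    = 1#
  ι zero    (suc j) = 0#
  ι (suc i) zero    = 0#
  ι (suc i) (suc j) = ι i j

  ι-sym : ∀ {n} (i j : Fin n) → ι i j ≈ ι j i
  ι-sym zero    zero    = refl
  ι-sym zero    (suc j) = refl
  ι-sym (suc i) zero    = refl
  ι-sym (suc i) (suc j) = ι-sym i j

  ∑-ι : ∀ {n} (t : Vec n) i → ∑ n (λ j → t j * ι j i) ≈ t i
  ∑-ι {suc n} t zero    = trans (∑-suc _) (trans (+-cong (*-identityʳ _) (∑-0 (λ j → zeroʳ _))) (+-identityʳ _))
  ∑-ι {suc n} t (suc i) = trans (∑-suc _) (trans (+-cong (zeroʳ _) (∑-ι (tail t) i)) (+-identityˡ _))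

  ι-diag : ∀ {n} (i : Fin n) → ι i i ≈ 1#
  ι-diag zero    = refl
  ι-diag (suc i) = ι-diag i

  ι-off : ∀ {n} {i j : Fin n} → i ≢ j → ι i j ≈ 0#
  ι-off {i = zero}  {zero}  i≢j = contradiction ≡.refl i≢j
  ι-off {i = zero}  {suc j} i≢j = refl
  ι-off {i = suc i} {zero}  i≢j = refl
  ι-off {i = suc i} {suc j} i≢j = ι-off (i≢j ∘ ≡.cong suc)

  sgn² : ∀ {n} (i : Fin n) → sgn i * sgn i ≈ 1#
  sgn² zero    = *-identityˡ 1#
  sgn² (suc i) = trans (sym (-‿distribˡ-* _ _)) (trans (-‿cong (sym (-‿distribʳ-* _ _))) (trans (-‿involutive _) (sgn² i)))

  -- Embeds rows as those whose coordinate `j` vanishes; pulling a form back along this map lowers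
  -- the dimension in `alt-unique`.
  insert₀ : ∀ {n} → Fin (suc n) → Vec n → Vec (suc n)
  insert₀ j v = insertAt v j 0#

  insert₀-linear : ∀ {n} (j : Fin (suc n)) → Linear (insert₀ j)
  insert₀-linear j = record { φ-cong = cg j ; φ-add = ad j ; φ-scale = sc j }
    where
    cg : ∀ {n} (j : Fin (suc n)) {u v} → u ≋ᵛ v → insert₀ j u ≋ᵛ insert₀ j v
    cg zero    e zero    = refl
    cg zero    e (suc i) = e i
    cg {suc n} (suc j) e zero    = e zero
    cg {suc n} (suc j) e (suc i) = cg j (e ∘ suc) i
    ad : ∀ {n} (j : Fin (suc n)) u v → insert₀ j (u +ᵛ v) ≋ᵛ (insert₀ j u +ᵛ insert₀ j v)
    ad zero    u v zero    = sym (+-identityʳ 0#)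
    ad zero    u v (suc i) = refl
    ad {suc n} (suc j) u v zero    = refl
    ad {suc n} (suc j) u v (suc i) = ad j (tail u) (tail v) i
    sc : ∀ {n} (j : Fin (suc n)) a u → insert₀ j (a *ᵛ u) ≋ᵛ (a *ᵛ insert₀ j u)
    sc zero    a u zero    = sym (zeroʳ a)
    sc zero    a u (suc i) = refl
    sc {suc n} (suc j) a u zero    = refl
    sc {suc n} (suc j) a u (suc i) = sc j a (tail u) i

  insert₀-ι : ∀ {n} (j : Fin (suc n)) k → insert₀ j (ι k) ≋ᵛ ι (punchIn j k)
  insert₀-ι zero    k zero    = refl
  insert₀-ι zero    k (suc i) = refl
  insert₀-ι {suc n} (suc j) zero    zero    = refl
  insert₀-ι {suc n} (suc j) zero    (suc i) = zeros j i
    where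
    zeros : ∀ {n} (j : Fin (suc n)) i → insert₀ j (λ _ → 0#) i ≈ 0#
    zeros zero    zero    = refl
    zeros zero    (suc i) = refl
    zeros {suc n} (suc j) zero    = refl
    zeros {suc n} (suc j) (suc i) = zeros j i
  insert₀-ι {suc n} (suc j) (suc k) zero    = refl
  insert₀-ι {suc n} (suc j) (suc k) (suc i) = insert₀-ι j k i

  -- Clearing one coordinate is a shear by the basis row `ι j`; this brings it into the form that
  -- `shear` accepts.
  insert₀-removeAt : ∀ {n} (j : Fin (suc n)) v → insert₀ j (v ∘ punchIn j) ≋ᵛ (v +ᵛ ((- v j) *ᵛ ι j))
  insert₀-removeAt zero    v zero    = sym (trans (+-congˡ (*-identityʳ _)) (-‿inverseʳ _))
  insert₀-removeAt zero    v (suc i) = sym (trans (+-congˡ (zeroʳ _)) (+-identityʳ _))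
  insert₀-removeAt {suc n} (suc j) v zero    = sym (trans (+-congˡ (zeroʳ _)) (+-identityʳ _))
  insert₀-removeAt {suc n} (suc j) v (suc i) = insert₀-removeAt j (tail v) i

  _ᵀ : ∀ {m n} → Vector (Vec m) n → Vector (Vec n) m
  (A ᵀ) i j = A j i

  -- Every alternating multilinear form is a multiple of the determinant: expand the first row in the basis, and clear the
  -- corresponding column in the remaining rows by shears.
  alt-unique : ∀ {n} {f : Form n n} → Alt n f → ∀ A → f A ≈ D n (A ᵀ) * f ι
  alt-unique {zero}  F A = trans (cong F (λ ())) (sym (*-identityˡ _))
  alt-unique {suc n} {f} F A = begin
    f A
      ≈⟨ cong F (λ i j → sym (∷-η A i j)) ⟩
    f (A zero ∷ tail A)
      ≈⟨ cong F (∷-cong (λ i → sym (∑-ι (A zero) i)) (λ _ _ → refl)) ⟩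
    f ((λ i → ∑ (suc n) (λ j → A zero j * ι j i)) ∷ tail A)
      ≈⟨ combination F (A zero) ι (tail A) ⟩
    ∑ (suc n) (λ j → A zero j * f (ι j ∷ tail A))
      ≈⟨ ∑-cong row ⟩
    ∑ (suc n) (λ j → (sgn j * (A zero j * D n (minorᵣ (A ᵀ) j))) * f ι)
      ≈⟨ ∑-*ʳ (f ι) _ ⟩
    (∑ (suc n) (λ j → sgn j * (A zero j * D n (minorᵣ (A ᵀ) j)))) * f ι
      ≈⟨ *-congʳ (Δ-expand D-cong (A ᵀ)) ⟨
    D (suc n) (A ᵀ) * f ι ∎
    where
    row : ∀ j → A zero j * f (ι j ∷ tail A) ≈ (sgn j * (A zero j * D n (minorᵣ (A ᵀ) j))) * f ι
    row j = begin
      A zero j * f (ι j ∷ tail A)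
        ≈⟨ *-congˡ (shear F (ι j) (tail A) _ (λ i → - A (suc i) j) (λ i → insert₀-removeAt j (A (suc i)))) ⟨
      A zero j * f (ι j ∷ (λ i → insert₀ j (A (suc i) ∘ punchIn j)))
        ≈⟨ *-congˡ (alt-unique (Alt-∘ (insert₀-linear j) (fix F (ι j))) (λ i k → A (suc i) (punchIn j k))) ⟩
      A zero j * (M * f (ι j ∷ (insert₀ j ∘ ι)))
        ≈⟨ *-congˡ (*-congˡ (trans (cong F (∷-cong (λ _ → refl) (insert₀-ι j))) (cycle F ι j))) ⟩
      A zero j * (M * (sgn j * f ι))
        ≈⟨ *-congˡ (*-assoc _ _ _) ⟨
      A zero j * ((M * sgn j) * f ι)
        ≈⟨ *-assoc _ _ _ ⟨
      (A zero j * (M * sgn j)) * f ι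
        ≈⟨ *-congʳ (trans (sym (*-assoc _ _ _)) (*-comm _ _)) ⟩
      (sgn j * (A zero j * M)) * f ι ∎
      where
      M = D n (minorᵣ (A ᵀ) j)

  D-column : ∀ n (A : Vector (Vec (suc n)) (suc n)) → (∀ i → A (suc i) zero ≈ 0#) →
             D (suc n) A ≈ A zero zero * D n (λ i j → A (suc i) (suc j))
  D-column zero    A A≈0 = refl
  D-column (suc n) A A≈0 = trans (+-congˡ (trans (-‿cong (Δ-0-column (tail A) A≈0)) -0#≈0#)) (+-identityʳ _)

  D-ι : ∀ n → D n ι ≈ 1#
  D-ι zero    = refl
  D-ι (suc n) = trans (D-column n ι (λ _ → refl)) (trans (*-identityˡ _) (D-ι n))

  -- `alt-unique` applied to `D` itself: the factor is the determinant of the transpose, and `D` is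
  -- 1 at the identity.
  D-ᵀ : ∀ {n} (A : Vector (Vec n) n) → D n (A ᵀ) ≈ D n A
  D-ᵀ {n} A = sym (trans (alt-unique (D-alt n) A) (trans (*-congˡ (D-ι n)) (*-identityʳ _)))

  _⊗_ : ∀ {k m n} → Vector (Vec m) n → Vector (Vec k) m → Vector (Vec k) n
  _⊗_ {m = m} A B i k = ∑ m (λ j → A i j * B j k)

  -- As a function of the rows of `A` the left side is alternating, and its value at the identity is
  -- `D n B`.
  D-⊗ : ∀ {n} (A B : Vector (Vec n) n) → D n (A ⊗ B) ≈ D n A * D n B
  D-⊗ {n} A B = begin
    D n (A ⊗ B)              ≈⟨ alt-unique (Alt-∘ B-linear (D-alt n)) A ⟩
    D n (A ᵀ) * D n (ι ⊗ B)  ≈⟨ *-cong (D-ᵀ A) (D-cong (λ i k → trans (∑-cong (λ j → trans (*-comm _ _) (*-congˡ (ι-sym i j)))) (∑-ι (λ j → B j k) i))) ⟩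
    D n A * D n B            ∎
    where
    B-linear : Linear (λ (v : Vec n) k → ∑ n (λ j → v j * B j k))
    B-linear = record
      { φ-cong  = λ e k → ∑-cong (λ j → *-congʳ (e j))
      ; φ-add   = λ u v k → trans (∑-cong (λ j → distribʳ _ _ _)) (∑-+ _ _)
      ; φ-scale = λ a u k → trans (∑-cong (λ j → *-assoc _ _ _)) (∑-*ˡ a _)
      }

  Δ-map : ∀ {m m′} n {f : Form m′ n} → Cong f → (φ : Fin m′ → Fin m) → ∀ A →
          Δ n (λ r → f (λ i j → r i (φ j))) A ≈ Δ n f (λ i → A i zero ∷ (tail (A i) ∘ φ))
  Δ-map zero    c φ A = *-congˡ (c (λ ()))
  Δ-map (suc n) {f} c φ A = +-congˡ (-‿cong (trans
    (Δ-resp (λ r → c λ { zero j → refl ; (suc i) j → refl }) (tail A))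
    (Δ-map n {λ r → f ((tail (A zero) ∘ φ) ∷ r)} (λ e → c (∷-cong (λ _ → refl) e)) φ (tail A))))

  -- The last `m` rows start with zero, so only the rows above contribute to the expansion. In each
  -- minor that occurs the last rows are the tails of those of `A`; hence `f` has to agree with `g`
  -- only on such arguments.
  Δ-block : ∀ k {p m} (f : Form p (k ℕ.+ m)) (g : Form p k) → Cong g → (A : Vector (Vec (suc p)) (suc k ℕ.+ m)) →
            (∀ i → A (suc k ↑ʳ i) zero ≈ 0#) →
            (∀ r → (∀ i → r (k ↑ʳ i) ≋ᵛ tail (A (suc k ↑ʳ i))) → f r ≈ g (λ i → r (i ↑ˡ m))) →
            Δ (k ℕ.+ m) f A ≈ Δ k g (λ i → A (i ↑ˡ m))
  Δ-block zero {m = zero}  f g cg A A≈0 f≈g = *-congˡ (trans (f≈g [] (λ ())) (cg (λ ())))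
  Δ-block zero {m = suc m} f g cg A A≈0 f≈g = trans
    (+-cong (*-congˡ (trans (f≈g _ (λ i j → refl)) (cg (λ ())))) (trans (-‿cong (Δ-0-column (tail A) A≈0)) -0#≈0#))
    (+-identityʳ _)
  Δ-block (suc k) {m = m} f g cg A A≈0 f≈g = +-cong
    (*-congˡ (f≈g _ (λ i j → refl)))
    (-‿cong (Δ-block k (λ r → f (tail (A zero) ∷ r)) (λ r → g (tail (A zero) ∷ r)) (λ e → cg (∷-cong (λ _ → refl) e)) (tail A) A≈0
      (λ r h → trans (f≈g _ h) (cg λ { zero j → refl ; (suc i) j → refl }))))

  D-block : ∀ k m (A : Vector (Vec (k ℕ.+ m)) (k ℕ.+ m)) → (∀ i j → A (k ↑ʳ i) (j ↑ˡ m) ≈ 0#) →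
            D (k ℕ.+ m) A ≈ D k (λ i j → A (i ↑ˡ m) (j ↑ˡ m)) * D m (λ i j → A (k ↑ʳ i) (k ↑ʳ j))
  D-block zero    m A A≈0 = sym (*-identityˡ _)
  D-block (suc k) m A A≈0 = begin
    Δ (k ℕ.+ m) (D (k ℕ.+ m)) A
      ≈⟨ Δ-block k (D (k ℕ.+ m)) (λ r → b * D k (λ i j → r i (j ↑ˡ m))) (λ e → *-congˡ (D-cong (λ i j → e i (j ↑ˡ m)))) A (λ i → A≈0 i zero)
           (λ r h → trans (D-block k m r (λ i j → trans (h i (j ↑ˡ m)) (A≈0 i (suc j))))
             (trans (*-comm _ _) (*-congʳ (D-cong (λ i j → h i (k ↑ʳ j)))))) ⟩
    Δ k (λ r → b * D k (λ i j → r i (j ↑ˡ m))) (λ i → A (i ↑ˡ m))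
      ≈⟨ Δ-* {n = k} b (λ r → D k (λ i j → r i (j ↑ˡ m))) (λ i → A (i ↑ˡ m)) ⟩
    b * Δ k (λ r → D k (λ i j → r i (j ↑ˡ m))) (λ i → A (i ↑ˡ m))
      ≈⟨ *-congˡ (trans (Δ-map k D-cong (_↑ˡ m) (λ i → A (i ↑ˡ m))) (Δ-cong {n = k} D-cong {A = λ i → A (i ↑ˡ m) zero ∷ (tail (A (i ↑ˡ m)) ∘ (_↑ˡ m))} {B = λ i j → A (i ↑ˡ m) (j ↑ˡ m)} (λ { i zero → refl ; i (suc j) → refl }))) ⟩
    b * D (suc k) (λ i j → A (i ↑ˡ m) (j ↑ˡ m))
      ≈⟨ *-comm _ _ ⟩
    D (suc k) (λ i j → A (i ↑ˡ m) (j ↑ˡ m)) * b ∎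
    where
    b = D m (λ i j → A (suc k ↑ʳ i) (suc k ↑ʳ j))

  -- The cofactor is written as a full determinant in which the unit row `ι l` replaces row `k`.
  -- Moving that row to the front, with its sign, makes linearity in it available through
  -- `combination`.
  adjugate : ∀ n → Vector (Vec n) n → Vector (Vec n) n
  adjugate (suc n) A l k = sgn k * D (suc n) (ι l ∷ (A ∘ punchIn k))

  -- Summation puts row `i` of `A` in the place of row `k`: the result is `A` again if the two
  -- indices agree, and has a repeated row otherwise.
  adjugate-⊗ : ∀ {n} (A : Vector (Vec n) n) i k → (A ⊗ adjugate n A) i k ≈ ι i k * D n A
  adjugate-⊗ {suc n} A i k = begin
    ∑ (suc n) (λ l → A i l * (sgn k * D (suc n) (ι l ∷ (A ∘ punchIn k))))
      ≈⟨ ∑-cong (λ l → x∙yz≈y∙xz _ _ _) ⟩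
    ∑ (suc n) (λ l → sgn k * (A i l * D (suc n) (ι l ∷ (A ∘ punchIn k))))
      ≈⟨ ∑-*ˡ (sgn k) _ ⟩
    sgn k * (∑ (suc n) (λ l → A i l * D (suc n) (ι l ∷ (A ∘ punchIn k))))
      ≈⟨ *-congˡ (combination (D-alt (suc n)) (A i) ι (A ∘ punchIn k)) ⟨
    sgn k * D (suc n) ((λ j → ∑ (suc n) (λ l → A i l * ι l j)) ∷ (A ∘ punchIn k))
      ≈⟨ *-congˡ (D-cong (∷-cong (∑-ι (A i)) (λ _ _ → refl))) ⟩
    sgn k * D (suc n) (A i ∷ (A ∘ punchIn k))
      ≈⟨ go (k ≟ i) ⟩
    ι i k * D (suc n) A ∎
    where
    go : _ → sgn k * D (suc n) (A i ∷ (A ∘ punchIn k)) ≈ ι i k * D (suc n) A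
    go (yes ≡.refl) = trans (*-congˡ (cycle (D-alt (suc n)) A k)) (trans (sym (*-assoc _ _ _)) (*-congʳ (trans (sgn² k) (sym (ι-diag k)))))
    go (no k≢i) = trans
      (trans (*-congˡ (repeated (D-alt (suc n)) (A i) (A ∘ punchIn k) (punchOut k≢i) (λ j → reflexive (≡.cong (λ z → A z j) (punchIn-punchOut k≢i))))) (zeroʳ _))
      (sym (trans (*-congʳ (ι-off (λ e → k≢i (≡.sym e)))) (zeroˡ _)))

open import Data.Integer as ℤ using (ℤ; +_; -_; 0ℤ; 1ℤ; +≤+; -[1+_])
open import Data.Integer.Tactic.RingSolver using (solve-∀)
open import Data.List using (List; []; _∷_; length)
open import Data.Maybe using (Maybe; just; nothing)
open import Data.Nat.Tactic.RingSolver using () renaming (solve-∀ to solve-ℕ)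
open import Data.Vec.Functional using (Vector) renaming (_∷_ to _◂_)
open import Function.Bundles using (_⇔_; mk⇔)
open import Level using (0ℓ)
open import Relation.Binary.Definitions using (tri<; tri≈; tri>)
open import Relation.Binary.PropositionalEquality hiding (setoid)
open import Relation.Nullary.Decidable using (decidable-stable)
open import Tactic.RingSolver using () renaming (solve-∀ to solve-∀-in)
open import Tactic.RingSolver.Core.AlmostCommutativeRing using (AlmostCommutativeRing; fromCommutativeRing)
import Data.Integer.Properties as ℤₚ
import Data.Nat.Properties as ℕₚ
import Relation.Binary.Reasoning.Setoid as SetoidReasoning

-- Integer polynomials as a commutative ring.

module PolynomialRing where

  open import Data.Integer using (_+_; _*_; _-_)

  -- A record, so that the ring solver does not unfold the equality and unification can recover the two sides.
  infix 4 _≃_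
  record _≃_ (p q : Poly) : Set where
    constructor mk
    field at : p ≈ₚ q
  open _≃_ public

  ≃-refl : ∀ {p} → p ≃ p
  ≃-refl = mk λ k → refl

  ≃-sym : ∀ {p q} → p ≃ q → q ≃ p
  ≃-sym (mk e) = mk λ k → sym (e k)

  ≃-trans : ∀ {p q r} → p ≃ q → q ≃ r → p ≃ r
  ≃-trans (mk e) (mk f) = mk λ k → trans (e k) (f k)

  ∷-cong : ∀ {a b p q} → a ≡ b → p ≃ q → (a ∷ p) ≃ (b ∷ q)
  ∷-cong e (mk f) = mk λ { zero → e ; (suc k) → f k }

  coeff-+ : ∀ p q k → coeff (p +ₚ q) k ≡ coeff p k + coeff q k
  coeff-+ []      q       k       = sym (ℤₚ.+-identityˡ _)
  coeff-+ (a ∷ p) []      k       = sym (ℤₚ.+-identityʳ _)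
  coeff-+ (a ∷ p) (b ∷ q) zero    = refl
  coeff-+ (a ∷ p) (b ∷ q) (suc k) = coeff-+ p q k

  coeff-· : ∀ c p k → coeff (c ·ₚ p) k ≡ c * coeff p k
  coeff-· c []      k       = sym (ℤₚ.*-zeroʳ c)
  coeff-· c (a ∷ p) zero    = refl
  coeff-· c (a ∷ p) (suc k) = coeff-· c p k

  +-cong : ∀ {p p′ q q′} → p ≃ p′ → q ≃ q′ → p +ₚ q ≃ p′ +ₚ q′
  +-cong {p} {p′} {q} {q′} (mk e) (mk f) = mk λ k →
    trans (coeff-+ p q k) (trans (cong₂ _+_ (e k) (f k)) (sym (coeff-+ p′ q′ k)))

  ·-cong : ∀ c {p q} → p ≃ q → c ·ₚ p ≃ c ·ₚ q
  ·-cong c {p} {q} (mk e) = mk λ k → trans (coeff-· c p k) (trans (cong (c *_) (e k)) (sym (coeff-· c q k)))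

  +-assoc : ∀ p q r → (p +ₚ q) +ₚ r ≃ p +ₚ (q +ₚ r)
  +-assoc p q r = mk λ k → begin
    coeff ((p +ₚ q) +ₚ r) k                   ≡⟨ trans (coeff-+ (p +ₚ q) r k) (cong (_+ _) (coeff-+ p q k)) ⟩
    (coeff p k + coeff q k) + coeff r k   ≡⟨ ℤₚ.+-assoc (coeff p k) _ _ ⟩
    coeff p k + (coeff q k + coeff r k)   ≡⟨ trans (coeff-+ p (q +ₚ r) k) (cong (λ z → coeff p k + z) (coeff-+ q r k)) ⟨
    coeff (p +ₚ (q +ₚ r)) k                   ∎
    where open ≡-Reasoning

  +-comm : ∀ p q → p +ₚ q ≃ q +ₚ p
  +-comm p q = mk λ k → trans (coeff-+ p q k) (trans (ℤₚ.+-comm (coeff p k) _) (sym (coeff-+ q p k)))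

  +-identityˡ : ∀ p → [] +ₚ p ≃ p
  +-identityˡ p = ≃-refl

  +-identityʳ : ∀ p → p +ₚ [] ≃ p
  +-identityʳ p = +-comm p []

  +-inverseˡ : ∀ p → negₚ p +ₚ p ≃ []
  +-inverseˡ p = mk λ k → trans (coeff-+ (negₚ p) p k)
    (trans (cong (_+ coeff p k) (trans (coeff-· (- 1ℤ) p k) (ℤₚ.-1*i≡-i _))) (ℤₚ.+-inverseˡ (coeff p k)))

  +-inverseʳ : ∀ p → p +ₚ negₚ p ≃ []
  +-inverseʳ p = ≃-trans (+-comm p (negₚ p)) (+-inverseˡ p)

  +-interchange : ∀ p q r s → (p +ₚ q) +ₚ (r +ₚ s) ≃ (p +ₚ r) +ₚ (q +ₚ s)
  +-interchange p q r s = mk λ k → trans (expand p q r s k) (trans (lemma (coeff p k) _ _ _) (sym (expand p r q s k)))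
    where
    expand : ∀ p q r s k → coeff ((p +ₚ q) +ₚ (r +ₚ s)) k ≡ (coeff p k + coeff q k) + (coeff r k + coeff s k)
    expand p q r s k = trans (coeff-+ (p +ₚ q) (r +ₚ s) k) (cong₂ _+_ (coeff-+ p q k) (coeff-+ r s k))
    lemma : ∀ a b c d → (a + b) + (c + d) ≡ (a + c) + (b + d)
    lemma = solve-∀

  ·-+ : ∀ c p q → c ·ₚ (p +ₚ q) ≃ (c ·ₚ p) +ₚ (c ·ₚ q)
  ·-+ c p q = mk λ k → begin
    coeff (c ·ₚ (p +ₚ q)) k                   ≡⟨ trans (coeff-· c (p +ₚ q) k) (cong (c *_) (coeff-+ p q k)) ⟩
    c * (coeff p k + coeff q k)           ≡⟨ ℤₚ.*-distribˡ-+ c _ _ ⟩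
    c * coeff p k + c * coeff q k       ≡⟨ trans (coeff-+ (c ·ₚ p) (c ·ₚ q) k) (cong₂ _+_ (coeff-· c p k) (coeff-· c q k)) ⟨
    coeff ((c ·ₚ p) +ₚ (c ·ₚ q)) k            ∎
    where open ≡-Reasoning

  ·-· : ∀ c d p → (c * d) ·ₚ p ≃ c ·ₚ (d ·ₚ p)
  ·-· c d p = mk λ k → trans (coeff-· (c * d) p k) (trans (ℤₚ.*-assoc c d _)
    (sym (trans (coeff-· c (d ·ₚ p) k) (cong (c *_) (coeff-· d p k)))))

  1-· : ∀ p → 1ℤ ·ₚ p ≃ p
  1-· p = mk λ k → trans (coeff-· 1ℤ p k) (ℤₚ.*-identityˡ _)

  0-· : ∀ p → 0ℤ ·ₚ p ≃ []
  0-· p = mk λ k → coeff-· 0ℤ p k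

  0∷[] : 0ℤ ∷ [] ≃ []
  0∷[] = mk λ { zero → refl ; (suc k) → refl }

  *-zeroʳ : ∀ p → p *ₚ [] ≃ []
  *-zeroʳ []      = ≃-refl
  *-zeroʳ (a ∷ p) = ≃-trans (∷-cong refl (*-zeroʳ p)) 0∷[]

  *-congʳ : ∀ p {q q′} → q ≃ q′ → p *ₚ q ≃ p *ₚ q′
  *-congʳ []      e = ≃-refl
  *-congʳ (a ∷ p) e = +-cong (·-cong a e) (∷-cong refl (*-congʳ p e))

  -- The defining recursion read in the second factor, which turns commutativity into an induction.
  *-∷ : ∀ p b q → p *ₚ (b ∷ q) ≃ (b ·ₚ p) +ₚ (0ℤ ∷ (p *ₚ q))
  *-∷ []      b q = ≃-sym 0∷[]
  *-∷ (a ∷ p) b q = ∷-cong (cong (_+ 0ℤ) (ℤₚ.*-comm a b))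
    (≃-trans (+-cong ≃-refl (*-∷ p b q))
    (≃-trans (≃-sym (+-assoc (a ·ₚ q) (b ·ₚ p) _))
    (≃-trans (+-cong (+-comm (a ·ₚ q) (b ·ₚ p)) ≃-refl)
             (+-assoc (b ·ₚ p) (a ·ₚ q) _))))

  *-comm : ∀ p q → p *ₚ q ≃ q *ₚ p
  *-comm []      q = ≃-sym (*-zeroʳ q)
  *-comm (a ∷ p) q = ≃-trans (+-cong ≃-refl (∷-cong refl (*-comm p q))) (≃-sym (*-∷ q a p))

  *-cong : ∀ {p p′ q q′} → p ≃ p′ → q ≃ q′ → p *ₚ q ≃ p′ *ₚ q′
  *-cong {p} {p′} {q} {q′} e f =
    ≃-trans (*-congʳ p f) (≃-trans (*-comm p q′) (≃-trans (*-congʳ q′ e) (*-comm q′ p′)))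

  *-distribˡ : ∀ p q r → p *ₚ (q +ₚ r) ≃ (p *ₚ q) +ₚ (p *ₚ r)
  *-distribˡ []      q r = ≃-refl
  *-distribˡ (a ∷ p) q r = ≃-trans
    (+-cong (·-+ a q r) (∷-cong refl (*-distribˡ p q r)))
    (+-interchange (a ·ₚ q) (a ·ₚ r) (0ℤ ∷ (p *ₚ q)) (0ℤ ∷ (p *ₚ r)))

  *-distribʳ : ∀ r p q → (p +ₚ q) *ₚ r ≃ (p *ₚ r) +ₚ (q *ₚ r)
  *-distribʳ r p q = ≃-trans (*-comm (p +ₚ q) r) (≃-trans (*-distribˡ r p q) (+-cong (*-comm r p) (*-comm r q)))

  ·-*-assoc : ∀ a p q → (a ·ₚ p) *ₚ q ≃ a ·ₚ (p *ₚ q)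
  ·-*-assoc a []      q = ≃-refl
  ·-*-assoc a (b ∷ p) q = ≃-trans
    (+-cong (·-· a b q) (∷-cong (sym (ℤₚ.*-zeroʳ a)) (·-*-assoc a p q)))
    (≃-sym (·-+ a (b ·ₚ q) (0ℤ ∷ (p *ₚ q))))

  0∷-* : ∀ p q → (0ℤ ∷ p) *ₚ q ≃ 0ℤ ∷ (p *ₚ q)
  0∷-* p q = +-cong (0-· q) ≃-refl

  *-assoc : ∀ p q r → (p *ₚ q) *ₚ r ≃ p *ₚ (q *ₚ r)
  *-assoc []      q r = ≃-refl
  *-assoc (a ∷ p) q r = ≃-trans
    (*-distribʳ r (a ·ₚ q) (0ℤ ∷ (p *ₚ q)))
    (+-cong (·-*-assoc a q r) (≃-trans (0∷-* (p *ₚ q) r) (∷-cong refl (*-assoc p q r))))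

  const-* : ∀ c p → constₚ c *ₚ p ≃ c ·ₚ p
  const-* c p = ≃-trans (+-cong ≃-refl 0∷[]) (+-identityʳ (c ·ₚ p))

  *-identityˡ : ∀ p → constₚ 1ℤ *ₚ p ≃ p
  *-identityˡ p = ≃-trans (const-* 1ℤ p) (1-· p)

  *-identityʳ : ∀ p → p *ₚ constₚ 1ℤ ≃ p
  *-identityʳ p = ≃-trans (*-comm p (constₚ 1ℤ)) (*-identityˡ p)

  polyRing : CommutativeRing 0ℓ 0ℓ
  polyRing = record
    { Carrier = Poly
    ; _≈_ = _≃_
    ; _+_ = _+ₚ_
    ; _*_ = _*ₚ_
    ; -_ = negₚ
    ; 0# = []
    ; 1# = constₚ 1ℤ
    ; isCommutativeRing = record
      { isRing = record
        { +-isAbelianGroup = record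
          { isGroup = record
            { isMonoid = record
              { isSemigroup = record
                { isMagma = record
                  { isEquivalence = record { refl = ≃-refl ; sym = ≃-sym ; trans = ≃-trans }
                  ; ∙-cong = +-cong
                  }
                ; assoc = +-assoc
                }
              ; identity = +-identityˡ , +-identityʳ
              }
            ; inverse = +-inverseˡ , +-inverseʳ
            ; ⁻¹-cong = ·-cong (- 1ℤ)
            }
          ; comm = +-comm
          }
        ; *-cong = *-cong
        ; *-assoc = *-assoc
        ; *-identity = *-identityˡ , *-identityʳ
        ; distrib = *-distribˡ , *-distribʳ
        }
      ; *-comm = *-comm
      }
    }

  zero? : ∀ p → Maybe ([] ≃ p)
  zero? []       = just (mk λ k → refl)
  zero? (+ 0 ∷ p) with zero? p
  ... | just (mk e) = just (mk λ { zero → refl ; (suc k) → e k })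
  ... | nothing = nothing
  zero? (_ ∷ p)  = nothing

  polyACR : AlmostCommutativeRing 0ℓ 0ℓ
  polyACR = fromCommutativeRing polyRing zero?

open PolynomialRing
open CommutativeRing polyRing using (setoid)
module P = Determinant polyRing
module Z = Determinant ℤₚ.+-*-commutativeRing

-- Leading coefficients, evaluation at a matrix, and the Cayley-Hamilton theorem.

module CharacteristicPolynomial where

  open import Data.Integer using (_+_; _*_; _-_)

  -- The recursion of `det` is local to `Defs`. Generalising a determinant of the zero matrix over its arguments gives a
  -- unification problem whose solution is that function.
  mutual
    laplace : ∀ n → (Fin (suc n) → Fin (suc n) → Poly) → ∀ k → (Fin k → Fin (suc n)) → ℤ → Poly
    laplace = _

    laplace-solve : ∀ n → det (suc (suc n)) (λ _ _ → []) ≡ laplace (suc n) (λ _ _ → []) n (λ i → suc (suc i)) (+ 1)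
    laplace-solve n with suc n | (λ (_ _ : Fin (suc (suc n))) → List.[] {A = ℤ}) | (λ (i : Fin n) → Fin.suc (Fin.suc i)) | + 1
    ... | N | M | f | s = refl

  -- `det` expands along the first row and `D` along the first column, so the minors are compared as
  -- transposes and `D-ᵀ` is applied at every level.
  det≃D : ∀ n (M : Matrix Poly n) → det n M ≃ P.D n M
  laplace≃∑ : ∀ n M k f s →
              laplace n M k f s ≃ constₚ s *ₚ P.∑ k (λ i → P.sgn i *ₚ (M zero (f i) *ₚ P.D n (minor M (f i) P.ᵀ)))

  laplace≃∑ n M zero    f s = ≃-sym (≃-trans (*-congʳ (constₚ s) (P.∑-zero _)) (*-zeroʳ (constₚ s)))
  laplace≃∑ n M (suc k) f s = begin
    s ·ₚ (M zero (f zero) *ₚ det n (minor M (f zero))) +ₚ laplace n M k (f ∘ suc) (- s)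
      ≈⟨ +-cong (≃-trans (·-cong s (*-congʳ (M zero (f zero)) (≃-trans (det≃D n _) (≃-sym (P.D-ᵀ (minor M (f zero))))))) (≃-sym (const-* s _)))
                (laplace≃∑ n M k (f ∘ suc) (- s)) ⟩
    constₚ s *ₚ t zero +ₚ constₚ (- s) *ₚ P.∑ k (λ i → P.sgn i *ₚ t (suc i))
      ≈⟨ +-cong {constₚ s *ₚ t zero} ≃-refl (*-cong { constₚ (- s)} {negₚ (constₚ s)} {T} (∷-cong (sym (ℤₚ.-1*i≡-i s)) ≃-refl) ≃-refl) ⟩
    constₚ s *ₚ t zero +ₚ negₚ (constₚ s) *ₚ P.∑ k (λ i → P.sgn i *ₚ t (suc i))
      ≈⟨ lemma (constₚ s) (t zero) T ⟩
    constₚ s *ₚ (constₚ 1ℤ *ₚ t zero +ₚ negₚ (constₚ 1ℤ) *ₚ P.∑ k (λ i → P.sgn i *ₚ t (suc i)))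
      ≈⟨ *-congʳ (constₚ s) (+-cong ≃-refl (≃-trans (≃-sym (P.∑-*ˡ (negₚ (constₚ 1ℤ)) (λ i → P.sgn i *ₚ t (suc i)))) (P.∑-cong (λ i → lemma₂ (P.sgn i) (t (suc i)))))) ⟩
    constₚ s *ₚ (constₚ 1ℤ *ₚ t zero +ₚ P.∑ k (λ i → negₚ (P.sgn i) *ₚ t (suc i)))
      ≈⟨ *-congʳ (constₚ s) (P.∑-suc _) ⟨
    constₚ s *ₚ P.∑ (suc k) (λ i → P.sgn i *ₚ t i) ∎
    where
    open SetoidReasoning setoid
    t : Fin (suc k) → Poly
    t i = M zero (f i) *ₚ P.D n (minor M (f i) P.ᵀ)
    T : Poly
    T = P.∑ k (λ i → P.sgn i *ₚ t (suc i))
    lemma : ∀ s a b → s *ₚ a +ₚ negₚ s *ₚ b ≃ s *ₚ (constₚ 1ℤ *ₚ a +ₚ negₚ (constₚ 1ℤ) *ₚ b)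
    lemma = solve-∀-in polyACR
    lemma₂ : ∀ a b → negₚ (constₚ 1ℤ) *ₚ (a *ₚ b) ≃ negₚ a *ₚ b
    lemma₂ = solve-∀-in polyACR

  det≃D zero    M = ≃-refl
  det≃D (suc n) M = begin
    det (suc n) M
      ≈⟨ laplace≃∑ n M (suc n) (λ i → i) 1ℤ ⟩
    constₚ 1ℤ *ₚ P.∑ (suc n) (λ i → P.sgn i *ₚ (M zero i *ₚ P.D n (minor M i P.ᵀ)))
      ≈⟨ *-identityˡ _ ⟩
    P.∑ (suc n) (λ i → P.sgn i *ₚ (M zero i *ₚ P.D n (minor M i P.ᵀ)))
      ≈⟨ P.Δ-expand P.D-cong (M P.ᵀ) ⟨
    P.D (suc n) (M P.ᵀ)
      ≈⟨ P.D-ᵀ M ⟩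
    P.D (suc n) M ∎
    where open SetoidReasoning setoid

  -- `c` may be zero: the degree is at most `d`, and `c` is the coefficient there. In this form the
  -- property is stable under sums, and hence passes through determinants.
  record HasTop (d : ℕ) (c : ℤ) (p : Poly) : Set where
    field
      above : ∀ k → d ℕ.< k → coeff p k ≡ 0ℤ
      top   : coeff p d ≡ c
  open HasTop

  top-resp : ∀ {d c p q} → p ≃ q → HasTop d c p → HasTop d c q
  top-resp (mk e) h = record { above = λ k d<k → trans (sym (e k)) (above h k d<k) ; top = trans (sym (e _)) (top h) }

  top-+ : ∀ {d a b p q} → HasTop d a p → HasTop d b q → HasTop d (a + b) (p +ₚ q)
  top-+ {p = p} {q} h g = record
    { above = λ k d<k → trans (coeff-+ p q k) (cong₂ _+_ (above h k d<k) (above g k d<k))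
    ; top = trans (coeff-+ p q _) (cong₂ _+_ (top h) (top g)) }

  top-· : ∀ {d a p} c → HasTop d a p → HasTop d (c * a) (c ·ₚ p)
  top-· {p = p} c h = record
    { above = λ k d<k → trans (coeff-· c p k) (trans (cong (c *_) (above h k d<k)) (ℤₚ.*-zeroʳ c))
    ; top = trans (coeff-· c p _) (cong (c *_) (top h)) }

  top-neg : ∀ {d a p} → HasTop d a p → HasTop d (- a) (negₚ p)
  top-neg {a = a} h = subst (λ z → HasTop _ z _) (ℤₚ.-1*i≡-i a) (top-· (- 1ℤ) h)

  top-const : ∀ c → HasTop 0 c (constₚ c)
  top-const c = record { above = λ { (suc k) _ → refl } ; top = refl }

  top-suc : ∀ {d c p} → HasTop d c p → HasTop (suc d) 0ℤ p
  top-suc h = record { above = λ k d<k → above h k (ℕₚ.<-trans (ℕₚ.n<1+n _) d<k) ; top = above h _ (ℕₚ.n<1+n _) }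

  top-tail : ∀ {d c a p} → HasTop (suc d) c (a ∷ p) → HasTop d c p
  top-tail h = record { above = λ k d<k → above h (suc k) (ℕ.s≤s d<k) ; top = top h }

  top-* : ∀ {d e a b} p q → HasTop d a p → HasTop e b q → HasTop (d ℕ.+ e) (a * b) (p *ₚ q)
  top-* {a = a} {b} []      q h g = record { above = λ k _ → refl ; top = sym (trans (cong (_* b) (sym (top h))) (ℤₚ.*-zeroˡ b)) }
  top-* {zero} {e} {a} {b} (c ∷ p) q h g = top-resp (≃-sym eq) (subst (λ z → HasTop e (z * b) (c ·ₚ q)) (top h) (top-· c g))
    where
    eq : (c ∷ p) *ₚ q ≃ c ·ₚ q
    eq = ≃-trans (+-cong ≃-refl (≃-trans (∷-cong refl (*-cong {p} {[]} (mk (λ k → above h (suc k) (ℕ.s≤s ℕ.z≤n))) (≃-refl {q}))) 0∷[]))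
                 (+-identityʳ _)
  top-* {suc d} {e} {a} {b} (c ∷ p) q h g = record
    { above = λ { (suc k) d<k → trans (coeff-+ (c ·ₚ q) _ (suc k)) (trans
        (cong₂ _+_ (high (suc k) (ℕₚ.≤-<-trans (ℕₚ.m≤n+m e (suc d)) d<k)) (above r k (ℕ.s<s⁻¹ d<k))) refl) }
    ; top = trans (coeff-+ (c ·ₚ q) _ (suc (d ℕ.+ e))) (trans
        (cong₂ _+_ (high _ (ℕ.s≤s (ℕₚ.m≤n+m e d))) (top r)) (ℤₚ.+-identityˡ _)) }
    where
    r = top-* p q (top-tail h) g
    high : ∀ k → e ℕ.< k → coeff (c ·ₚ q) k ≡ 0ℤ
    high k e<k = trans (coeff-· c q k) (trans (cong (c *_) (above g k e<k)) (ℤₚ.*-zeroʳ c))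

  top-unique : ∀ {d e a b p} → a ≢ 0ℤ → b ≢ 0ℤ → HasTop d a p → HasTop e b p → d ≡ e
  top-unique {d} {e} a≢0 b≢0 h g with ℕₚ.<-cmp d e
  ... | tri< d<e _ _ = contradiction (trans (sym (top g)) (above h e d<e)) b≢0
  ... | tri≈ _ d≡e _ = d≡e
  ... | tri> _ _ e<d = contradiction (trans (sym (top h)) (above g d e<d)) a≢0

  coeff-beyond : ∀ p k → length p ℕ.≤ k → coeff p k ≡ 0ℤ
  coeff-beyond []      k       _ = refl
  coeff-beyond (a ∷ p) (suc k) l = coeff-beyond p k (ℕ.s≤s⁻¹ l)

  -- Descent on a bound for the length of `u`: if the coefficients of `u` beyond degree `e` vanish,
  -- the coefficient of the product in degree d + e is `a` times that of `u` in degree `e`.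
  top-cancel : ∀ {d a p} → a ≢ 0ℤ → HasTop d a p → ∀ u → p *ₚ u ≃ [] → u ≃ []
  top-cancel {d} {a} {p} a≢0 h u pu≃0 = go (length u) (coeff-beyond u)
    where
    go : ∀ e → (∀ k → e ℕ.≤ k → coeff u k ≡ 0ℤ) → u ≃ []
    go zero    z = mk (λ k → z k ℕ.z≤n)
    go (suc e) z = go e λ k e≤k → [ z k , (λ { refl → u-top }) ]′ (ℕₚ.m≤n⇒m<n∨m≡n e≤k)
      where
      a*u≡0 : a * coeff u e ≡ 0ℤ
      a*u≡0 = trans (sym (top (top-* p u h (record { above = z ; top = refl })))) (at pu≃0 (d ℕ.+ e))
      u-top : coeff u e ≡ 0ℤ
      u-top = [ (λ a≡0 → contradiction a≡0 a≢0) , (λ u≡0 → u≡0) ]′ (ℤₚ.i*j≡0⇒i≡0∨j≡0 a a*u≡0)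

  difference-zero : ∀ {p q} → p +ₚ negₚ q ≃ [] → p ≃ q
  difference-zero {p} {q} e = ≃-trans (lemma p q) (+-cong e ≃-refl)
    where
    lemma : ∀ p q → p ≃ (p +ₚ negₚ q) +ₚ q
    lemma = solve-∀-in polyACR

  *-cancelˡ : ∀ {d a} p {u v} → a ≢ 0ℤ → HasTop d a p → p *ₚ u ≃ p *ₚ v → u ≃ v
  *-cancelˡ p {u} {v} a≢0 h e = difference-zero (top-cancel a≢0 h _ (≃-trans (lemma p u v) (≃-trans (+-cong e ≃-refl) (+-inverseʳ (p *ₚ v)))))
    where
    lemma : ∀ p u v → p *ₚ (u +ₚ negₚ v) ≃ p *ₚ u +ₚ negₚ (p *ₚ v)
    lemma = solve-∀-in polyACR

  -- p² = r² gives (p + r)(p - r) = 0, and p + r has leading coefficient 2.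
  monic-sqrt-unique : ∀ {d p r} → HasTop d 1ℤ p → HasTop d 1ℤ r → p *ₚ p ≃ r *ₚ r → p ≃ r
  monic-sqrt-unique {d} {p} {r} h g e =
    difference-zero (top-cancel (λ ()) (top-+ h g) _ (≃-trans (lemma p r) (≃-trans (+-cong e ≃-refl) (+-inverseʳ (r *ₚ r)))))
    where
    lemma : ∀ p r → (p +ₚ r) *ₚ (p +ₚ negₚ r) ≃ p *ₚ p +ₚ negₚ (r *ₚ r)
    lemma = solve-∀-in polyACR

  -- Taking the coefficient in the top degree commutes with sums and products, hence with the
  -- expansion. For x - S the top coefficients form the identity matrix, whence `charPoly-monic`.
  Δ-top : ∀ {m} n {d} {f : P.Form m n} {g : Z.Form m n} →
          (∀ {r a} → (∀ i j → HasTop 1 (a i j) (r i j)) → HasTop d (g a) (f r)) →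
          ∀ {A B} → (∀ i j → HasTop 1 (B i j) (A i j)) → HasTop (suc d) (Z.Δ n g B) (P.Δ n f A)
  Δ-top zero    h {A} t = top-* (A zero zero) _ (t zero zero) (h (λ ()))
  Δ-top (suc n) h {A} t = top-+
    (top-* (A zero zero) _ (t zero zero) (h (λ i j → t (suc i) (suc j))))
    (top-neg (Δ-top n (λ t′ → h λ { zero j → t zero (suc j) ; (suc i) j → t′ i j }) (t ∘ suc)))

  D-top : ∀ n {A B} → (∀ i j → HasTop 1 (B i j) (A i j)) → HasTop n (Z.D n B) (P.D n A)
  D-top zero    t = top-const 1ℤ
  D-top (suc n) t = Δ-top n (D-top n) t

  charMatrix : ∀ {n} → Matrix ℤ n → Matrix Poly n
  charMatrix S i j = (δ i j ·ₚ X) +ₚ negₚ (constₚ (S i j))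

  charPoly≃D : ∀ n S → charPoly n S ≃ P.D n (charMatrix S)
  charPoly≃D n S = det≃D n (charMatrix S)

  δ≡ι : ∀ {n} (i j : Fin n) → δ i j ≡ Z.ι i j
  δ≡ι zero    zero    = refl
  δ≡ι zero    (suc j) = refl
  δ≡ι (suc i) zero    = refl
  δ≡ι (suc i) (suc j) = δ≡ι i j

  top-X : HasTop 1 1ℤ X
  top-X = record { above = λ { (suc (suc k)) _ → refl ; (suc zero) (ℕ.s≤s ()) } ; top = refl }

  charPoly-monic : ∀ n S → HasTop n 1ℤ (charPoly n S)
  charPoly-monic n S = top-resp (≃-sym (charPoly≃D n S)) (subst (λ z → HasTop n z (P.D n (charMatrix S))) D-δ (D-top n entry-top))
    where
    D-δ : Z.D n δ ≡ 1ℤ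
    D-δ = trans (Z.D-cong {n} δ≡ι) (Z.D-ι n)
    entry-top : ∀ i j → HasTop 1 (δ i j) (charMatrix S i j)
    entry-top i j = subst (λ z → HasTop 1 z (charMatrix S i j)) (trans (ℤₚ.+-identityʳ _) (ℤₚ.*-identityʳ (δ i j)))
       (top-+ (top-· (δ i j) top-X) (top-suc (top-neg (top-const (S i j)))))

  const-∑ : ∀ n (t : Fin n → ℤ) → constₚ (Z.∑ n t) ≃ P.∑ n (constₚ ∘ t)
  const-∑ zero    t = ≃-trans (∷-cong (Z.∑-zero t) ≃-refl) (≃-trans 0∷[] (≃-sym (P.∑-zero _)))
  const-∑ (suc n) t = ≃-trans (∷-cong (Z.∑-suc t) ≃-refl) (≃-trans (+-cong ≃-refl (const-∑ n (t ∘ suc))) (≃-sym (P.∑-suc _)))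

  coeff-∑ : ∀ n (t : Fin n → Poly) k → coeff (P.∑ n t) k ≡ Z.∑ n (λ i → coeff (t i) k)
  coeff-∑ zero    t k = trans (at (P.∑-zero t) k) (sym (Z.∑-zero _))
  coeff-∑ (suc n) t k = trans (at (P.∑-suc t) k) (trans (coeff-+ (t zero) _ k)
    (trans (cong (λ z → coeff (t zero) k + z) (coeff-∑ n (t ∘ suc) k)) (sym (Z.∑-suc _))))

  eval : ∀ {n} → Matrix ℤ n → Poly → Matrix ℤ n
  eval S []      i j = 0ℤ
  eval S (a ∷ p) i j = a * δ i j + (S Z.⊗ eval S p) i j

  module _ {n} (S : Matrix ℤ n) where

    private E = eval S

    ⊗-zeroʳ : ∀ {A B : Matrix ℤ n} → (∀ i j → B i j ≡ 0ℤ) → ∀ i j → (A Z.⊗ B) i j ≡ 0ℤ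
    ⊗-zeroʳ {A} B≡0 i j = Z.∑-0 (λ k → trans (cong (A i k *_) (B≡0 k j)) (ℤₚ.*-zeroʳ (A i k)))

    ⊗-congʳ : ∀ {A B B′ : Matrix ℤ n} → (∀ i j → B i j ≡ B′ i j) → ∀ i j → (A Z.⊗ B) i j ≡ (A Z.⊗ B′) i j
    ⊗-congʳ {A} e i j = Z.∑-cong (λ k → cong (A i k *_) (e k j))

    ⊗-distribˡ : ∀ (A B C : Matrix ℤ n) i j → (A Z.⊗ (λ i j → B i j + C i j)) i j ≡ (A Z.⊗ B) i j + (A Z.⊗ C) i j
    ⊗-distribˡ A B C i j = trans (Z.∑-cong (λ k → ℤₚ.*-distribˡ-+ (A i k) _ _)) (Z.∑-+ _ _)

    ⊗-·ʳ : ∀ c (A B : Matrix ℤ n) i j → (A Z.⊗ (λ i j → c * B i j)) i j ≡ c * (A Z.⊗ B) i j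
    ⊗-·ʳ c A B i j = trans (Z.∑-cong (λ k → lemma (A i k) c (B k j))) (Z.∑-*ˡ c _)
      where
      lemma : ∀ a c b → a * (c * b) ≡ c * (a * b)
      lemma = solve-∀

    ⊗-assoc : ∀ (A B C : Matrix ℤ n) i j → ((A Z.⊗ B) Z.⊗ C) i j ≡ (A Z.⊗ (B Z.⊗ C)) i j
    ⊗-assoc A B C i l = begin
      Z.∑ n (λ k → Z.∑ n (λ j → A i j * B j k) * C k l)
        ≡⟨ Z.∑-cong (λ k → sym (Z.∑-*ʳ (C k l) _)) ⟩
      Z.∑ n (λ k → Z.∑ n (λ j → A i j * B j k * C k l))
        ≡⟨ Z.∑-comm _ ⟩
      Z.∑ n (λ j → Z.∑ n (λ k → A i j * B j k * C k l))
        ≡⟨ Z.∑-cong (λ j → trans (Z.∑-cong (λ k → ℤₚ.*-assoc (A i j) (B j k) (C k l))) (Z.∑-*ˡ (A i j) _)) ⟩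
      Z.∑ n (λ j → A i j * Z.∑ n (λ k → B j k * C k l)) ∎
      where open ≡-Reasoning

    ⊗-δˡ : ∀ (B : Matrix ℤ n) i j → (δ Z.⊗ B) i j ≡ B i j
    ⊗-δˡ B i j = trans (Z.∑-cong (λ k → trans (ℤₚ.*-comm (δ i k) (B k j)) (cong (B k j *_) (trans (δ≡ι i k) (Z.ι-sym i k))))) (Z.∑-ι (λ k → B k j) i)

    eval-zero : ∀ p → p ≃ [] → ∀ i j → E p i j ≡ 0ℤ
    eval-zero []      e i j = refl
    eval-zero (a ∷ p) e i j = cong₂ _+_
      (cong (_* δ i j) (at e zero))
      (⊗-zeroʳ {S} (eval-zero p (mk (λ k → at e (suc k)))) i j)

    eval-cong : ∀ {p q} → p ≃ q → ∀ i j → E p i j ≡ E q i j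
    eval-cong {[]}    {q}     e i j = sym (eval-zero q (≃-sym e) i j)
    eval-cong {a ∷ p} {[]}    e i j = eval-zero (a ∷ p) e i j
    eval-cong {a ∷ p} {b ∷ q} e i j = cong₂ _+_
      (cong (_* δ i j) (at e zero))
      (⊗-congʳ {S} (eval-cong {p} {q} (mk (λ k → at e (suc k)))) i j)

    eval-+ : ∀ p q i j → E (p +ₚ q) i j ≡ E p i j + E q i j
    eval-+ []      q       i j = sym (ℤₚ.+-identityˡ _)
    eval-+ (a ∷ p) []      i j = sym (ℤₚ.+-identityʳ _)
    eval-+ (a ∷ p) (b ∷ q) i j = trans
      (cong (λ z → (a + b) * δ i j + z) (trans (⊗-congʳ {S} (eval-+ p q) i j) (⊗-distribˡ S (E p) (E q) i j)))
      (lemma a b (δ i j) _ _)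
      where
      lemma : ∀ a b d x y → (a + b) * d + (x + y) ≡ (a * d + x) + (b * d + y)
      lemma = solve-∀

    eval-· : ∀ c p i j → E (c ·ₚ p) i j ≡ c * E p i j
    eval-· c []      i j = sym (ℤₚ.*-zeroʳ c)
    eval-· c (a ∷ p) i j = trans
      (cong (λ z → c * a * δ i j + z) (trans (⊗-congʳ {S} (eval-· c p) i j) (⊗-·ʳ c S (E p) i j)))
      (lemma c a (δ i j) _)
      where
      lemma : ∀ c a d x → c * a * d + c * x ≡ c * (a * d + x)
      lemma = solve-∀

    eval-* : ∀ p q i j → E (p *ₚ q) i j ≡ (E p Z.⊗ E q) i j
    eval-* []      q i j = sym (Z.∑-0 (λ k → ℤₚ.*-zeroˡ (E q k j)))
    eval-* (a ∷ p) q i j = begin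
      E (a ·ₚ q +ₚ (0ℤ ∷ p *ₚ q)) i j
        ≡⟨ eval-+ (a ·ₚ q) _ i j ⟩
      E (a ·ₚ q) i j + (0ℤ * δ i j + (S Z.⊗ E (p *ₚ q)) i j)
        ≡⟨ cong₂ (λ x y → x + (0ℤ * δ i j + y)) (eval-· a q i j) (⊗-congʳ {S} (eval-* p q) i j) ⟩
      a * E q i j + (0ℤ * δ i j + (S Z.⊗ (E p Z.⊗ E q)) i j)
        ≡⟨ cong₂ (λ x y → a * x + y) (sym (⊗-δˡ (E q) i j)) (trans (cong₂ _+_ (ℤₚ.*-zeroˡ (δ i j)) (sym (⊗-assoc S (E p) (E q) i j))) (ℤₚ.+-identityˡ _)) ⟩
      a * (δ Z.⊗ E q) i j + ((S Z.⊗ E p) Z.⊗ E q) i j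
        ≡⟨ cong (_+ _) (Z.∑-*ˡ a _) ⟨
      Z.∑ n (λ k → a * (δ i k * E q k j)) + Z.∑ n (λ k → (S Z.⊗ E p) i k * E q k j)
        ≡⟨ Z.∑-+ _ _ ⟨
      Z.∑ n (λ k → a * (δ i k * E q k j) + (S Z.⊗ E p) i k * E q k j)
        ≡⟨ Z.∑-cong (λ k → lemma a (δ i k) (E q k j) _) ⟩
      Z.∑ n (λ k → E (a ∷ p) i k * E q k j) ∎
      where
      open ≡-Reasoning
      lemma : ∀ a d q s → a * (d * q) + s * q ≡ (a * d + s) * q
      lemma = solve-∀

    eval-const : ∀ c i j → E (constₚ c) i j ≡ c * δ i j
    eval-const c i j = trans (cong (λ z → c * δ i j + z) (⊗-zeroʳ {S} (λ _ _ → refl) i j)) (ℤₚ.+-identityʳ _)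

    eval-X : ∀ i j → E X i j ≡ S i j
    eval-X i j = trans (cong₂ _+_ (ℤₚ.*-zeroˡ (δ i j)) (trans (⊗-congʳ {S} (λ k l → trans (eval-const 1ℤ k l) (trans (ℤₚ.*-identityˡ _) (δ≡ι k l))) i j) (Z.∑-ι (S i) j))) (ℤₚ.+-identityˡ _)

    -- Horner's rule: E p telescopes along the recurrence.
    eval-telescope : ∀ p (w : ℕ → Matrix ℤ n) K → (∀ k → K ℕ.≤ k → ∀ i l → w k i l ≡ 0ℤ) →
                     (∀ k i l → coeff p k * δ i l ≡ w k i l + - (S Z.⊗ w (suc k)) i l) →
                     ∀ i l → E p i l ≡ w 0 i l
    eval-telescope [] w zero    w≡0 rec i l = sym (w≡0 0 ℕ.z≤n i l)
    eval-telescope [] w (suc K) w≡0 rec i l = sym (begin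
      w 0 i l                                            ≡⟨ lemma _ ((S Z.⊗ w 1) i l) ⟩
      (w 0 i l + - (S Z.⊗ w 1) i l) + (S Z.⊗ w 1) i l ≡⟨ cong₂ _+_ (sym (rec 0 i l)) (⊗-zeroʳ {S} w₁≡0 i l) ⟩
      0ℤ * δ i l + 0ℤ                                ≡⟨ trans (ℤₚ.+-identityʳ _) (ℤₚ.*-zeroˡ (δ i l)) ⟩
      0ℤ                                                 ∎)
      where
      open ≡-Reasoning
      lemma : ∀ x y → x ≡ (x + - y) + y
      lemma = solve-∀
      w₁≡0 : ∀ i l → w 1 i l ≡ 0ℤ
      w₁≡0 i l = sym (eval-telescope [] (w ∘ suc) K (λ k K≤k → w≡0 (suc k) (ℕ.s≤s K≤k)) (λ k → rec (suc k)) i l)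
    eval-telescope (a ∷ p) w K w≡0 rec i l = begin
      a * δ i l + (S Z.⊗ E p) i l
        ≡⟨ cong₂ _+_ (rec 0 i l) (⊗-congʳ {S} (eval-telescope p (w ∘ suc) K (λ k K≤k → w≡0 (suc k) (ℕₚ.m≤n⇒m≤1+n K≤k)) (λ k → rec (suc k))) i l) ⟩
      (w 0 i l + - (S Z.⊗ w 1) i l) + (S Z.⊗ w 1) i l
        ≡⟨ lemma _ ((S Z.⊗ w 1) i l) ⟩
      w 0 i l ∎
      where
      open ≡-Reasoning
      lemma : ∀ x y → (x + - y) + y ≡ x
      lemma = solve-∀

  bounded : ∀ {n} (b : Fin n → ℕ) → ∃ λ K → ∀ i → b i ℕ.≤ K
  bounded {zero}  b = 0 , λ ()
  bounded {suc n} b with bounded (b ∘ suc)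
  ... | K , h = b zero ℕ.⊔ K , λ { zero → ℕₚ.m≤m⊔n (b zero) K ; (suc i) → ℕₚ.≤-trans (h i) (ℕₚ.m≤n⊔m (b zero) K) }

  ι-coeff : ∀ {n} (i l : Fin n) p k → coeff (P.ι i l *ₚ p) k ≡ δ i l * coeff p k
  ι-coeff zero    zero    p k = trans (at (*-identityˡ p) k) (sym (ℤₚ.*-identityˡ _))
  ι-coeff zero    (suc l) p k = sym (ℤₚ.*-zeroˡ (coeff p k))
  ι-coeff (suc i) zero    p k = sym (ℤₚ.*-zeroˡ (coeff p k))
  ι-coeff (suc i) (suc l) p k = ι-coeff i l p k

  -- With B the adjugate of x - S, comparing coefficients in (x - S) B = p I gives p_k I = B_(k-1) -
  -- S B_k. The family `w` consists of the coefficients of x B, a shift by which k = 0 needs no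
  -- exception: Horner's rule ends with `w 0`, which is zero.
  cayley-hamilton : ∀ n (S : Matrix ℤ n) i l → eval S (charPoly n S) i l ≡ 0ℤ
  cayley-hamilton n S i l = trans (eval-cong S (charPoly≃D n S) i l)
    (eval-telescope S p w K (λ k K≤k i l → coeff-beyond (0ℤ ∷ B i l) k (ℕₚ.≤-trans (K-bound i l) K≤k)) rec i l)
    where
    p = P.D n (charMatrix S)
    B = P.adjugate n (charMatrix S)
    w : ℕ → Matrix ℤ n
    w k i l = coeff (0ℤ ∷ B i l) k
    rows : ∀ i → ∃ λ K → ∀ l → length (0ℤ ∷ B i l) ℕ.≤ K
    rows i = bounded _
    K = proj₁ (bounded (proj₁ ∘ rows))
    K-bound : ∀ i l → length (0ℤ ∷ B i l) ℕ.≤ K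
    K-bound i l = ℕₚ.≤-trans (proj₂ (rows i) l) (proj₂ (bounded (proj₁ ∘ rows)) i)
    X-* : ∀ p → X *ₚ p ≃ 0ℤ ∷ p
    X-* p = ≃-trans (0∷-* (1ℤ ∷ []) p) (∷-cong refl (*-identityˡ p))
    entry : ∀ i j l k → coeff (charMatrix S i j *ₚ B j l) k ≡ w k j l * δ i j + - 1ℤ * (S i j * w (suc k) j l)
    entry i j l k = begin
      coeff (charMatrix S i j *ₚ b) k
        ≡⟨ at (*-distribʳ b (δ i j ·ₚ X) (negₚ (constₚ (S i j)))) k ⟩
      coeff ((δ i j ·ₚ X) *ₚ b +ₚ negₚ (constₚ (S i j)) *ₚ b) k
        ≡⟨ at (+-cong linear constant) k ⟩
      coeff ((δ i j ·ₚ (0ℤ ∷ b)) +ₚ (- 1ℤ) ·ₚ (S i j ·ₚ b)) k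
        ≡⟨ coeff-+ (δ i j ·ₚ (0ℤ ∷ b)) ((- 1ℤ) ·ₚ (S i j ·ₚ b)) k ⟩
      coeff (δ i j ·ₚ (0ℤ ∷ b)) k + coeff ((- 1ℤ) ·ₚ (S i j ·ₚ b)) k
        ≡⟨ cong₂ _+_ (trans (coeff-· (δ i j) (0ℤ ∷ b) k) (ℤₚ.*-comm (δ i j) _)) (trans (coeff-· (- 1ℤ) (S i j ·ₚ b) k) (cong (- 1ℤ *_) (coeff-· (S i j) b k))) ⟩
      w k j l * δ i j + - 1ℤ * (S i j * coeff b k) ∎
      where
      open ≡-Reasoning
      b = B j l
      linear : (δ i j ·ₚ X) *ₚ b ≃ δ i j ·ₚ (0ℤ ∷ b)
      linear = ≃-trans (·-*-assoc (δ i j) X b) (·-cong (δ i j) (X-* b))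
      constant : negₚ (constₚ (S i j)) *ₚ b ≃ (- 1ℤ) ·ₚ (S i j ·ₚ b)
      constant = ≃-trans (·-*-assoc (- 1ℤ) (constₚ (S i j)) b) (·-cong (- 1ℤ) (const-* (S i j) b))
    rec : ∀ k i l → coeff p k * δ i l ≡ w k i l + - (S Z.⊗ w (suc k)) i l
    rec k i l = begin
      coeff p k * δ i l
        ≡⟨ ℤₚ.*-comm (coeff p k) (δ i l) ⟩
      δ i l * coeff p k
        ≡⟨ ι-coeff i l p k ⟨
      coeff (P.ι i l *ₚ p) k
        ≡⟨ at (P.adjugate-⊗ (charMatrix S) i l) k ⟨
      coeff (P.∑ n (λ j → charMatrix S i j *ₚ B j l)) k
        ≡⟨ coeff-∑ n _ k ⟩
      Z.∑ n (λ j → coeff (charMatrix S i j *ₚ B j l) k)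
        ≡⟨ Z.∑-cong (λ j → entry i j l k) ⟩
      Z.∑ n (λ j → w k j l * δ i j + - 1ℤ * (S i j * w (suc k) j l))
        ≡⟨ Z.∑-+ _ _ ⟩
      Z.∑ n (λ j → w k j l * δ i j) + Z.∑ n (λ j → - 1ℤ * (S i j * w (suc k) j l))
        ≡⟨ cong₂ _+_ (trans (Z.∑-cong (λ j → cong (w k j l *_) (trans (δ≡ι i j) (Z.ι-sym i j)))) (Z.∑-ι (λ j → w k j l) i)) (trans (Z.∑-*ˡ (- 1ℤ) _) (ℤₚ.-1*i≡-i _)) ⟩
      w k i l + - (S Z.⊗ w (suc k)) i l ∎
      where open ≡-Reasoning

open CharacteristicPolynomial

-- Skew matrices with S Sᵀ = c and their principal submatrices.

module ConferenceMatrix where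

  open import Data.Integer using (_+_; _*_; _-_)

  Skew : ∀ {n} → Matrix ℤ n → Set
  Skew S = ∀ i j → S j i ≡ - S i j

  gram : ∀ {n} → Matrix ℤ n → Matrix ℤ n
  gram {n} S i j = Z.∑ n (λ k → S i k * S j k)

  -- For a skew Seidel matrix of order c + 1 this defines a skew conference matrix; equivalently, S
  -- + I is a skew Hadamard matrix.
  Conference : ∀ {n} → ℤ → Matrix ℤ n → Set
  Conference c S = ∀ i j → gram S i j ≡ c * δ i j

  quad : ℤ → Poly
  quad c = X *ₚ X +ₚ constₚ c

  const-cong : ∀ {a b} → a ≡ b → constₚ a ≃ constₚ b
  const-cong refl = ≃-refl

  const-*-const : ∀ a b → constₚ a *ₚ constₚ b ≃ constₚ (a * b)
  const-*-const a b = const-* a (constₚ b)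

  δX : ∀ {n} (i j : Fin n) → δ i j ·ₚ X ≃ P.ι i j *ₚ X
  δX zero    zero    = ≃-sym (const-* 1ℤ X)
  δX zero    (suc j) = 0-· X
  δX (suc i) zero    = 0-· X
  δX (suc i) (suc j) = δX i j

  ι-const : ∀ {n} (i j : Fin n) c → constₚ (c * δ i j) ≃ P.ι i j *ₚ constₚ c
  ι-const zero    zero    c = ≃-trans (∷-cong (ℤₚ.*-identityʳ c) ≃-refl) (≃-sym (*-identityˡ (constₚ c)))
  ι-const zero    (suc j) c = ≃-trans (∷-cong (ℤₚ.*-zeroʳ c) ≃-refl) 0∷[]
  ι-const (suc i) zero    c = ≃-trans (∷-cong (ℤₚ.*-zeroʳ c) ≃-refl) 0∷[]
  ι-const (suc i) (suc j) c = ι-const i j c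

  -- Skewness makes x + S the transpose of x - S, and (x - S)(x + S) = x² - S² = x² + S Sᵀ.
  charMatrix-gram : ∀ {n} {S : Matrix ℤ n} {c} → Skew S → Conference c S → ∀ i j →
                    (charMatrix S P.⊗ (charMatrix S P.ᵀ)) i j ≃ P.ι i j *ₚ quad c
  charMatrix-gram {n} {S} {c} skew conf i j = begin
    P.∑ n (λ k → charMatrix S i k *ₚ charMatrix S j k)
      ≈⟨ P.∑-cong entry ⟩
    P.∑ n (λ k → (u k *ₚ P.ι k i +ₚ v k *ₚ P.ι k j) +ₚ constₚ (S i k * S j k))
      ≈⟨ P.∑-+ _ _ ⟩
    P.∑ n (λ k → u k *ₚ P.ι k i +ₚ v k *ₚ P.ι k j) +ₚ P.∑ n (λ k → constₚ (S i k * S j k))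
      ≈⟨ +-cong (P.∑-+ (λ k → u k *ₚ P.ι k i) (λ k → v k *ₚ P.ι k j)) (≃-sym (const-∑ n (λ k → S i k * S j k))) ⟩
    (P.∑ n (λ k → u k *ₚ P.ι k i) +ₚ P.∑ n (λ k → v k *ₚ P.ι k j)) +ₚ constₚ (gram S i j)
      ≈⟨ +-cong (+-cong (P.∑-ι u i) (P.∑-ι v j)) (≃-trans (const-cong (conf i j)) (ι-const i j c)) ⟩
    (u i +ₚ v j) +ₚ P.ι i j *ₚ constₚ c
      ≈⟨ +-cong (≃-trans (+-cong (+-cong (*-cong (≃-refl {X *ₚ X}) (P.ι-sym j i)) (·-cong (- 1ℤ) (*-cong (≃-refl {X}) (const-cong (skew i j))))) (≃-refl {v j})) (cancel (P.ι i j))) ≃-refl ⟩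
    P.ι i j *ₚ (X *ₚ X) +ₚ P.ι i j *ₚ constₚ c
      ≈⟨ *-distribˡ (P.ι i j) (X *ₚ X) (constₚ c) ⟨
    P.ι i j *ₚ quad c ∎
    where
    open SetoidReasoning setoid
    -- The terms are grouped by the factor `P.ι k i` or `P.ι k j` that they carry, so that `∑-ι`
    -- collapses both sums; what is left adds up to the Gram matrix.
    u v : Fin n → Poly
    u k = (X *ₚ X) *ₚ P.ι j k +ₚ negₚ (X *ₚ constₚ (S j k))
    v k = negₚ (X *ₚ constₚ (S i k))
    expand : ∀ X a b s t → (a *ₚ X +ₚ negₚ s) *ₚ (b *ₚ X +ₚ negₚ t) ≃
             (((X *ₚ X) *ₚ b +ₚ negₚ (X *ₚ t)) *ₚ a +ₚ negₚ (X *ₚ s) *ₚ b) +ₚ s *ₚ t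
    expand = solve-∀-in polyACR
    entry : ∀ k → charMatrix S i k *ₚ charMatrix S j k ≃ (u k *ₚ P.ι k i +ₚ v k *ₚ P.ι k j) +ₚ constₚ (S i k * S j k)
    entry k = begin
      charMatrix S i k *ₚ charMatrix S j k
        ≈⟨ *-cong (+-cong (δX i k) (≃-refl {negₚ (constₚ (S i k))})) (+-cong (δX j k) (≃-refl {negₚ (constₚ (S j k))})) ⟩
      (P.ι i k *ₚ X +ₚ negₚ (constₚ (S i k))) *ₚ (P.ι j k *ₚ X +ₚ negₚ (constₚ (S j k)))
        ≈⟨ expand X (P.ι i k) (P.ι j k) (constₚ (S i k)) (constₚ (S j k)) ⟩
      (u k *ₚ P.ι i k +ₚ v k *ₚ P.ι j k) +ₚ constₚ (S i k) *ₚ constₚ (S j k)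
        ≈⟨ +-cong (+-cong (*-cong (≃-refl {u k}) (P.ι-sym i k)) (*-cong (≃-refl {v k}) (P.ι-sym j k))) (const-*-const (S i k) (S j k)) ⟩
      (u k *ₚ P.ι k i +ₚ v k *ₚ P.ι k j) +ₚ constₚ (S i k * S j k) ∎
    cancel′ : ∀ X a s ns → ns +ₚ s ≃ [] → ((X *ₚ X) *ₚ a +ₚ negₚ (X *ₚ ns)) +ₚ negₚ (X *ₚ s) ≃ a *ₚ (X *ₚ X)
    cancel′ X a s ns e = ≃-trans (lemma X a s ns) (≃-trans (+-cong ≃-refl (≃-trans (·-cong (- 1ℤ) (*-cong (≃-refl {X}) e)) (·-cong (- 1ℤ) (*-zeroʳ X)))) (+-identityʳ _))
      where
      lemma : ∀ X a s ns → ((X *ₚ X) *ₚ a +ₚ negₚ (X *ₚ ns)) +ₚ negₚ (X *ₚ s) ≃ a *ₚ (X *ₚ X) +ₚ negₚ (X *ₚ (ns +ₚ s))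
      lemma = solve-∀-in polyACR
    cancel : ∀ a → ((X *ₚ X) *ₚ a +ₚ negₚ (X *ₚ constₚ (- S i j))) +ₚ v j ≃ a *ₚ (X *ₚ X)
    cancel a = cancel′ X a (constₚ (S i j)) (constₚ (- S i j)) (≃-trans (∷-cong (ℤₚ.+-inverseˡ (S i j)) ≃-refl) 0∷[])

  ^-+ : ∀ p a b → p ^ₚ (a ℕ.+ b) ≃ (p ^ₚ a) *ₚ (p ^ₚ b)
  ^-+ p zero    b = ≃-sym (*-identityˡ _)
  ^-+ p (suc a) b = ≃-trans (*-congʳ p (^-+ p a b)) (≃-sym (*-assoc p _ _))

  D-scalar : ∀ n p → P.D n (λ i j → P.ι i j *ₚ p) ≃ p ^ₚ n
  D-scalar zero    p = ≃-refl
  D-scalar (suc n) p = ≃-trans (P.D-column n (λ i j → P.ι i j *ₚ p) (λ i → ≃-refl)) (*-cong (*-identityˡ p) (D-scalar n p))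

  top-quad : ∀ c → HasTop 2 1ℤ (quad c)
  top-quad c = top-+ (top-* X X top-X top-X) (top-suc (top-suc (top-const c)))

  top-^ : ∀ {d p} k → HasTop d 1ℤ p → HasTop (k ℕ.* d) 1ℤ (p ^ₚ k)
  top-^ zero    h = top-const 1ℤ
  top-^ {p = p} (suc k) h = top-* p (p ^ₚ k) h (top-^ k h)

  conference-charPoly : ∀ m {S : Matrix ℤ (m ℕ.* 2)} {c} → Skew S → Conference c S → charPoly (m ℕ.* 2) S ≃ quad c ^ₚ m
  conference-charPoly m {S} {c} skew conf = monic-sqrt-unique (charPoly-monic (m ℕ.* 2) S) (top-^ m (top-quad c)) (begin
    charPoly N S *ₚ charPoly N S              ≈⟨ *-cong (charPoly≃D N S) (charPoly≃D N S) ⟩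
    P.D N C *ₚ P.D N C                        ≈⟨ *-congʳ (P.D N C) (P.D-ᵀ C) ⟨
    P.D N C *ₚ P.D N (C P.ᵀ)                  ≈⟨ P.D-⊗ C (C P.ᵀ) ⟨
    P.D N (C P.⊗ (C P.ᵀ))                     ≈⟨ P.D-cong (charMatrix-gram {c = c} skew conf) ⟩
    P.D N (λ i j → P.ι i j *ₚ quad c)         ≈⟨ D-scalar N (quad c) ⟩
    quad c ^ₚ N                               ≡⟨ cong (quad c ^ₚ_) (trans (ℕₚ.*-comm m 2) (cong (m ℕ.+_) (ℕₚ.+-identityʳ m))) ⟩
    quad c ^ₚ (m ℕ.+ m)                       ≈⟨ ^-+ (quad c) m m ⟩
    (quad c ^ₚ m) *ₚ (quad c ^ₚ m)            ∎)
    where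
    open SetoidReasoning setoid
    N = m ℕ.* 2
    C = charMatrix S

  -- Jacobi's complementary minor identity for x - S, whose inverse is (x + S) / (x² + c).
  complementary-minor : ∀ k m {S : Matrix ℤ (k ℕ.+ m)} {c} → Skew S → Conference c S →
                        charPoly k (λ i j → S (i ↑ˡ m) (j ↑ˡ m)) *ₚ charPoly (k ℕ.+ m) S ≃
                        (quad c ^ₚ k) *ₚ charPoly m (λ i j → S (k ↑ʳ i) (k ↑ʳ j))
  complementary-minor k m {S} {c} skew conf = begin
    charPoly k _ *ₚ charPoly N S
      ≈⟨ *-cong (charPoly≃D k _) (charPoly≃D N S) ⟩
    P.D k (charMatrix (λ i j → S (i ↑ˡ m) (j ↑ˡ m))) *ₚ P.D N C
      ≈⟨ *-cong D-A (≃-sym (P.D-ᵀ C)) ⟩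
    P.D N A *ₚ P.D N (C P.ᵀ)
      ≈⟨ P.D-⊗ A (C P.ᵀ) ⟨
    P.D N B
      ≈⟨ P.D-ᵀ B ⟨
    P.D N (B P.ᵀ)
      ≈⟨ P.D-block k m (B P.ᵀ) (λ i j → ≃-trans (B-top j (k ↑ʳ i)) (*-cong (ι-↑ˡ-↑ʳ k j i) (≃-refl {quad c}))) ⟩
    P.D k (λ i j → B (j ↑ˡ m) (i ↑ˡ m)) *ₚ P.D m (λ i j → B (k ↑ʳ j) (k ↑ʳ i))
      ≈⟨ *-cong (≃-trans (P.D-cong (λ i j → ≃-trans (B-top j (i ↑ˡ m)) (*-cong (≃-trans (ι-↑ˡ m j i) (P.ι-sym j i)) (≃-refl {quad c})))) (D-scalar k (quad c)))
                (≃-trans (P.D-cong (λ i j → ≃-trans (B-bottom j (k ↑ʳ i)) (C-↑ʳ i j))) (≃-sym (charPoly≃D m _))) ⟩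
    (quad c ^ₚ k) *ₚ charPoly m _ ∎
    where
    open SetoidReasoning setoid
    N = k ℕ.+ m
    C = charMatrix S
    row : Fin N → Fin k ⊎ Fin m → Fin N → Poly
    row i (inj₁ _) = C i
    row i (inj₂ _) = P.ι i
    -- `A` agrees with x - S in its first `k` rows and with the identity below, so its determinant
    -- is the leading principal minor. After multiplication by x + S the first rows are unit rows
    -- times x² + c and the others are rows of x + S, so `B` is block triangular.
    A B : Matrix Poly N
    A i = row i (splitAt k i)
    B = A P.⊗ (C P.ᵀ)
    A-top : ∀ a j → A (a ↑ˡ m) j ≡ C (a ↑ˡ m) j
    A-top a j = cong (λ z → row (a ↑ˡ m) z j) (splitAt-↑ˡ k a m)
    A-bottom : ∀ b j → A (k ↑ʳ b) j ≡ P.ι (k ↑ʳ b) j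
    A-bottom b j = cong (λ z → row (k ↑ʳ b) z j) (splitAt-↑ʳ k m b)
    ≡⇒≃ : ∀ {p q} → p ≡ q → p ≃ q
    ≡⇒≃ refl = ≃-refl
    B-top : ∀ a j → B (a ↑ˡ m) j ≃ P.ι (a ↑ˡ m) j *ₚ quad c
    B-top a j = ≃-trans (P.∑-cong (λ l → *-cong (≡⇒≃ (A-top a l)) (≃-refl {C j l}))) (charMatrix-gram {c = c} skew conf (a ↑ˡ m) j)
    B-bottom : ∀ b j → B (k ↑ʳ b) j ≃ C j (k ↑ʳ b)
    B-bottom b j = ≃-trans
      (P.∑-cong (λ l → ≃-trans (*-cong (≃-trans (≡⇒≃ (A-bottom b l)) (P.ι-sym (k ↑ʳ b) l)) (≃-refl {C j l})) (*-comm (P.ι l (k ↑ʳ b)) (C j l))))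
      (P.∑-ι (C j) (k ↑ʳ b))
    ι-↑ˡ : ∀ {k} m (i j : Fin k) → P.ι (i ↑ˡ m) (j ↑ˡ m) ≃ P.ι i j
    ι-↑ˡ m zero    zero    = ≃-refl
    ι-↑ˡ m zero    (suc j) = ≃-refl
    ι-↑ˡ m (suc i) zero    = ≃-refl
    ι-↑ˡ m (suc i) (suc j) = ι-↑ˡ m i j
    ι-↑ˡ-↑ʳ : ∀ k {m} (i : Fin k) (j : Fin m) → P.ι (i ↑ˡ m) (k ↑ʳ j) ≃ []
    ι-↑ˡ-↑ʳ (suc k) zero    j = ≃-refl
    ι-↑ˡ-↑ʳ (suc k) (suc i) j = ι-↑ˡ-↑ʳ k i j
    ι-↑ʳ : ∀ k {m} (i j : Fin m) → P.ι (k ↑ʳ i) (k ↑ʳ j) ≡ P.ι i j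
    ι-↑ʳ zero    i j = refl
    ι-↑ʳ (suc k) i j = ι-↑ʳ k i j
    δ-↑ʳ : ∀ k {m} (i j : Fin m) → δ (k ↑ʳ i) (k ↑ʳ j) ≡ δ i j
    δ-↑ʳ zero    i j = refl
    δ-↑ʳ (suc k) i j = δ-↑ʳ k i j
    δ-↑ˡ : ∀ {k} m (i j : Fin k) → δ (i ↑ˡ m) (j ↑ˡ m) ≡ δ i j
    δ-↑ˡ m zero    zero    = refl
    δ-↑ˡ m zero    (suc j) = refl
    δ-↑ˡ m (suc i) zero    = refl
    δ-↑ˡ m (suc i) (suc j) = δ-↑ˡ m i j
    C-↑ʳ : ∀ i j → C (k ↑ʳ i) (k ↑ʳ j) ≃ charMatrix (λ i j → S (k ↑ʳ i) (k ↑ʳ j)) i j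
    C-↑ʳ i j = ≡⇒≃ (cong (λ z → (z ·ₚ X) +ₚ negₚ (constₚ (S (k ↑ʳ i) (k ↑ʳ j)))) (δ-↑ʳ k i j))
    D-A : P.D k (charMatrix (λ i j → S (i ↑ˡ m) (j ↑ˡ m))) ≃ P.D N A
    D-A = begin
      P.D k (charMatrix (λ i j → S (i ↑ˡ m) (j ↑ˡ m)))
        ≈⟨ P.D-cong (λ i j → ≡⇒≃ (trans (A-top i (j ↑ˡ m)) (cong (λ z → (z ·ₚ X) +ₚ negₚ (constₚ (S (i ↑ˡ m) (j ↑ˡ m)))) (δ-↑ˡ m i j)))) ⟨
      P.D k (λ i j → A (i ↑ˡ m) (j ↑ˡ m))
        ≈⟨ *-identityʳ _ ⟨
      P.D k (λ i j → A (i ↑ˡ m) (j ↑ˡ m)) *ₚ constₚ 1ℤ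
        ≈⟨ *-congʳ (P.D k (λ i j → A (i ↑ˡ m) (j ↑ˡ m))) (≃-trans (P.D-cong (λ i j → ≡⇒≃ (trans (A-bottom i (k ↑ʳ j)) (ι-↑ʳ k i j)))) (P.D-ι m)) ⟨
      P.D k (λ i j → A (i ↑ˡ m) (j ↑ˡ m)) *ₚ P.D m (λ i j → A (k ↑ʳ i) (k ↑ʳ j))
        ≈⟨ P.D-block k m A (λ i j → ≃-trans (≡⇒≃ (A-bottom i (j ↑ˡ m))) (≃-trans (P.ι-sym (k ↑ʳ i) (j ↑ˡ m)) (ι-↑ˡ-↑ʳ k j i))) ⟨
      P.D N A ∎

  square-nonneg : ∀ i → 0ℤ ℤ.≤ i * i
  square-nonneg (+ n)    = subst (0ℤ ℤ.≤_) (ℤₚ.pos-* n n) (+≤+ ℕ.z≤n)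
  square-nonneg -[1+ n ] = +≤+ ℕ.z≤n

  square-zero : ∀ i → i * i ≡ 0ℤ → i ≡ 0ℤ
  square-zero i e = [ (λ z → z) , (λ z → z) ]′ (ℤₚ.i*j≡0⇒i≡0∨j≡0 i e)

  ∑-nonneg : ∀ {n} {t : Fin n → ℤ} → (∀ i → 0ℤ ℤ.≤ t i) → 0ℤ ℤ.≤ Z.∑ n t
  ∑-nonneg {zero}  {t} h = ℤₚ.≤-reflexive (sym (Z.∑-zero t))
  ∑-nonneg {suc n} {t} h = subst (0ℤ ℤ.≤_) (sym (Z.∑-suc t)) (ℤₚ.+-mono-≤ (h zero) (∑-nonneg (h ∘ suc)))

  nonneg-sum-zero : ∀ {a b} → 0ℤ ℤ.≤ a → 0ℤ ℤ.≤ b → a + b ≡ 0ℤ → a ≡ 0ℤ × b ≡ 0ℤ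
  nonneg-sum-zero {+ 0}     {+ 0}     _ _ _ = refl , refl
  nonneg-sum-zero {+ 0}     {+ suc n} _ _ ()
  nonneg-sum-zero {+ suc m} {+ n}     _ _ ()

  ∑-nonneg-zero : ∀ {n} {t : Fin n → ℤ} → (∀ i → 0ℤ ℤ.≤ t i) → Z.∑ n t ≡ 0ℤ → ∀ i → t i ≡ 0ℤ
  ∑-nonneg-zero {suc n} {t} h e = λ { zero → proj₁ split ; (suc i) → ∑-nonneg-zero (h ∘ suc) (proj₂ split) i }
    where
    split : t zero ≡ 0ℤ × Z.∑ n (t ∘ suc) ≡ 0ℤ
    split = nonneg-sum-zero (h zero) (∑-nonneg (h ∘ suc)) (trans (sym (Z.∑-suc t)) e)

  ∑-1 : ∀ n → Z.∑ n (λ _ → 1ℤ) ≡ + n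
  ∑-1 zero    = Z.∑-zero _
  ∑-1 (suc n) = trans (Z.∑-suc _) (cong (λ z → 1ℤ + z) (∑-1 n))

  ∑-δ : ∀ {n} (t : Fin n → ℤ) i → Z.∑ n (λ k → t k * δ i k) ≡ t i
  ∑-δ t i = trans (Z.∑-cong (λ k → cong (t k *_) (trans (δ≡ι i k) (Z.ι-sym i k)))) (Z.∑-ι t i)

  δ-refl : ∀ {n} (i : Fin n) → δ i i ≡ 1ℤ
  δ-refl i = trans (δ≡ι i i) (Z.ι-diag i)

  δ-≢ : ∀ {n} {i j : Fin n} → i ≢ j → δ i j ≡ 0ℤ
  δ-≢ {i = i} {j} i≢j = trans (δ≡ι i j) (Z.ι-off i≢j)

  δ-sym : ∀ {n} (i j : Fin n) → δ i j ≡ δ j i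
  δ-sym i j = trans (δ≡ι i j) (trans (Z.ι-sym i j) (sym (δ≡ι j i)))

  -- Even polynomials in a skew matrix are symmetric, with `s` = 1, and odd ones are skew, with `s`
  -- = -1.
  record Parity {n} (S : Matrix ℤ n) (s : ℤ) (p : Poly) : Set where
    constructor par
    field transpose : ∀ i j → eval S p j i ≡ s * eval S p i j
  open Parity

  module _ {n} (S : Matrix ℤ n) (skew : Skew S) where

    private E = eval S

    parity-* : ∀ {s s′} p r → Parity S s p → Parity S s′ r → Parity S (s * s′) (p *ₚ r)
    parity-* {s} {s′} p r (par hp) (par hr) = par λ i j → begin
      E (p *ₚ r) j i
        ≡⟨ eval-* S p r j i ⟩
      Z.∑ n (λ k → E p j k * E r k i)
        ≡⟨ Z.∑-cong (λ k → trans (cong₂ _*_ (hp k j) (hr i k)) (lemma s s′ (E p k j) (E r i k))) ⟩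
      Z.∑ n (λ k → (s * s′) * (E r i k * E p k j))
        ≡⟨ Z.∑-*ˡ (s * s′) _ ⟩
      (s * s′) * Z.∑ n (λ k → E r i k * E p k j)
        ≡⟨ cong ((s * s′) *_) (trans (sym (eval-* S r p i j)) (eval-cong S (*-comm r p) i j)) ⟩
      (s * s′) * E (p *ₚ r) i j ∎
      where
      open ≡-Reasoning
      lemma : ∀ s t x y → (s * x) * (t * y) ≡ (s * t) * (y * x)
      lemma = solve-∀

    parity-+ : ∀ {s} p r → Parity S s p → Parity S s r → Parity S s (p +ₚ r)
    parity-+ {s} p r (par hp) (par hr) = par λ i j → trans (eval-+ S p r j i) (trans (cong₂ _+_ (hp i j) (hr i j))
      (trans (sym (ℤₚ.*-distribˡ-+ s _ _)) (cong (s *_) (sym (eval-+ S p r i j)))))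

    parity-const : ∀ c → Parity S 1ℤ (constₚ c)
    parity-const c = par λ i j → trans (eval-const S c j i) (trans (cong (c *_) (δ-sym j i)) (sym (trans (ℤₚ.*-identityˡ _) (eval-const S c i j))))

    parity-X : Parity S (- 1ℤ) X
    parity-X = par λ i j → trans (eval-X S j i) (trans (skew i j) (trans (sym (ℤₚ.-1*i≡-i _)) (cong (- 1ℤ *_) (sym (eval-X S i j)))))

    parity-quad : ∀ c → Parity S 1ℤ (quad c)
    parity-quad c = parity-+ (X *ₚ X) (constₚ c) (parity-* X X parity-X parity-X) (parity-const c)

    parity-^ : ∀ p k → Parity S 1ℤ p → Parity S 1ℤ (p ^ₚ k)
    parity-^ p zero    h = parity-const 1ℤ
    parity-^ p (suc k) h = parity-* p (p ^ₚ k) h (parity-^ p k h)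

    -- The diagonal entries of p(S)² are `s` times the squared norms of the rows of p(S).
    square-eval-zero : ∀ {s} p → s ≢ 0ℤ → Parity S s p → (∀ i j → E (p *ₚ p) i j ≡ 0ℤ) → ∀ i j → E p i j ≡ 0ℤ
    square-eval-zero {s} p s≢0 (par h) e i j = square-zero _ (∑-nonneg-zero (λ k → square-nonneg (E p i k)) norm≡0 j)
      where
      norm≡0 : Z.∑ n (λ k → E p i k * E p i k) ≡ 0ℤ
      norm≡0 = [ (λ s≡0 → contradiction s≡0 s≢0) , (λ z → z) ]′ (ℤₚ.i*j≡0⇒i≡0∨j≡0 s (begin
        s * Z.∑ n (λ k → E p i k * E p i k)    ≡⟨ Z.∑-*ˡ s _ ⟨
        Z.∑ n (λ k → s * (E p i k * E p i k))  ≡⟨ Z.∑-cong (λ k → trans (lemma s (E p i k)) (cong (E p i k *_) (sym (h i k)))) ⟩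
        Z.∑ n (λ k → E p i k * E p k i)          ≡⟨ eval-* S p p i i ⟨
        E (p *ₚ p) i i                             ≡⟨ e i i ⟩
        0ℤ                                         ∎))
        where
        open ≡-Reasoning
        lemma : ∀ s a → s * (a * a) ≡ a * (s * a)
        lemma = solve-∀

    -- Semisimplicity: S is skew, so the exponent of q can be lowered to one.
    reduced : ∀ {s} q f k → s ≢ 0ℤ → Parity S 1ℤ q → Parity S s f →
              (∀ i j → E (f *ₚ (q ^ₚ suc k)) i j ≡ 0ℤ) → ∀ i j → E (f *ₚ q) i j ≡ 0ℤ
    reduced q f zero s≢0 hq hf e i j = trans (eval-cong S (*-congʳ f (≃-sym (*-identityʳ q))) i j) (e i j)
    reduced {s} q f (suc k) s≢0 hq hf e = reduced q f k s≢0 hq hf (square-eval-zero p (λ s*1≡0 → s≢0 (trans (sym (ℤₚ.*-identityʳ s)) s*1≡0))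
        (parity-* f (q ^ₚ suc k) hf (parity-^ q (suc k) hq)) p²≡0)
      where
      p = f *ₚ (q ^ₚ suc k)
      -- Here `r` stands for `q ^ₚ k`: the square of f q^(k+1) contains the factor f q^(k+2), which
      -- vanishes at `S`, so the exponent can be lowered by one.
      lemma : ∀ f q r → (f *ₚ (q *ₚ r)) *ₚ (f *ₚ (q *ₚ r)) ≃ (f *ₚ r) *ₚ (f *ₚ (q *ₚ (q *ₚ r)))
      lemma = solve-∀-in polyACR
      p²≡0 : ∀ i j → E (p *ₚ p) i j ≡ 0ℤ
      p²≡0 i j = trans (eval-cong S (lemma f q (q ^ₚ k)) i j)
        (trans (eval-* S (f *ₚ (q ^ₚ k)) (f *ₚ (q *ₚ (q *ₚ (q ^ₚ k)))) i j) (⊗-zeroʳ S {E (f *ₚ (q ^ₚ k))} e i j))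

    eval-quad : ∀ c i j → E (quad c) i j ≡ c * δ i j + - gram S i j
    eval-quad c i j = trans (eval-+ S (X *ₚ X) (constₚ c) i j) (trans (ℤₚ.+-comm (E (X *ₚ X) i j) _) (cong₂ _+_ (eval-const S c i j) (begin
      E (X *ₚ X) i j                          ≡⟨ eval-* S X X i j ⟩
      Z.∑ n (λ k → E X i k * E X k j)       ≡⟨ Z.∑-cong (λ k → trans (cong₂ _*_ (eval-X S i k) (trans (eval-X S k j) (skew j k))) (lemma (S i k) (S j k))) ⟩
      Z.∑ n (λ k → - 1ℤ * (S i k * S j k)) ≡⟨ trans (Z.∑-*ˡ (- 1ℤ) _) (ℤₚ.-1*i≡-i _) ⟩
      - gram S i j                            ∎)))
      where
      open ≡-Reasoning
      lemma : ∀ a b → a * - b ≡ - 1ℤ * (a * b)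
      lemma = solve-∀

    quad-zero⇒conference : ∀ c → (∀ i j → E (quad c) i j ≡ 0ℤ) → Conference c S
    quad-zero⇒conference c e i j = sym (ℤₚ.i-j≡0⇒i≡j (c * δ i j) (gram S i j) (trans (sym (eval-quad c i j)) (e i j)))

  module _ {n} {S : Matrix ℤ n} (seidel : IsSkewSeidel S) where

    diagonal-zero : ∀ i → S i i ≡ 0ℤ
    diagonal-zero = proj₁ (proj₁ seidel)

    skew-of : Skew S
    skew-of = proj₂ seidel

    entry² : ∀ {i j} → i ≢ j → S i j * S i j ≡ 1ℤ
    entry² {i} {j} i≢j with proj₂ (proj₁ seidel) i j i≢j
    ... | inj₁ e rewrite e = refl
    ... | inj₂ e rewrite e = refl

    gram-diagonal : ∀ i → gram S i i ≡ + n - 1ℤ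
    gram-diagonal i = begin
      Z.∑ n (λ k → S i k * S i k)                        ≡⟨ Z.∑-cong (λ k → entry (i ≟ k)) ⟩
      Z.∑ n (λ k → 1ℤ + - 1ℤ * δ i k)                 ≡⟨ Z.∑-+ (λ _ → 1ℤ) _ ⟩
      Z.∑ n (λ k → 1ℤ) + Z.∑ n (λ k → - 1ℤ * δ i k)   ≡⟨ cong₂ _+_ (∑-1 n) (∑-δ (λ _ → - 1ℤ) i) ⟩
      + n - 1ℤ                                           ∎
      where
      open ≡-Reasoning
      entry : ∀ {k} → _ → S i k * S i k ≡ 1ℤ + - 1ℤ * δ i k
      entry (yes refl) = trans (cong (λ z → z * z) (diagonal-zero i)) (sym (cong (λ z → 1ℤ + - 1ℤ * z) (δ-refl i)))
      entry (no i≢k)   = trans (entry² i≢k) (sym (cong (λ z → 1ℤ + - 1ℤ * z) (δ-≢ i≢k)))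

  restrict-seidel : ∀ {k n} {S : Matrix ℤ n} (φ : Fin k → Fin n) → (∀ {i j} → φ i ≡ φ j → i ≡ j) →
                    IsSkewSeidel S → IsSkewSeidel (λ i j → S (φ i) (φ j))
  restrict-seidel φ inj ((d , o) , s) = ((λ i → d (φ i)) , (λ i j i≢j → o (φ i) (φ j) (i≢j ∘ inj))) , (λ i j → s (φ i) (φ j))

  module _ {n} {S : Matrix ℤ n} (s : IsSkewSeidel S) where

    private
      ·X-cong : ∀ {a b} → a ≡ b → a ·ₚ X ≃ b ·ₚ X
      ·X-cong refl = ≃-refl

    charMatrix-diagonal : ∀ i → charMatrix S i i ≃ X
    charMatrix-diagonal i = ≃-trans
      (+-cong (≃-trans (·X-cong (δ-refl i)) (1-· X)) (·-cong (- 1ℤ) (≃-trans (const-cong (diagonal-zero s i)) 0∷[])))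
      (+-identityʳ X)

    charMatrix-off : ∀ {i j} → i ≢ j → charMatrix S i j ≃ negₚ (constₚ (S i j))
    charMatrix-off {i} {j} i≢j = +-cong (≃-trans (·X-cong (δ-≢ i≢j)) (0-· X)) (≃-refl {negₚ (constₚ (S i j))})

    charMatrix-offᵀ : ∀ {i j} → i ≢ j → charMatrix S j i ≃ constₚ (S i j)
    charMatrix-offᵀ {i} {j} i≢j = ≃-trans (charMatrix-off (i≢j ∘ sym))
      (const-cong (trans (cong (- 1ℤ *_) (skew-of s i j)) (lemma (S i j))))
      where
      lemma : ∀ a → - 1ℤ * - a ≡ a
      lemma = solve-∀

    const-entry² : ∀ {i j} → i ≢ j → constₚ (S i j) *ₚ constₚ (S i j) ≃ constₚ 1ℤ
    const-entry² {i} {j} i≢j = ≃-trans (const-*-const (S i j) (S i j)) (const-cong (entry² s i≢j))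

  charPoly₁ : ∀ {S : Matrix ℤ 1} → IsSkewSeidel S → charPoly 1 S ≃ X
  charPoly₁ {S} s = ≃-trans (charPoly≃D 1 S) (≃-trans (*-identityʳ _) (charMatrix-diagonal s zero))

  charPoly₂ : ∀ {S : Matrix ℤ 2} → IsSkewSeidel S → charPoly 2 S ≃ X *ₚ X +ₚ constₚ 1ℤ
  charPoly₂ {S} s = ≃-trans (charPoly≃D 2 S) (≃-trans (P.D-cong {B = K} entries)
    (≃-trans (expand X a) (+-cong (≃-refl {X *ₚ X}) (const-entry² s {zero} {suc zero} (λ ())))))
    where
    a = constₚ (S zero (suc zero))
    K : Matrix Poly 2
    K zero       zero       = X
    K zero       (suc zero) = negₚ a
    K (suc zero) zero       = a
    K (suc zero) (suc zero) = X
    entries : ∀ i j → charMatrix S i j ≃ K i j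
    entries zero       zero       = charMatrix-diagonal s zero
    entries zero       (suc zero) = charMatrix-off s (λ ())
    entries (suc zero) zero       = charMatrix-offᵀ s (λ ())
    entries (suc zero) (suc zero) = charMatrix-diagonal s (suc zero)
    expand : ∀ x a → x *ₚ (x *ₚ constₚ 1ℤ) +ₚ negₚ (a *ₚ (negₚ a *ₚ constₚ 1ℤ)) ≃ x *ₚ x +ₚ a *ₚ a
    expand = solve-∀-in polyACR

  -- The signs of the entries matter only through their squares: a skew matrix of order three has
  -- determinant zero, and the coefficient of `X` is the sum of the squares above the diagonal.
  charPoly₃ : ∀ {S : Matrix ℤ 3} → IsSkewSeidel S → charPoly 3 S ≃ X *ₚ (X *ₚ X +ₚ constₚ (+ 3))
  charPoly₃ {S} s = ≃-trans (charPoly≃D 3 S) (≃-trans (P.D-cong {B = K} entries)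
    (≃-trans (expand X a b c) (*-congʳ X (+-cong (≃-refl {X *ₚ X})
      (+-cong (const-entry² s {i₀} {i₁} (λ ())) (+-cong (const-entry² s {i₀} {i₂} (λ ())) (const-entry² s {i₁} {i₂} (λ ()))))))))
    where
    i₀ i₁ i₂ : Fin 3
    i₀ = zero
    i₁ = suc zero
    i₂ = suc (suc zero)
    a = constₚ (S i₀ i₁)
    b = constₚ (S i₀ i₂)
    c = constₚ (S i₁ i₂)
    K : Matrix Poly 3
    K zero             zero             = X
    K zero             (suc zero)       = negₚ a
    K zero             (suc (suc zero)) = negₚ b
    K (suc zero)       zero             = a
    K (suc zero)       (suc zero)       = X
    K (suc zero)       (suc (suc zero)) = negₚ c
    K (suc (suc zero)) zero             = b
    K (suc (suc zero)) (suc zero)       = c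
    K (suc (suc zero)) (suc (suc zero)) = X
    entries : ∀ i j → charMatrix S i j ≃ K i j
    entries zero             zero             = charMatrix-diagonal s i₀
    entries zero             (suc zero)       = charMatrix-off s (λ ())
    entries zero             (suc (suc zero)) = charMatrix-off s (λ ())
    entries (suc zero)       zero             = charMatrix-offᵀ s (λ ())
    entries (suc zero)       (suc zero)       = charMatrix-diagonal s i₁
    entries (suc zero)       (suc (suc zero)) = charMatrix-off s (λ ())
    entries (suc (suc zero)) zero             = charMatrix-offᵀ s (λ ())
    entries (suc (suc zero)) (suc zero)       = charMatrix-offᵀ s (λ ())
    entries (suc (suc zero)) (suc (suc zero)) = charMatrix-diagonal s i₂
    expand : ∀ x a b c →
      x *ₚ (x *ₚ (x *ₚ constₚ 1ℤ) +ₚ negₚ (c *ₚ (negₚ c *ₚ constₚ 1ℤ))) +ₚ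
      negₚ (a *ₚ (negₚ a *ₚ (x *ₚ constₚ 1ℤ) +ₚ negₚ (c *ₚ (negₚ b *ₚ constₚ 1ℤ))) +ₚ
            negₚ (b *ₚ (negₚ a *ₚ (negₚ c *ₚ constₚ 1ℤ) +ₚ negₚ (x *ₚ (negₚ b *ₚ constₚ 1ℤ))))) ≃
      x *ₚ (x *ₚ x +ₚ (a *ₚ a +ₚ (b *ₚ b +ₚ c *ₚ c)))
    expand = solve-∀-in polyACR

  -- This is the complementary minor identity divided by the `k`-th power of `quad c`. Which indices
  -- are deleted does not matter, as `small` gives the same `f` for every skew Seidel matrix of
  -- order `k`; the first `k` are taken.
  delete : ∀ k {N r} {S : Matrix ℤ N} {c} f → k ℕ.≤ N → IsSkewSeidel S → Conference c S → charPoly N S ≃ quad c ^ₚ (k ℕ.+ r) →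
           (∀ {T : Matrix ℤ k} → IsSkewSeidel T → charPoly k T ≃ f) →
           Σ ℕ λ m → Σ (Matrix ℤ m) λ T → IsSkewSeidel T × charPoly m T ≃ f *ₚ (quad c ^ₚ r)
  delete k {N} {r} {S} {c} f k≤N seidel conf cp small with N ℕ.∸ k | ℕₚ.m+[n∸m]≡n k≤N
  ... | m | refl =
    m , T , restrict-seidel (k ↑ʳ_) (↑ʳ-injective k _ _) seidel ,
    *-cancelˡ (quad c ^ₚ k) (λ ()) (top-^ k (top-quad c)) (begin
      (quad c ^ₚ k) *ₚ charPoly m T
        ≈⟨ complementary-minor k m {c = c} (skew-of seidel) conf ⟨
      charPoly k (λ i j → S (i ↑ˡ m) (j ↑ˡ m)) *ₚ charPoly (k ℕ.+ m) S
        ≈⟨ *-cong (small (restrict-seidel (_↑ˡ m) (↑ˡ-injective m _ _) seidel)) (≃-trans cp (^-+ (quad c) k r)) ⟩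
      f *ₚ ((quad c ^ₚ k) *ₚ (quad c ^ₚ r))
        ≈⟨ swap f (quad c ^ₚ k) (quad c ^ₚ r) ⟩
      (quad c ^ₚ k) *ₚ (f *ₚ (quad c ^ₚ r)) ∎)
    where
    open SetoidReasoning setoid
    T : Matrix ℤ m
    T i j = S (k ↑ʳ i) (k ↑ʳ j)
    swap : ∀ a b c → a *ₚ (b *ₚ c) ≃ b *ₚ (a *ₚ c)
    swap = solve-∀-in polyACR

open ConferenceMatrix

-- Bordering a skew Seidel matrix by one, two or three rows to reach S Sᵀ = c.

module Augmentation where

  open import Data.Integer using (_+_; _*_; _-_; ∣_∣)
  open ≡-Reasoning

  Unit : ℤ → Set
  Unit x = x ≡ 1ℤ ⊎ x ≡ - 1ℤ

  unit² : ∀ {x} → Unit x → x * x ≡ 1ℤ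
  unit² (inj₁ refl) = refl
  unit² (inj₂ refl) = refl

  unit-neg : ∀ {x} → Unit x → Unit (- x)
  unit-neg (inj₁ refl) = inj₂ refl
  unit-neg (inj₂ refl) = inj₁ refl

  unit-* : ∀ {x y} → Unit x → Unit y → Unit (x * y)
  unit-* (inj₁ refl) (inj₁ refl) = inj₁ refl
  unit-* (inj₁ refl) (inj₂ refl) = inj₂ refl
  unit-* (inj₂ refl) (inj₁ refl) = inj₂ refl
  unit-* (inj₂ refl) (inj₂ refl) = inj₁ refl

  dot : ∀ {n} → Vector ℤ n → Vector ℤ n → ℤ
  dot {n} u v = Z.∑ n (λ k → u k * v k)

  dot-comm : ∀ {n} (u v : Vector ℤ n) → dot u v ≡ dot v u
  dot-comm u v = Z.∑-cong (λ k → ℤₚ.*-comm (u k) (v k))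

  dot-cong : ∀ {n} {u u′ v v′ : Vector ℤ n} → (∀ k → u k ≡ u′ k) → (∀ k → v k ≡ v′ k) → dot u v ≡ dot u′ v′
  dot-cong e f = Z.∑-cong (λ k → cong₂ _*_ (e k) (f k))

  dot-linear : ∀ {n} α β (a b v : Vector ℤ n) → dot (λ k → α * a k + β * b k) v ≡ α * dot a v + β * dot b v
  dot-linear α β a b v = begin
    Z.∑ _ (λ k → (α * a k + β * b k) * v k)          ≡⟨ Z.∑-cong (λ k → lemma α β (a k) (b k) (v k)) ⟩
    Z.∑ _ (λ k → α * (a k * v k) + β * (b k * v k))  ≡⟨ Z.∑-+ _ _ ⟩
    Z.∑ _ (λ k → α * (a k * v k)) + Z.∑ _ (λ k → β * (b k * v k)) ≡⟨ cong₂ _+_ (Z.∑-*ˡ α _) (Z.∑-*ˡ β _) ⟩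
    α * dot a v + β * dot b v                        ∎
    where
    lemma : ∀ α β a b v → (α * a + β * b) * v ≡ α * (a * v) + β * (b * v)
    lemma = solve-∀

  dot-linearʳ : ∀ {n} α β (v a b : Vector ℤ n) → dot v (λ k → α * a k + β * b k) ≡ α * dot v a + β * dot v b
  dot-linearʳ α β v a b = trans (dot-comm v _) (trans (dot-linear α β a b v) (cong₂ (λ x y → α * x + β * y) (dot-comm a v) (dot-comm b v)))

  dot-unit : ∀ {n} {v : Vector ℤ n} → (∀ i → Unit (v i)) → dot v v ≡ + n
  dot-unit {n} u = trans (Z.∑-cong (λ k → unit² (u k))) (∑-1 n)

  apply : ∀ {n} → Matrix ℤ n → Vector ℤ n → Vector ℤ n
  apply S v i = dot (S i) v

  border : ∀ {n} → Vector ℤ n → Matrix ℤ n → Matrix ℤ (suc n)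
  border v S zero    zero    = 0ℤ
  border v S zero    (suc j) = v j
  border v S (suc i) zero    = - v i
  border v S (suc i) (suc j) = S i j

  border-seidel : ∀ {n} {v : Vector ℤ n} {S} → (∀ i → Unit (v i)) → IsSkewSeidel S → IsSkewSeidel (border v S)
  border-seidel {v = v} {S} u ((d , o) , s) = (diag , off) , skew
    where
    diag : ∀ i → border v S i i ≡ 0ℤ
    diag zero    = refl
    diag (suc i) = d i
    off : ∀ i j → i ≢ j → Unit (border v S i j)
    off zero    zero    i≢j = contradiction refl i≢j
    off zero    (suc j) i≢j = u j
    off (suc i) zero    i≢j = unit-neg (u i)
    off (suc i) (suc j) i≢j = o i j (i≢j ∘ cong suc)
    skew : ∀ i j → border v S j i ≡ - border v S i j
    skew zero    zero    = refl
    skew zero    (suc j) = refl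
    skew (suc i) zero    = sym (ℤₚ.neg-involutive (v i))
    skew (suc i) (suc j) = s i j

  gram-sym : ∀ {n} (S : Matrix ℤ n) i j → gram S i j ≡ gram S j i
  gram-sym S i j = dot-comm (S i) (S j)

  module _ {n} (v : Vector ℤ n) (S : Matrix ℤ n) where

    gram-border₀₀ : gram (border v S) zero zero ≡ dot v v
    gram-border₀₀ = trans (Z.∑-suc _) (ℤₚ.+-identityˡ _)

    gram-border₀ : ∀ j → gram (border v S) zero (suc j) ≡ apply S v j
    gram-border₀ j = trans (Z.∑-suc _) (trans (ℤₚ.+-identityˡ _) (dot-comm v (S j)))

    gram-border : ∀ i j → gram (border v S) (suc i) (suc j) ≡ v i * v j + gram S i j
    gram-border i j = trans (Z.∑-suc _) (cong (_+ gram S i j) (lemma (v i) (v j)))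
      where
      lemma : ∀ a b → - a * - b ≡ a * b
      lemma = solve-∀

    border-conference : ∀ {c} → dot v v ≡ c → (∀ j → apply S v j ≡ 0ℤ) → (∀ i j → v i * v j + gram S i j ≡ c * δ i j) →
                        Conference c (border v S)
    border-conference {c} h₀₀ h₀ h zero    zero    = trans gram-border₀₀ (trans h₀₀ (sym (ℤₚ.*-identityʳ c)))
    border-conference {c} h₀₀ h₀ h zero    (suc j) = trans (gram-border₀ j) (trans (h₀ j) (sym (ℤₚ.*-zeroʳ c)))
    border-conference {c} h₀₀ h₀ h (suc i) zero    = trans (gram-sym (border v S) (suc i) zero) (trans (gram-border₀ i) (trans (h₀ i) (sym (ℤₚ.*-zeroʳ c))))
    border-conference {c} h₀₀ h₀ h (suc i) (suc j) = trans (gram-border i j) (h i j)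

  record Extension (c : ℤ) (n : ℕ) : Set where
    constructor extension
    field
      matrix     : Matrix ℤ n
      seidel     : IsSkewSeidel matrix
      conference : Conference c matrix

  -- A symmetric M with M² = μ M is, up to scale, the Gram matrix of its rows.
  row-difference : ∀ {n} {M : Matrix ℤ n} {μ} → (∀ i j → M j i ≡ M i j) → (∀ i j → Z.∑ n (λ k → M i k * M k j) ≡ μ * M i j) →
                   ∀ {s} → Unit s → ∀ i j →
                   Z.∑ n (λ k → (M i k - s * M j k) * (M i k - s * M j k)) ≡ μ * (M i i + M j j - + 2 * s * M i j)
  row-difference {n} {M} {μ} symm sq {s} us i j = begin
    Z.∑ n (λ k → (M i k - s * M j k) * (M i k - s * M j k))
      ≡⟨ Z.∑-cong (λ k → trans (expand s (M i k) (M j k)) (cong₂ (λ x y → x + (- (+ 2 * s)) * y) (cong (λ z → M i k * M i k + z * (M j k * M j k)) (unit² us)) refl)) ⟩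
    Z.∑ n (λ k → (M i k * M i k + 1ℤ * (M j k * M j k)) + (- (+ 2 * s)) * (M i k * M j k))
      ≡⟨ trans (Z.∑-+ _ _) (cong₂ _+_ (trans (Z.∑-+ _ _) (cong₂ _+_ (row i i) (trans (Z.∑-*ˡ 1ℤ _) (cong (1ℤ *_) (row j j))))) (trans (Z.∑-*ˡ (- (+ 2 * s)) _) (cong (- (+ 2 * s) *_) (row i j)))) ⟩
    (μ * M i i + 1ℤ * (μ * M j j)) + (- (+ 2 * s)) * (μ * M i j)
      ≡⟨ collect μ s (M i i) (M j j) (M i j) ⟩
    μ * (M i i + M j j - + 2 * s * M i j) ∎
    where
    expand : ∀ s a b → (a - s * b) * (a - s * b) ≡ (a * a + s * s * (b * b)) + (- (+ 2 * s)) * (a * b)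
    expand = solve-∀
    collect : ∀ μ s a b x → (μ * a + 1ℤ * (μ * b)) + (- (+ 2 * s)) * (μ * x) ≡ μ * (a + b - + 2 * s * x)
    collect = solve-∀
    row : ∀ i j → Z.∑ n (λ k → M i k * M j k) ≡ μ * M i j
    row i j = trans (Z.∑-cong (λ k → cong (M i k *_) (sym (symm j k)))) (sq i j)

  ∑-squares-zero : ∀ {n} {t : Vector ℤ n} → Z.∑ n (λ k → t k * t k) ≡ 0ℤ → ∀ k → t k ≡ 0ℤ
  ∑-squares-zero {t = t} e k = square-zero _ (∑-nonneg-zero (λ k → square-nonneg (t k)) e k)

  pos-cancel-nonneg : ∀ m {x} → 0ℤ ℤ.≤ + suc m * x → 0ℤ ℤ.≤ x
  pos-cancel-nonneg m {x} h = ℤₚ.*-cancelˡ-≤-pos 0ℤ x (+ suc m) (subst (ℤ._≤ + suc m * x) (sym (ℤₚ.*-zeroʳ (+ suc m))) h)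

  small : ∀ x → 0ℤ ℤ.≤ 1ℤ - x → 0ℤ ℤ.≤ 1ℤ + x → x ≡ 0ℤ ⊎ Unit x
  small (+ 0)             _  _  = inj₁ refl
  small (+ 1)             _  _  = inj₂ (inj₁ refl)
  small (+ suc (suc n))   () _
  small -[1+ 0 ]          _  _  = inj₂ (inj₂ refl)
  small -[1+ suc n ]      _  ()

  -- `M` is what the rows of `S` lack to be orthogonal of squared length `c`, and what the added
  -- columns have to contribute. Its diagonal entry counts the rows missing from order c + 1.
  record Defect {n} (c : ℤ) (S M : Matrix ℤ n) : Set where
    field
      seidel    : IsSkewSeidel S
      symmetric : ∀ i j → M j i ≡ M i j
      complement : ∀ i j → M i j + gram S i j ≡ c * δ i j

    diagonal : ∀ i → M i i ≡ c + 1ℤ - + n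
    diagonal i = begin
      M i i                                   ≡⟨ lemma₁ (M i i) (gram S i i) ⟩
      (M i i + gram S i i) - gram S i i       ≡⟨ cong₂ _-_ (trans (complement i i) (cong (c *_) (δ-refl i))) (gram-diagonal seidel i) ⟩
      c * 1ℤ - (+ n - 1ℤ)                     ≡⟨ lemma₂ c (+ n) ⟩
      c + 1ℤ - + n                            ∎
      where
      lemma₁ : ∀ x y → x ≡ (x + y) - y
      lemma₁ = solve-∀
      lemma₂ : ∀ c n → c * 1ℤ - (n - 1ℤ) ≡ c + 1ℤ - n
      lemma₂ = solve-∀

  *-cancel-suc : ∀ m {x y} → + suc m * x ≡ + suc m * y → x ≡ y
  *-cancel-suc m {x} {y} = ℤₚ.*-cancelˡ-≡ (+ suc m) x y

  ∑-combine : ∀ {n} α β (s t : Vector ℤ n) → Z.∑ n (λ k → α * s k + β * t k) ≡ α * Z.∑ n s + β * Z.∑ n t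
  ∑-combine α β s t = trans (Z.∑-+ _ _) (cong₂ _+_ (Z.∑-*ˡ α s) (Z.∑-*ˡ β t))

  -- `W` is μ times an orthogonal projection, so its entries are inner products of vectors of length
  -- one. Cauchy-Schwarz, in the form of `difference`, bounds them by 1, and the equality case makes
  -- two rows equal up to sign.
  module UnitDiagonal {n} (W : Matrix ℤ n) {μ : ℤ} (m : ℕ) (μ≡ : μ ≡ + suc m) (symmetric : ∀ i j → W j i ≡ W i j)
                      (W² : ∀ i j → (W Z.⊗ W) i j ≡ μ * W i j) (diagonal : ∀ i → W i i ≡ 1ℤ) where

    difference : ∀ {s} → Unit s → ∀ i j → Z.∑ n (λ k → (W i k - s * W j k) * (W i k - s * W j k)) ≡ μ * (+ 2 * (1ℤ - s * W i j))
    difference {s} us i j = trans (row-difference {M = W} {μ} symmetric W² us i j)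
      (cong (μ *_) (trans (cong₂ (λ x y → x + y - + 2 * s * W i j) (diagonal i) (diagonal j)) (lemma s (W i j))))
      where
      lemma : ∀ s x → 1ℤ + 1ℤ - + 2 * s * x ≡ + 2 * (1ℤ - s * x)
      lemma = solve-∀

    bound : ∀ {s} → Unit s → ∀ i j → 0ℤ ℤ.≤ 1ℤ - s * W i j
    bound {s} us i j = pos-cancel-nonneg 1 (pos-cancel-nonneg m
      (subst (0ℤ ℤ.≤_) (trans (difference us i j) (cong (_* (+ 2 * (1ℤ - s * W i j))) μ≡)) (∑-nonneg (λ k → square-nonneg (W i k - s * W j k)))))

    entries : ∀ i j → W i j ≡ 0ℤ ⊎ Unit (W i j)
    entries i j = small (W i j)
      (subst (λ z → 0ℤ ℤ.≤ 1ℤ - z) (ℤₚ.*-identityˡ (W i j)) (bound (inj₁ refl) i j))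
      (subst (λ z → 0ℤ ℤ.≤ 1ℤ + z) (lemma (W i j)) (bound (inj₂ refl) i j))
      where
      lemma : ∀ x → - (- 1ℤ * x) ≡ x
      lemma = solve-∀

    parallel : ∀ {i j} → Unit (W i j) → ∀ k → W i k ≡ W i j * W j k
    parallel {i} {j} u k = ℤₚ.i-j≡0⇒i≡j (W i k) (W i j * W j k) (∑-squares-zero {t = λ k → W i k - W i j * W j k} norm≡0 k)
      where
      norm≡0 : Z.∑ n (λ k → (W i k - W i j * W j k) * (W i k - W i j * W j k)) ≡ 0ℤ
      norm≡0 = trans (difference u i j) (trans (cong (λ z → μ * (+ 2 * (1ℤ - z))) (unit² u)) (ℤₚ.*-zeroʳ (μ)))

    row-norm : ∀ i → dot (W i) (W i) ≡ μ
    row-norm i = trans (dot-cong {u = W i} (λ _ → refl) (λ k → sym (symmetric i k)))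
      (trans (W² i i) (trans (cong (μ *_) (diagonal i)) (ℤₚ.*-identityʳ _)))

    square≤1 : ∀ i k → 0ℤ ℤ.≤ 1ℤ + - 1ℤ * (W i k * W i k)
    square≤1 i k = [ (λ e → subst (λ z → 0ℤ ℤ.≤ 1ℤ + - 1ℤ * (z * z)) (sym e) (+≤+ ℕ.z≤n)) ,
                     (λ u → ℤₚ.≤-reflexive (sym (cong (λ z → 1ℤ + - 1ℤ * z) (unit² u)))) ]′ (entries i k)

    unit-of : ∀ {i k} → W i k ≢ 0ℤ → Unit (W i k)
    unit-of {i} {k} ≢0 = [ (λ e → contradiction e ≢0) , (λ u → u) ]′ (entries i k)

  -- M is a rank one matrix v vᵀ with v in the kernel of S.
  augment₁ : ∀ {n} {S M : Matrix ℤ (suc n)} → Defect (+ suc n) S M →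
             (∀ i j → (M Z.⊗ M) i j ≡ + suc n * M i j) → (∀ i j → (S Z.⊗ M) i j ≡ 0ℤ) →
             Extension (+ suc n) (suc (suc n))
  augment₁ {n} {S} {M} defect M² SM≡0 = extension (border v S) (border-seidel (units zero) seidel)
    (border-conference v S (dot-unit (units zero)) (λ j → trans (dot-cong {u = S j} (λ _ → refl) (λ k → symmetric k zero)) (SM≡0 j zero))
      (λ i j → trans (cong (_+ gram S i j) (trans (cong (_* v j) (symmetric i zero)) (sym (parallel (units i zero) j)))) (complement i j)))
    where
    open Defect defect
    unit-diagonal : ∀ i → M i i ≡ 1ℤ
    unit-diagonal i = trans (diagonal i) (lemma (+ suc n))
      where
      lemma : ∀ c → c + 1ℤ - c ≡ 1ℤ
      lemma = solve-∀
    open UnitDiagonal M n refl symmetric M² unit-diagonal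
    v : Vector ℤ (suc n)
    v = M zero
    -- The squared norm of a row equals the number of its entries, and no entry has a square above
    -- 1.
    1-M² : ∀ i k → 1ℤ + - 1ℤ * (M i k * M i k) ≡ 0ℤ
    1-M² i = ∑-nonneg-zero (square≤1 i) (begin
      Z.∑ (suc n) (λ k → 1ℤ + - 1ℤ * (M i k * M i k))  ≡⟨ trans (Z.∑-+ _ _) (cong₂ _+_ (∑-1 (suc n)) (Z.∑-*ˡ (- 1ℤ) _)) ⟩
      + suc n + - 1ℤ * dot (M i) (M i)                 ≡⟨ cong (λ z → + suc n + - 1ℤ * z) (row-norm i) ⟩
      + suc n + - 1ℤ * + suc n                         ≡⟨ lemma (+ suc n) ⟩
      0ℤ                                               ∎)
      where
      lemma : ∀ c → c + - 1ℤ * c ≡ 0ℤ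
      lemma = solve-∀
    units : ∀ i j → Unit (M i j)
    units i j = unit-of (λ e → contradiction (trans (sym (cong (λ z → 1ℤ + - 1ℤ * (z * z)) e)) (1-M² i j)) (λ ()))

  module _ {n} {S : Matrix ℤ n} (seidel : IsSkewSeidel S) where

    -- S + I has only entries ±1, as the congruence modulo 4 requires, and skewness cancels the
    -- mixed terms in its Gram matrix, leaving S Sᵀ + I.
    unitRow : Matrix ℤ n
    unitRow i k = S i k + δ i k

    unitRow-unit : ∀ i k → Unit (unitRow i k)
    unitRow-unit i k with i ≟ k
    ... | yes refl = inj₁ (cong₂ _+_ (diagonal-zero seidel i) (δ-refl i))
    ... | no i≢k   = subst Unit (sym (trans (cong (λ z → S i k + z) (δ-≢ i≢k)) (ℤₚ.+-identityʳ _))) (proj₂ (proj₁ seidel) i k i≢k)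

    unitRow-dot : ∀ i j → dot (unitRow i) (unitRow j) ≡ gram S i j + δ i j
    unitRow-dot i j = begin
      Z.∑ n (λ k → (S i k + δ i k) * (S j k + δ j k))
        ≡⟨ Z.∑-cong (λ k → lemma₁ (S i k) (δ i k) (S j k) (δ j k)) ⟩
      Z.∑ n (λ k → S i k * S j k + ((S j k + δ j k) * δ i k + S i k * δ j k))
        ≡⟨ trans (Z.∑-+ _ _) (cong (λ z → gram S i j + z) (trans (Z.∑-+ _ _) (cong₂ _+_ (∑-δ (λ k → S j k + δ j k) i) (∑-δ (S i) j)))) ⟩
      gram S i j + ((S j i + δ j i) + S i j)
        ≡⟨ cong₂ (λ x y → gram S i j + ((x + y) + S i j)) (skew-of seidel i j) (δ-sym j i) ⟩
      gram S i j + ((- S i j + δ i j) + S i j)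
        ≡⟨ lemma₂ (gram S i j) (S i j) (δ i j) ⟩
      gram S i j + δ i j ∎
      where
      lemma₁ : ∀ s d t e → (s + d) * (t + e) ≡ s * t + ((t + e) * d + s * e)
      lemma₁ = solve-∀
      lemma₂ : ∀ g s d → g + ((- s + d) + s) ≡ g + d
      lemma₂ = solve-∀

    -- (x + y)(x + z) is divisible by 4 for x, y, z = ±1.
    dots-mod-4 : ∀ i j k → ∃ λ e → + n + (dot (unitRow i) (unitRow k) + dot (unitRow i) (unitRow j) + dot (unitRow j) (unitRow k)) ≡ + 4 * e
    dots-mod-4 i j k = Z.∑ n quarter , (begin
      + n + (dot (x i) (x k) + dot (x i) (x j) + dot (x j) (x k))
        ≡⟨ cong₂ _+_ (∑-1 n) (trans (Z.∑-+ _ _) (cong (_+ dot (x j) (x k)) (Z.∑-+ _ _))) ⟨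
      Z.∑ n (λ _ → 1ℤ) + Z.∑ n (λ l → x i l * x k l + x i l * x j l + x j l * x k l)
        ≡⟨ Z.∑-+ _ _ ⟨
      Z.∑ n (λ l → 1ℤ + (x i l * x k l + x i l * x j l + x j l * x k l))
        ≡⟨ Z.∑-cong (λ l → proj₂ (fourth (unitRow-unit i l) (unitRow-unit j l) (unitRow-unit k l))) ⟩
      Z.∑ n (λ l → + 4 * quarter l)
        ≡⟨ Z.∑-*ˡ (+ 4) quarter ⟩
      + 4 * Z.∑ n quarter ∎)
      where
      x = unitRow
      fourth : ∀ {x y z} → Unit x → Unit y → Unit z → ∃ λ e → 1ℤ + (x * z + x * y + y * z) ≡ + 4 * e
      fourth (inj₁ refl) (inj₁ refl) (inj₁ refl) = 1ℤ , refl
      fourth (inj₁ refl) (inj₁ refl) (inj₂ refl) = 0ℤ , refl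
      fourth (inj₁ refl) (inj₂ refl) (inj₁ refl) = 0ℤ , refl
      fourth (inj₁ refl) (inj₂ refl) (inj₂ refl) = 0ℤ , refl
      fourth (inj₂ refl) (inj₁ refl) (inj₁ refl) = 0ℤ , refl
      fourth (inj₂ refl) (inj₁ refl) (inj₂ refl) = 0ℤ , refl
      fourth (inj₂ refl) (inj₂ refl) (inj₁ refl) = 0ℤ , refl
      fourth (inj₂ refl) (inj₂ refl) (inj₂ refl) = 1ℤ , refl
      quarter : Vector ℤ n
      quarter l = proj₁ (fourth (unitRow-unit i l) (unitRow-unit j l) (unitRow-unit k l))

  apply-skew : ∀ {n} {S : Matrix ℤ n} → Skew S → ∀ u v → dot u (apply S v) ≡ - dot (apply S u) v
  apply-skew {n} {S} skew u v = begin
    Z.∑ n (λ i → u i * Z.∑ n (λ j → S i j * v j))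
      ≡⟨ Z.∑-cong (λ i → sym (Z.∑-*ˡ (u i) _)) ⟩
    Z.∑ n (λ i → Z.∑ n (λ j → u i * (S i j * v j)))
      ≡⟨ Z.∑-comm _ ⟩
    Z.∑ n (λ j → Z.∑ n (λ i → u i * (S i j * v j)))
      ≡⟨ Z.∑-cong (λ j → Z.∑-cong (λ i → trans (cong (λ z → u i * (z * v j)) (skew j i)) (lemma (u i) (S j i) (v j)))) ⟩
    Z.∑ n (λ j → Z.∑ n (λ i → - 1ℤ * v j * (S j i * u i)))
      ≡⟨ Z.∑-cong (λ j → trans (Z.∑-*ˡ (- 1ℤ * v j) _) (lemma₂ (v j) (apply S u j))) ⟩
    Z.∑ n (λ j → - 1ℤ * (apply S u j * v j))
      ≡⟨ trans (Z.∑-*ˡ (- 1ℤ) _) (ℤₚ.-1*i≡-i _) ⟩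
    - dot (apply S u) v ∎
    where
    lemma : ∀ u s v → u * (- s * v) ≡ - 1ℤ * v * (s * u)
    lemma = solve-∀
    lemma₂ : ∀ v x → - 1ℤ * v * x ≡ - 1ℤ * (x * v)
    lemma₂ = solve-∀

  apply-skew-self : ∀ {n} {S : Matrix ℤ n} → Skew S → ∀ u → dot u (apply S u) ≡ 0ℤ
  apply-skew-self {S = S} skew u = *-cancel-suc 1 (trans (lemma (dot u (apply S u))) (ℤₚ.i≡j⇒i-j≡0 (trans (apply-skew skew u u) (cong -_ (dot-comm _ u)))))
    where
    lemma : ∀ x → + 2 * x ≡ x - - x
    lemma = solve-∀

  unit-root : ∀ x → x * x ≡ 1ℤ → Unit x
  unit-root x e = [ (λ p → inj₁ (ℤₚ.i-j≡0⇒i≡j x 1ℤ p)) , (λ p → inj₂ (ℤₚ.i-j≡0⇒i≡j x (- 1ℤ) p)) ]′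
    (ℤₚ.i*j≡0⇒i≡0∨j≡0 (x - 1ℤ) (trans (lemma x) (ℤₚ.i≡j⇒i-j≡0 e)))
    where
    lemma : ∀ x → (x - 1ℤ) * (x - - 1ℤ) ≡ x * x - 1ℤ
    lemma = solve-∀

  apply-⊗ : ∀ {n} {S M : Matrix ℤ n} → (∀ i j → (S Z.⊗ M) i j ≡ (M Z.⊗ S) i j) → (∀ i j → M j i ≡ M i j) →
            ∀ j i → apply S (M j) i ≡ dot (M i) (λ k → S k j)
  apply-⊗ {S = S} comm symm j i = trans (dot-cong {u = S i} (λ _ → refl) (λ k → symm k j)) (comm i j)

  -- With the third row equal to the first, `dots-mod-4` reads N + N + 2 x = 4 e for the product x
  -- of two rows of S + I, so x = 2 e - N is even along with N. `M` is N + 2 times the identity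
  -- minus these products.
  defect-even : ∀ {N} {ν} {S M : Matrix ℤ N} → + N ≡ + 2 * ν → Defect (+ N + 1ℤ) S M → ∀ i j → ∃ λ w → M i j ≡ + 2 * w
  defect-even {N} {ν} {S} {M} N≡2ν defect i j = ((ν + 1ℤ) * δ i j + ν - e) , *-cancel-suc 1 (begin
      + 2 * M i j
        ≡⟨ expand (M i j) (gram S i j) (δ i j) (+ N) ⟩
      + 2 * ((M i j + gram S i j) + δ i j) + + N + + N - (+ N + ((+ N - 1ℤ + 1ℤ) + (gram S i j + δ i j) + (gram S i j + δ i j)))
        ≡⟨ cong₂ (λ x y → + 2 * (x + δ i j) + + N + + N - y) (complement i j) (trans (sym (cong (λ z → + N + z) (cong₂ _+_ (cong₂ _+_
             (trans (unitRow-dot seidel i i) (cong₂ _+_ (gram-diagonal seidel i) (δ-refl i))) (unitRow-dot seidel i j))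
             (trans (dot-comm (unitRow seidel j) (unitRow seidel i)) (unitRow-dot seidel i j))))) (proj₂ (dots-mod-4 seidel i j i))) ⟩
      + 2 * ((+ N + 1ℤ) * δ i j + δ i j) + + N + + N - + 4 * e
        ≡⟨ cong (λ z → + 2 * ((z + 1ℤ) * δ i j + δ i j) + z + z - + 4 * e) N≡2ν ⟩
      + 2 * ((+ 2 * ν + 1ℤ) * δ i j + δ i j) + + 2 * ν + + 2 * ν - + 4 * e
        ≡⟨ collect ν (δ i j) e ⟩
      + 2 * (+ 2 * ((ν + 1ℤ) * δ i j + ν - e)) ∎)
    where
    open Defect defect
    e = proj₁ (dots-mod-4 seidel i j i)
    expand : ∀ x g d n → + 2 * x ≡ + 2 * ((x + g) + d) + n + n - (n + ((n - 1ℤ + 1ℤ) + (g + d) + (g + d)))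
    expand = solve-∀
    collect : ∀ ν d e → + 2 * ((+ 2 * ν + 1ℤ) * d + d) + + 2 * ν + + 2 * ν - + 4 * e ≡ + 2 * (+ 2 * ((ν + 1ℤ) * d + ν - e))
    collect = solve-∀

  -- M / 2 is the sum of two rank one matrices u uᵀ + w wᵀ with disjoint supports, on whose span S acts as a rotation by a
  -- right angle; the new rows are u + w and u - w.
  augment-pair : ∀ {N} m {ν} {S M : Matrix ℤ N} → Fin N → ν ≡ + suc m → + N ≡ + 2 * ν → Defect (+ N + 1ℤ) S M →
             (W : Matrix ℤ N) → (∀ i j → M i j ≡ + 2 * W i j) →
             (∀ i j → (M Z.⊗ M) i j ≡ + N * M i j) → (∀ i j → (S Z.⊗ M) i j ≡ (M Z.⊗ S) i j) →
             (∀ i j → (S Z.⊗ (S Z.⊗ M)) i j ≡ - M i j) →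
             Extension (+ N + 1ℤ) (suc (suc N))
  augment-pair {N} m {ν} {S} {M} zero′ ν≡ N≡2ν defect W M≡2W M² SM≡MS SSM≡-M =
    -- The corner entry `- β` is what makes the old rows orthogonal to the outermost new one,
    -- because `S` sends `a` to `- β` times `b`.
    extension (border (- β ◂ a) (border b S))
      (border-seidel (λ { zero → unit-neg β-unit ; (suc i) → a-unit i }) (border-seidel b-unit seidel))
      (border-conference (- β ◂ a) (border b S) h₀₀ h₀ h)
    where
    open Defect defect renaming (symmetric to M-sym)
    W-sym : ∀ i j → W j i ≡ W i j
    W-sym i j = *-cancel-suc 1 (trans (sym (M≡2W j i)) (trans (M-sym i j) (M≡2W i j)))
    W² : ∀ i j → (W Z.⊗ W) i j ≡ ν * W i j
    W² i j = *-cancel-suc 3 (begin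
      + 4 * (W Z.⊗ W) i j                  ≡⟨ Z.∑-*ˡ (+ 4) _ ⟨
      Z.∑ N (λ k → + 4 * (W i k * W k j))  ≡⟨ Z.∑-cong (λ k → trans (lemma₁ (W i k) (W k j)) (sym (cong₂ _*_ (M≡2W i k) (M≡2W k j)))) ⟩
      (M Z.⊗ M) i j                        ≡⟨ trans (M² i j) (cong₂ _*_ N≡2ν (M≡2W i j)) ⟩
      + 2 * ν * (+ 2 * W i j)              ≡⟨ lemma₂ ν (W i j) ⟩
      + 4 * (ν * W i j)                    ∎)
      where
      lemma₁ : ∀ x y → + 4 * (x * y) ≡ + 2 * x * (+ 2 * y)
      lemma₁ = solve-∀
      lemma₂ : ∀ x y → + 2 * x * (+ 2 * y) ≡ + 4 * (x * y)
      lemma₂ = solve-∀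
    W-diagonal : ∀ i → W i i ≡ 1ℤ
    W-diagonal i = *-cancel-suc 1 (trans (sym (M≡2W i i)) (trans (diagonal i) (lemma (+ N))))
      where
      lemma : ∀ n → n + 1ℤ + 1ℤ - n ≡ + 2 * 1ℤ
      lemma = solve-∀
    SW≡WS : ∀ i j → (S Z.⊗ W) i j ≡ (W Z.⊗ S) i j
    SW≡WS i j = *-cancel-suc 1 (begin
      + 2 * (S Z.⊗ W) i j                ≡⟨ Z.∑-*ˡ (+ 2) _ ⟨
      Z.∑ N (λ k → + 2 * (S i k * W k j)) ≡⟨ Z.∑-cong (λ k → trans (lemma (S i k) (W k j)) (cong (S i k *_) (sym (M≡2W k j)))) ⟩
      (S Z.⊗ M) i j                      ≡⟨ SM≡MS i j ⟩
      (M Z.⊗ S) i j                      ≡⟨ Z.∑-cong (λ k → trans (cong (_* S k j) (M≡2W i k)) (ℤₚ.*-assoc (+ 2) (W i k) (S k j))) ⟩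
      Z.∑ N (λ k → + 2 * (W i k * S k j)) ≡⟨ Z.∑-*ˡ (+ 2) _ ⟩
      + 2 * (W Z.⊗ S) i j                ∎)
      where
      lemma : ∀ x y → + 2 * (x * y) ≡ x * (+ 2 * y)
      lemma = solve-∀
    open UnitDiagonal W m ν≡ W-sym W² W-diagonal
    -- If every entry of this row were ±1, its squared norm ν would equal N = 2ν.
    orthogonal : ∃ λ k → W zero′ k ≡ 0ℤ
    orthogonal with any? (λ k → W zero′ k ℤ.≟ 0ℤ)
    ... | yes p = p
    ... | no ¬p = contradiction (trans (sym ν≡) (ν≡0 (trans (sym (row-norm zero′)) (dot-unit (λ k → unit-of (λ e → ¬p (k , e))))))) (λ ())
      where
      ν≡0 : ν ≡ + N → ν ≡ 0ℤ
      ν≡0 e = trans (lemma ν) (ℤₚ.i≡j⇒i-j≡0 (trans (sym N≡2ν) (sym e)))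
        where
        lemma : ∀ x → x ≡ + 2 * x - x
        lemma = solve-∀
    k₀ = proj₁ orthogonal
    u w a b : Vector ℤ N
    u = W zero′
    w = W k₀
    a i = 1ℤ * u i + 1ℤ * w i
    b i = 1ℤ * u i + - 1ℤ * w i
    u⊥w : dot u w ≡ 0ℤ
    u⊥w = trans (dot-cong {u = u} (λ _ → refl) (λ k → sym (W-sym k₀ k))) (trans (W² zero′ k₀) (trans (cong (ν *_) (proj₂ orthogonal)) (ℤₚ.*-zeroʳ ν)))
    disjoint : ∀ i → Unit (u i) → w i ≡ 0ℤ
    disjoint i ui = begin
      W k₀ i            ≡⟨ W-sym i k₀ ⟩
      W i k₀            ≡⟨ parallel (subst Unit (sym (W-sym zero′ i)) ui) k₀ ⟩
      W i zero′ * W zero′ k₀ ≡⟨ trans (cong (W i zero′ *_) (proj₂ orthogonal)) (ℤₚ.*-zeroʳ (W i zero′)) ⟩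
      0ℤ                ∎
    Support : Fin N → Set
    Support i = (Unit (u i) × w i ≡ 0ℤ) ⊎ (u i ≡ 0ℤ × Unit (w i))
    u²+w²≤1 : ∀ i → 0ℤ ℤ.≤ 1ℤ + (- 1ℤ * (u i * u i) + - 1ℤ * (w i * w i))
    u²+w²≤1 i = [ (λ e → subst (λ z → 0ℤ ℤ.≤ 1ℤ + (- 1ℤ * (z * z) + - 1ℤ * (w i * w i))) (sym e) (subst (λ z → 0ℤ ℤ.≤ 1ℤ + z) (sym (ℤₚ.+-identityˡ (- 1ℤ * (w i * w i)))) (square≤1 k₀ i))) ,
                  (λ ui → ℤₚ.≤-reflexive (sym (cong₂ (λ x y → 1ℤ + (- 1ℤ * x + - 1ℤ * (y * y))) (unit² ui) (disjoint i ui)))) ]′ (entries zero′ i)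
    -- The squares of `u` and `w` add up to 2ν = N over all indices and to at most 1 at each of the
    -- N indices, so everywhere exactly one of the two is ±1.
    u²+w²≡1 : ∀ i → 1ℤ + (- 1ℤ * (u i * u i) + - 1ℤ * (w i * w i)) ≡ 0ℤ
    u²+w²≡1 = ∑-nonneg-zero u²+w²≤1 (begin
      Z.∑ N (λ i → 1ℤ + (- 1ℤ * (u i * u i) + - 1ℤ * (w i * w i)))  ≡⟨ trans (Z.∑-+ _ _) (cong₂ _+_ (∑-1 N) (∑-combine (- 1ℤ) (- 1ℤ) _ _)) ⟩
      + N + (- 1ℤ * dot u u + - 1ℤ * dot w w)                        ≡⟨ cong₂ (λ x y → x + y) N≡2ν (cong₂ (λ x y → - 1ℤ * x + - 1ℤ * y) (row-norm zero′) (row-norm k₀)) ⟩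
      + 2 * ν + (- 1ℤ * ν + - 1ℤ * ν)                                ≡⟨ lemma ν ⟩
      0ℤ                                                             ∎)
      where
      lemma : ∀ x → + 2 * x + (- 1ℤ * x + - 1ℤ * x) ≡ 0ℤ
      lemma = solve-∀
    support : ∀ i → Support i
    support i = [ (λ ui≡0 → inj₂ (ui≡0 , unit-of (λ wi≡0 → contradiction
                    (trans (sym (cong₂ (λ x y → 1ℤ + (- 1ℤ * (x * x) + - 1ℤ * (y * y))) ui≡0 wi≡0)) (u²+w²≡1 i)) (λ ())))) ,
                  (λ ui → inj₁ (ui , disjoint i ui)) ]′ (entries zero′ i)
    W-split : ∀ i j → W i j ≡ u i * u j + w i * w j
    W-split i j = [ on-u , on-w ]′ (support i)
      where
      on-u : Unit (u i) × w i ≡ 0ℤ → W i j ≡ u i * u j + w i * w j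
      on-u (ui , wi≡0) = trans (parallel {i} {zero′} (subst Unit (sym (W-sym zero′ i)) ui) j)
        (trans (cong (_* u j) (W-sym zero′ i)) (sym (trans (cong (λ z → u i * u j + z * w j) wi≡0) (ℤₚ.+-identityʳ _))))
      on-w : u i ≡ 0ℤ × Unit (w i) → W i j ≡ u i * u j + w i * w j
      on-w (ui≡0 , wi) = trans (parallel {i} {k₀} (subst Unit (sym (W-sym k₀ i)) wi) j)
        (trans (cong (_* w j) (W-sym k₀ i)) (sym (trans (cong (λ z → z * u j + w i * w j) ui≡0) (ℤₚ.+-identityˡ _))))
    a-unit : ∀ i → Unit (a i)
    a-unit i = [ (λ (ui , wi≡0) → subst Unit (sym (trans (cong (λ z → 1ℤ * u i + 1ℤ * z) wi≡0) (lemma₁ (u i)))) ui) ,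
                 (λ (ui≡0 , wi) → subst Unit (sym (trans (cong (λ z → 1ℤ * z + 1ℤ * w i) ui≡0) (lemma₂ (w i)))) wi) ]′ (support i)
      where
      lemma₁ : ∀ x → 1ℤ * x + 1ℤ * 0ℤ ≡ x
      lemma₁ = solve-∀
      lemma₂ : ∀ x → 1ℤ * 0ℤ + 1ℤ * x ≡ x
      lemma₂ = solve-∀
    b-unit : ∀ i → Unit (b i)
    b-unit i = [ (λ (ui , wi≡0) → subst Unit (sym (trans (cong (λ z → 1ℤ * u i + - 1ℤ * z) wi≡0) (lemma₁ (u i)))) ui) ,
                 (λ (ui≡0 , wi) → subst Unit (sym (trans (cong (λ z → 1ℤ * z + - 1ℤ * w i) ui≡0) (lemma₂ (w i)))) (unit-neg wi)) ]′ (support i)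
      where
      lemma₁ : ∀ x → 1ℤ * x + - 1ℤ * 0ℤ ≡ x
      lemma₁ = solve-∀
      lemma₂ : ∀ x → 1ℤ * 0ℤ + - 1ℤ * x ≡ - x
      lemma₂ = solve-∀
    -- `S` commutes with `W`, whose rows are combinations of `u` and `w`, so `S` preserves their
    -- span. Skewness then evaluates the four coefficients below: α and κ vanish, and γ is -β.
    column : ∀ j i → apply S (W j) i ≡ dot u (λ k → S k j) * u i + dot w (λ k → S k j) * w i
    column j i = begin
      apply S (W j) i                                       ≡⟨ apply-⊗ {S = S} {W} SW≡WS W-sym j i ⟩
      dot (W i) (λ k → S k j)                               ≡⟨ dot-cong {v = λ k → S k j} (W-split i) (λ _ → refl) ⟩
      dot (λ k → u i * u k + w i * w k) (λ k → S k j)       ≡⟨ dot-linear (u i) (w i) u w (λ k → S k j) ⟩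
      u i * dot u (λ k → S k j) + w i * dot w (λ k → S k j) ≡⟨ cong₂ _+_ (ℤₚ.*-comm (u i) _) (ℤₚ.*-comm (w i) _) ⟩
      dot u (λ k → S k j) * u i + dot w (λ k → S k j) * w i ∎
    α β γ κ : ℤ
    α = dot u (λ k → S k zero′)
    β = dot w (λ k → S k zero′)
    γ = dot u (λ k → S k k₀)
    κ = dot w (λ k → S k k₀)
    ν-cancel : ∀ {x y} → ν * x ≡ ν * y → x ≡ y
    ν-cancel {x} {y} e = *-cancel-suc m (subst (λ z → z * x ≡ z * y) ν≡ e)
    ν*≡0 : ∀ {x} → ν * x ≡ 0ℤ → x ≡ 0ℤ
    ν*≡0 e = ν-cancel (trans e (sym (ℤₚ.*-zeroʳ ν)))
    uSu : ∀ v x y → (∀ i → apply S v i ≡ x * u i + y * w i) → dot u (apply S v) ≡ ν * x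
    uSu v x y e = trans (dot-cong {u = u} (λ _ → refl) e) (trans (dot-linearʳ x y u u w)
      (trans (cong₂ (λ p q → x * p + y * q) (row-norm zero′) u⊥w) (lemma x y ν)))
      where
      lemma : ∀ x y v → x * v + y * 0ℤ ≡ v * x
      lemma = solve-∀
    wSu : ∀ v x y → (∀ i → apply S v i ≡ x * u i + y * w i) → dot w (apply S v) ≡ ν * y
    wSu v x y e = trans (dot-cong {u = w} (λ _ → refl) e) (trans (dot-linearʳ x y w u w)
      (trans (cong₂ (λ p q → x * p + y * q) (trans (dot-comm w u) u⊥w) (row-norm k₀)) (lemma x y ν)))
      where
      lemma : ∀ x y v → x * 0ℤ + y * v ≡ v * y
      lemma = solve-∀
    α≡0 : α ≡ 0ℤ
    α≡0 = ν*≡0 (trans (sym (uSu u α β (column zero′))) (apply-skew-self (skew-of seidel) u))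
    κ≡0 : κ ≡ 0ℤ
    κ≡0 = ν*≡0 (trans (sym (wSu w γ κ (column k₀))) (apply-skew-self (skew-of seidel) w))
    γ≡-β : γ ≡ - β
    γ≡-β = ν-cancel (begin
      ν * γ                  ≡⟨ uSu w γ κ (column k₀) ⟨
      dot u (apply S w)      ≡⟨ apply-skew (skew-of seidel) u w ⟩
      - dot (apply S u) w    ≡⟨ cong -_ (trans (dot-comm _ w) (wSu u α β (column zero′))) ⟩
      - (ν * β)              ≡⟨ ℤₚ.neg-distribʳ-* ν β ⟩
      ν * - β                ∎)
    Su : ∀ i → apply S u i ≡ β * w i
    Su i = trans (column zero′ i) (trans (cong (λ z → z * u i + β * w i) α≡0) (ℤₚ.+-identityˡ _))
    Sw : ∀ i → apply S w i ≡ - β * u i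
    Sw i = trans (column k₀ i) (trans (cong₂ (λ x y → x * u i + y * w i) γ≡-β κ≡0) (ℤₚ.+-identityʳ _))
    -- From S u = β w and S w = -β u, the diagonal entry of S² M = -M at `zero′` reads -2 β² = -2.
    β-unit : Unit β
    β-unit = unit-root β (ℤₚ.neg-injective (*-cancel-suc 1 (begin
      + 2 * - (β * β)
        ≡⟨ lemma β ⟩
      + 2 * (β * (- β * 1ℤ))
        ≡⟨ cong (λ z → + 2 * (β * (- β * z))) (W-diagonal zero′) ⟨
      + 2 * (β * (- β * u zero′))
        ≡⟨ cong (λ z → + 2 * (β * z)) (Sw zero′) ⟨
      + 2 * (β * apply S w zero′)
        ≡⟨ trans (cong (+ 2 *_) (sym (Z.∑-*ˡ β _))) (sym (Z.∑-*ˡ (+ 2) _)) ⟩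
      Z.∑ N (λ k → + 2 * (β * (S zero′ k * w k)))
        ≡⟨ Z.∑-cong (λ k → trans (shuffle β (S zero′ k) (w k)) (cong (λ z → S zero′ k * (+ 2 * z)) (sym (Su k)))) ⟩
      Z.∑ N (λ k → S zero′ k * (+ 2 * apply S u k))
        ≡⟨ Z.∑-cong (λ k → cong (S zero′ k *_) (trans (sym (Z.∑-*ˡ (+ 2) _)) (Z.∑-cong (λ l →
             trans (swap (S k l) (u l)) (cong (S k l *_) (sym (trans (M≡2W l zero′) (cong (+ 2 *_) (W-sym zero′ l))))))))) ⟩
      (S Z.⊗ (S Z.⊗ M)) zero′ zero′
        ≡⟨ trans (SSM≡-M zero′ zero′) (cong -_ (trans (M≡2W zero′ zero′) (cong (+ 2 *_) (W-diagonal zero′)))) ⟩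
      + 2 * - 1ℤ ∎)))
      where
      lemma : ∀ b → + 2 * - (b * b) ≡ + 2 * (b * (- b * 1ℤ))
      lemma = solve-∀
      shuffle : ∀ b s w → + 2 * (b * (s * w)) ≡ s * (+ 2 * (b * w))
      shuffle = solve-∀
      swap : ∀ s u → + 2 * (s * u) ≡ s * (+ 2 * u)
      swap = solve-∀
    Sa : ∀ i → apply S a i ≡ - β * b i
    Sa i = trans (dot-linearʳ 1ℤ 1ℤ (S i) u w) (trans (cong₂ (λ x y → 1ℤ * x + 1ℤ * y) (Su i) (Sw i)) (lemma β (u i) (w i)))
      where
      lemma : ∀ β u w → 1ℤ * (β * w) + 1ℤ * (- β * u) ≡ - β * (1ℤ * u + - 1ℤ * w)
      lemma = solve-∀
    Sb : ∀ i → apply S b i ≡ β * a i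
    Sb i = trans (dot-linearʳ 1ℤ (- 1ℤ) (S i) u w) (trans (cong₂ (λ x y → 1ℤ * x + - 1ℤ * y) (Su i) (Sw i)) (lemma β (u i) (w i)))
      where
      lemma : ∀ β u w → 1ℤ * (β * w) + - 1ℤ * (- β * u) ≡ β * (1ℤ * u + 1ℤ * w)
      lemma = solve-∀
    e²≡1 : - β * - β ≡ 1ℤ
    e²≡1 = unit² (unit-neg β-unit)
    a·b≡0 : dot b a ≡ 0ℤ
    a·b≡0 = begin
      dot b a
        ≡⟨ dot-linear 1ℤ (- 1ℤ) u w a ⟩
      1ℤ * dot u a + - 1ℤ * dot w a
        ≡⟨ cong₂ (λ x y → 1ℤ * x + - 1ℤ * y) (dot-linearʳ 1ℤ 1ℤ u u w) (dot-linearʳ 1ℤ 1ℤ w u w) ⟩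
      1ℤ * (1ℤ * dot u u + 1ℤ * dot u w) + - 1ℤ * (1ℤ * dot w u + 1ℤ * dot w w)
        ≡⟨ cong₂ (λ x y → 1ℤ * (1ℤ * x + 1ℤ * dot u w) + - 1ℤ * (1ℤ * dot w u + 1ℤ * y)) (row-norm zero′) (row-norm k₀) ⟩
      1ℤ * (1ℤ * ν + 1ℤ * dot u w) + - 1ℤ * (1ℤ * dot w u + 1ℤ * ν)
        ≡⟨ cong₂ (λ x y → 1ℤ * (1ℤ * ν + 1ℤ * x) + - 1ℤ * (1ℤ * y + 1ℤ * ν)) u⊥w (trans (dot-comm w u) u⊥w) ⟩
      1ℤ * (1ℤ * ν + 1ℤ * 0ℤ) + - 1ℤ * (1ℤ * 0ℤ + 1ℤ * ν)
        ≡⟨ lemma ν ⟩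
      0ℤ ∎
      where
      lemma : ∀ x → 1ℤ * (1ℤ * x + 1ℤ * 0ℤ) + - 1ℤ * (1ℤ * 0ℤ + 1ℤ * x) ≡ 0ℤ
      lemma = solve-∀
    c = + N + 1ℤ
    h₀₀ : dot (- β ◂ a) (- β ◂ a) ≡ c
    h₀₀ = trans (Z.∑-suc _) (trans (cong₂ _+_ e²≡1 (dot-unit a-unit)) (ℤₚ.+-comm 1ℤ (+ N)))
    h₀ : ∀ j → apply (border b S) (- β ◂ a) j ≡ 0ℤ
    h₀ zero    = trans (Z.∑-suc _) (trans (ℤₚ.+-identityˡ _) a·b≡0)
    h₀ (suc j) = trans (Z.∑-suc _) (trans (cong (λ z → - b j * - β + z) (Sa j)) (lemma (b j) β))
      where
      lemma : ∀ b β → - b * - β + - β * b ≡ 0ℤ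
      lemma = solve-∀
    h₀ₛ : ∀ j → - β * a j + gram (border b S) zero (suc j) ≡ 0ℤ
    h₀ₛ j = trans (cong (λ z → - β * a j + z) (trans (gram-border₀ b S j) (Sb j))) (lemma β (a j))
      where
      lemma : ∀ β a → - β * a + β * a ≡ 0ℤ
      lemma = solve-∀
    h : ∀ i j → (- β ◂ a) i * (- β ◂ a) j + gram (border b S) i j ≡ c * δ i j
    h zero    zero    = trans (cong₂ _+_ e²≡1 (trans (gram-border₀₀ b S) (dot-unit b-unit))) (lemma (+ N))
      where
      lemma : ∀ n → 1ℤ + n ≡ (n + 1ℤ) * 1ℤ
      lemma = solve-∀
    h zero    (suc j) = trans (h₀ₛ j) (sym (ℤₚ.*-zeroʳ c))
    h (suc i) zero    = trans (cong₂ _+_ (ℤₚ.*-comm (a i) (- β)) (gram-sym (border b S) (suc i) zero)) (trans (h₀ₛ i) (sym (ℤₚ.*-zeroʳ c)))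
    h (suc i) (suc j) = trans (cong (λ z → a i * a j + z) (gram-border b S i j)) (trans (lemma (u i) (u j) (w i) (w j) (gram S i j))
      (trans (cong (λ z → + 2 * z + gram S i j) (sym (W-split i j))) (trans (cong (_+ gram S i j) (sym (M≡2W i j))) (complement i j))))
      where
      lemma : ∀ u u′ w w′ g → (1ℤ * u + 1ℤ * w) * (1ℤ * u′ + 1ℤ * w′) + ((1ℤ * u + - 1ℤ * w) * (1ℤ * u′ + - 1ℤ * w′) + g) ≡ + 2 * (u * u′ + w * w′) + g
      lemma = solve-∀

  augment₂ : ∀ {N} m {ν} {S M : Matrix ℤ N} → Fin N → ν ≡ + suc m → + N ≡ + 2 * ν → Defect (+ N + 1ℤ) S M →
             (∀ i j → (M Z.⊗ M) i j ≡ + N * M i j) → (∀ i j → (S Z.⊗ M) i j ≡ (M Z.⊗ S) i j) →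
             (∀ i j → (S Z.⊗ (S Z.⊗ M)) i j ≡ - M i j) →
             Extension (+ N + 1ℤ) (suc (suc N))
  augment₂ m i₀ ν≡ N≡2ν defect = augment-pair m i₀ ν≡ N≡2ν defect (λ i j → proj₁ (even i j)) (λ i j → proj₂ (even i j))
    where
    even = defect-even N≡2ν defect

  dot-linear₃ : ∀ {n} α β γ (a b c v : Vector ℤ n) →
                dot (λ k → α * a k + β * b k + γ * c k) v ≡ α * dot a v + β * dot b v + γ * dot c v
  dot-linear₃ α β γ a b c v = begin
    Z.∑ _ (λ k → (α * a k + β * b k + γ * c k) * v k)      ≡⟨ Z.∑-cong (λ k → lemma (α * a k + β * b k) γ (c k) (v k)) ⟩
    Z.∑ _ (λ k → (α * a k + β * b k) * v k + γ * (c k * v k)) ≡⟨ trans (Z.∑-+ _ _) (cong₂ _+_ (dot-linear α β a b v) (Z.∑-*ˡ γ _)) ⟩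
    α * dot a v + β * dot b v + γ * dot c v                ∎
    where
    lemma : ∀ x γ c v → (x + γ * c) * v ≡ x * v + γ * (c * v)
    lemma = solve-∀

  dot-linear₃ʳ : ∀ {n} α β γ (v a b c : Vector ℤ n) →
                 dot v (λ k → α * a k + β * b k + γ * c k) ≡ α * dot v a + β * dot v b + γ * dot v c
  dot-linear₃ʳ α β γ v a b c = trans (dot-comm v _) (trans (dot-linear₃ α β γ a b c v)
    (cong₂ (λ x y → x + γ * y) (cong₂ (λ x y → α * x + β * y) (dot-comm a v) (dot-comm b v)) (dot-comm c v)))

  -- The three new rows are (0, e, -e, a), (-e, 0, e, b), (e, -e, 0, c).
  border₃ : ∀ {n} {S : Matrix ℤ n} {a b c : Vector ℤ n} {e κ} → IsSkewSeidel S → Unit e → κ ≡ + n + + 2 →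
            (∀ i → Unit (a i)) → (∀ i → Unit (b i)) → (∀ i → Unit (c i)) →
            dot b a ≡ 1ℤ → dot c a ≡ 1ℤ → dot c b ≡ 1ℤ →
            (∀ i → apply S a i ≡ e * (b i - c i)) → (∀ i → apply S b i ≡ e * (c i - a i)) → (∀ i → apply S c i ≡ e * (a i - b i)) →
            (∀ i j → a i * a j + b i * b j + c i * c j + gram S i j ≡ κ * δ i j) →
            Extension κ (suc (suc (suc n)))
  border₃ {n} {S} {a} {b} {c} {e} {κ} seidel ue κ≡ ua ub uc ba ca cb Sa Sb Sc complement = extension (border a₃ B₂)
    (border-seidel (λ { zero → ue ; (suc zero) → unit-neg ue ; (suc (suc i)) → ua i })
      (border-seidel (λ { zero → ue ; (suc i) → ub i }) (border-seidel uc seidel)))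
    (border-conference a₃ B₂ h₀₀ h₀ h)
    where
    a₃ : Vector ℤ (suc (suc n))
    a₃ = e ◂ (- e) ◂ a
    b₂ : Vector ℤ (suc n)
    b₂ = e ◂ b
    B₁ = border c S
    B₂ = border b₂ B₁
    κ*1 : + n + + 2 ≡ κ * 1ℤ
    κ*1 = sym (trans (ℤₚ.*-identityʳ κ) κ≡)
    e² : e * e ≡ 1ℤ
    e² = unit² ue
    κ*0 : 0ℤ ≡ κ * 0ℤ
    κ*0 = sym (ℤₚ.*-zeroʳ κ)
    h₀₀ : dot a₃ a₃ ≡ κ
    h₀₀ = trans (Z.∑-suc _) (trans (cong (λ z → e * e + z) (trans (Z.∑-suc _) (cong (λ z → - e * - e + z) (dot-unit ua))))
      (trans (lemma e (+ n)) (trans (cong (λ z → + n + + 2 * z) e²) (sym κ≡))))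
      where
      lemma : ∀ e n → e * e + (- e * - e + n) ≡ n + + 2 * (e * e)
      lemma = solve-∀
    h₀ : ∀ j → apply B₂ a₃ j ≡ 0ℤ
    h₀ zero = trans (Z.∑-suc _) (trans (cong (λ z → 0ℤ * e + z) (trans (Z.∑-suc _) (cong (λ z → e * - e + z) ba)))
      (trans (lemma e) (cong (λ z → 1ℤ - z) e²)))
      where
      lemma : ∀ e → 0ℤ * e + (e * - e + 1ℤ) ≡ 1ℤ - e * e
      lemma = solve-∀
    h₀ (suc zero) = trans (Z.∑-suc _) (trans (cong (λ z → - e * e + z) (trans (Z.∑-suc _) (cong (λ z → 0ℤ * - e + z) ca)))
      (trans (lemma e) (cong (λ z → 1ℤ - z) e²)))
      where
      lemma : ∀ e → - e * e + (0ℤ * - e + 1ℤ) ≡ 1ℤ - e * e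
      lemma = solve-∀
    h₀ (suc (suc j)) = trans (Z.∑-suc _) (trans (cong (λ z → - b j * e + z) (trans (Z.∑-suc _) (cong (λ z → - c j * - e + z) (Sa j))))
      (lemma e (b j) (c j)))
      where
      lemma : ∀ e b c → - b * e + (- c * - e + e * (b - c)) ≡ 0ℤ
      lemma = solve-∀
    h₀₁ : e * - e + gram B₂ zero (suc zero) ≡ 0ℤ
    h₀₁ = trans (cong (λ z → e * - e + z) (trans (gram-border₀ b₂ B₁ zero) (trans (Z.∑-suc _) (cong (λ z → 0ℤ * e + z) cb))))
      (trans (lemma e) (cong (λ z → 1ℤ - z) e²))
      where
      lemma : ∀ e → e * - e + (0ℤ * e + 1ℤ) ≡ 1ℤ - e * e
      lemma = solve-∀
    h₀ₛ : ∀ j → e * a j + gram B₂ zero (suc (suc j)) ≡ 0ℤ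
    h₀ₛ j = trans (cong (λ z → e * a j + z) (trans (gram-border₀ b₂ B₁ (suc j)) (trans (Z.∑-suc _) (cong (λ z → - c j * e + z) (Sb j)))))
      (lemma e (a j) (c j))
      where
      lemma : ∀ e a c → e * a + (- c * e + e * (c - a)) ≡ 0ℤ
      lemma = solve-∀
    h₁ₛ : ∀ j → - e * a j + gram B₂ (suc zero) (suc (suc j)) ≡ 0ℤ
    h₁ₛ j = trans (cong (λ z → - e * a j + z) (trans (gram-border b₂ B₁ zero (suc j)) (cong (λ z → e * b j + z) (trans (gram-border₀ c S j) (Sc j)))))
      (lemma e (a j) (b j))
      where
      lemma : ∀ e a b → - e * a + (e * b + e * (a - b)) ≡ 0ℤ
      lemma = solve-∀
    swap : ∀ i j → a₃ j * a₃ i + gram B₂ j i ≡ 0ℤ → a₃ i * a₃ j + gram B₂ i j ≡ 0ℤ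
    swap i j eq = trans (cong₂ _+_ (ℤₚ.*-comm (a₃ i) (a₃ j)) (gram-sym B₂ i j)) eq
    h : ∀ i j → a₃ i * a₃ j + gram B₂ i j ≡ κ * δ i j
    h zero zero = trans (cong (λ z → e * e + z) (trans (gram-border₀₀ b₂ B₁) (trans (Z.∑-suc _) (cong (λ z → e * e + z) (dot-unit ub)))))
      (trans (lemma e (+ n)) (trans (cong (λ z → + n + + 2 * z) e²) κ*1))
      where
      lemma : ∀ e n → e * e + (e * e + n) ≡ n + + 2 * (e * e)
      lemma = solve-∀
    h zero (suc zero) = trans h₀₁ κ*0
    h zero (suc (suc j)) = trans (h₀ₛ j) κ*0
    h (suc zero) zero = trans (swap (suc zero) zero h₀₁) κ*0
    h (suc zero) (suc zero) = trans (cong (λ z → - e * - e + z) (trans (gram-border b₂ B₁ zero zero) (cong (λ z → e * e + z) (trans (gram-border₀₀ c S) (dot-unit uc)))))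
      (trans (lemma e (+ n)) (trans (cong (λ z → + n + + 2 * z) e²) κ*1))
      where
      lemma : ∀ e n → - e * - e + (e * e + n) ≡ n + + 2 * (e * e)
      lemma = solve-∀
    h (suc zero) (suc (suc j)) = trans (h₁ₛ j) κ*0
    h (suc (suc i)) zero = trans (swap (suc (suc i)) zero (h₀ₛ i)) κ*0
    h (suc (suc i)) (suc zero) = trans (swap (suc (suc i)) (suc zero) (h₁ₛ i)) κ*0
    h (suc (suc i)) (suc (suc j)) = trans
      (cong (λ z → a i * a j + z) (trans (gram-border b₂ B₁ (suc i) (suc j)) (cong (λ z → b i * b j + z) (gram-border c S i j))))
      (trans (lemma (a i * a j) (b i * b j) (c i * c j) (gram S i j)) (complement i j))
      where
      lemma : ∀ x y z g → x + (y + (z + g)) ≡ x + y + z + g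
      lemma = solve-∀

  -- M = a aᵀ + b bᵀ + c cᵀ, where (a b c) has Gram matrix 4t + J. The kernel of S contains a + b + c, and skewness forces S to
  -- permute the differences cyclically.
  augment-triple : ∀ m {n} {S M : Matrix ℤ n} {κ} {a b c x y z : Vector ℤ n} → Defect κ S M →
    + n ≡ + 4 * + suc m + 1ℤ → κ ≡ + n + + 2 → (∀ i j → (S Z.⊗ M) i j ≡ (M Z.⊗ S) i j) →
    (∀ i → Unit (a i)) → (∀ i → Unit (b i)) → (∀ i → Unit (c i)) →
    dot b a ≡ 1ℤ → dot c a ≡ 1ℤ → dot c b ≡ 1ℤ →
    (∀ i j → M i j ≡ a i * a j + b i * b j + c i * c j) →
    (∀ i → apply M x i ≡ + 2 * a i) → (∀ i → apply M y i ≡ + 2 * b i) → (∀ i → apply M z i ≡ + 2 * c i) →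
    Extension κ (suc (suc (suc n)))
  augment-triple m {n} {S} {M} {κ} {a₀} {b₀} {c₀} {x₀} {y₀} {z₀} defect n≡ κ≡ SM≡MS ua₀ ub₀ uc₀ ba₀ ca₀ cb₀ M≡₀ Mx₀ My₀ Mz₀ =
    border₃ {S = S} {a₀} {b₀} {c₀} {e = e} seidel e-unit κ≡ ua₀ ub₀ uc₀ ba₀ ca₀ cb₀ (halve (λ i → b₀ i - c₀ i) ra.double)
      (halve (λ i → c₀ i - a₀ i) (λ i → trans (rb.double i) (cong (_* (c₀ i - a₀ i)) (sym β≡β′))))
      (halve (λ i → a₀ i - b₀ i) (λ i → trans (rc.double i) (cong (_* (a₀ i - b₀ i)) (sym (trans β≡β′ β′≡β″)))))
      (λ i j → trans (cong (_+ gram S i j) (sym (M≡₀ i j))) (complement i j))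
    where
    open Defect defect
    τ = + suc m
    apply-SS : ∀ v i → apply S (apply S v) i ≡ apply M v i - κ * v i
    apply-SS v i = begin
      Z.∑ n (λ j → S i j * Z.∑ n (λ k → S j k * v k))
        ≡⟨ Z.∑-cong (λ j → sym (Z.∑-*ˡ (S i j) _)) ⟩
      Z.∑ n (λ j → Z.∑ n (λ k → S i j * (S j k * v k)))
        ≡⟨ Z.∑-comm _ ⟩
      Z.∑ n (λ k → Z.∑ n (λ j → S i j * (S j k * v k)))
        ≡⟨ Z.∑-cong (λ k → trans (Z.∑-cong (λ j → trans (cong (λ z → S i j * (z * v k)) (skew-of seidel k j)) (shuffle (S i j) (S k j) (v k)))) (Z.∑-*ˡ (- v k) _)) ⟩
      Z.∑ n (λ k → - v k * gram S i k)
        ≡⟨ Z.∑-cong (λ k → trans (solve-gram (M i k) (gram S i k) (v k)) (cong (λ z → M i k * v k + - z * v k) (complement i k))) ⟩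
      Z.∑ n (λ k → M i k * v k + - (κ * δ i k) * v k)
        ≡⟨ Z.∑-cong (λ k → cong (λ z → M i k * v k + z) (reorder κ (δ i k) (v k))) ⟩
      Z.∑ n (λ k → M i k * v k + - κ * (v k * δ i k))
        ≡⟨ trans (Z.∑-+ _ _) (cong (λ z → apply M v i + z) (trans (Z.∑-*ˡ (- κ) _) (cong (- κ *_) (∑-δ v i)))) ⟩
      apply M v i + - κ * v i
        ≡⟨ cong (λ z → apply M v i + z) (sym (ℤₚ.neg-distribˡ-* κ (v i))) ⟩
      apply M v i - κ * v i ∎
      where
      shuffle : ∀ s s′ v → s * (- s′ * v) ≡ - v * (s * s′)
      shuffle = solve-∀
      solve-gram : ∀ x g v → - v * g ≡ x * v + - (x + g) * v
      solve-gram = solve-∀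
      reorder : ∀ κ d v → - (κ * d) * v ≡ - κ * (v * d)
      reorder = solve-∀

    -- Stated for one cyclic order of the three vectors and used for all three. The vector `x` with
    -- M x = 2 a replaces an inverse of `M`: 2 S a = S M x = M S x lies in the span of `a`, `b` and
    -- `c`.
    module Rotation (a b c x : Vector ℤ n) (ua : ∀ i → Unit (a i)) (ub : ∀ i → Unit (b i)) (uc : ∀ i → Unit (c i))
                    (ab : dot a b ≡ 1ℤ) (bc : dot b c ≡ 1ℤ) (ca : dot c a ≡ 1ℤ)
                    (M≡ : ∀ i j → M i j ≡ a i * a j + b i * b j + c i * c j) (Mx : ∀ i → apply M x i ≡ + 2 * a i) where

      apply-M : ∀ v i → apply M v i ≡ dot a v * a i + dot b v * b i + dot c v * c i
      apply-M v i = trans (dot-cong {v = v} (M≡ i) (λ _ → refl)) (trans (dot-linear₃ (a i) (b i) (c i) a b c v)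
        (lemma (a i) (b i) (c i) (dot a v) (dot b v) (dot c v)))
        where
        lemma : ∀ a b c x y z → a * x + b * y + c * z ≡ x * a + y * b + z * c
        lemma = solve-∀
      s : Vector ℤ n
      s k = 1ℤ * a k + 1ℤ * b k + 1ℤ * c k
      dot-s : ∀ v → dot v s ≡ 1ℤ * dot v a + 1ℤ * dot v b + 1ℤ * dot v c
      dot-s v = dot-linear₃ʳ 1ℤ 1ℤ 1ℤ v a b c
      aa = dot-unit ua
      bb = dot-unit ub
      cc = dot-unit uc
      ba = trans (dot-comm b a) ab
      cb = trans (dot-comm c b) bc
      ac = trans (dot-comm a c) ca
      as : dot a s ≡ κ
      as = trans (dot-s a) (trans (cong₂ (λ p q → p + 1ℤ * q) (cong₂ (λ p q → 1ℤ * p + 1ℤ * q) aa ab) ac) (trans (lemma (+ n)) (sym κ≡)))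
        where
        lemma : ∀ n → 1ℤ * n + 1ℤ * 1ℤ + 1ℤ * 1ℤ ≡ n + + 2
        lemma = solve-∀
      bs : dot b s ≡ κ
      bs = trans (dot-s b) (trans (cong₂ (λ p q → p + 1ℤ * q) (cong₂ (λ p q → 1ℤ * p + 1ℤ * q) ba bb) bc) (trans (lemma (+ n)) (sym κ≡)))
        where
        lemma : ∀ n → 1ℤ * 1ℤ + 1ℤ * n + 1ℤ * 1ℤ ≡ n + + 2
        lemma = solve-∀
      cs : dot c s ≡ κ
      cs = trans (dot-s c) (trans (cong₂ (λ p q → p + 1ℤ * q) (cong₂ (λ p q → 1ℤ * p + 1ℤ * q) ca cb) cc) (trans (lemma (+ n)) (sym κ≡)))
        where
        lemma : ∀ n → 1ℤ * 1ℤ + 1ℤ * 1ℤ + 1ℤ * n ≡ n + + 2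
        lemma = solve-∀
      -- The sum `s` has product n + 2 = κ with each of the three vectors, so M s = κ s, while S² =
      -- M - κ.
      SSs≡0 : ∀ i → apply S (apply S s) i ≡ 0ℤ
      SSs≡0 i = trans (apply-SS s i) (ℤₚ.i≡j⇒i-j≡0 (trans (apply-M s i)
        (trans (cong₂ (λ p q → p + q * c i) (cong₂ (λ p q → p * a i + q * b i) as bs) cs) (lemma κ (a i) (b i) (c i)))))
        where
        lemma : ∀ κ a b c → κ * a + κ * b + κ * c ≡ κ * (1ℤ * a + 1ℤ * b + 1ℤ * c)
        lemma = solve-∀
      Ss≡0 : ∀ i → apply S s i ≡ 0ℤ
      Ss≡0 = ∑-squares-zero {t = apply S s} (begin
        dot (apply S s) (apply S s)        ≡⟨ ℤₚ.neg-involutive _ ⟨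
        - - dot (apply S s) (apply S s)    ≡⟨ cong -_ (apply-skew (skew-of seidel) s (apply S s)) ⟨
        - dot s (apply S (apply S s))      ≡⟨ cong -_ (Z.∑-0 (λ k → trans (cong (s k *_) (SSs≡0 k)) (ℤₚ.*-zeroʳ (s k)))) ⟩
        0ℤ                                 ∎)
      α β γ : ℤ
      α = dot a (apply S x)
      β = dot b (apply S x)
      γ = dot c (apply S x)
      expansion : ∀ i → + 2 * apply S a i ≡ α * a i + β * b i + γ * c i
      expansion i = begin
        + 2 * apply S a i                  ≡⟨ Z.∑-*ˡ (+ 2) _ ⟨
        Z.∑ n (λ k → + 2 * (S i k * a k))  ≡⟨ Z.∑-cong (λ k → trans (shuffle (S i k) (a k)) (cong (S i k *_) (sym (Mx k)))) ⟩
        Z.∑ n (λ k → S i k * apply M x k)  ≡⟨ ⊗-apply S M ⟩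
        dot ((S Z.⊗ M) i) x                ≡⟨ dot-cong {v = x} (SM≡MS i) (λ _ → refl) ⟩
        dot ((M Z.⊗ S) i) x                ≡⟨ ⊗-apply M S ⟨
        apply M (apply S x) i              ≡⟨ apply-M (apply S x) i ⟩
        α * a i + β * b i + γ * c i        ∎
        where
        shuffle : ∀ s a → + 2 * (s * a) ≡ s * (+ 2 * a)
        shuffle = solve-∀
        ⊗-apply : ∀ (A B : Matrix ℤ n) → Z.∑ n (λ k → A i k * apply B x k) ≡ dot ((A Z.⊗ B) i) x
        ⊗-apply A B = begin
          Z.∑ n (λ k → A i k * Z.∑ n (λ l → B k l * x l))    ≡⟨ Z.∑-cong (λ k → trans (sym (Z.∑-*ˡ (A i k) _)) (Z.∑-cong (λ l → sym (ℤₚ.*-assoc (A i k) (B k l) (x l))))) ⟩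
          Z.∑ n (λ k → Z.∑ n (λ l → A i k * B k l * x l))    ≡⟨ Z.∑-comm _ ⟩
          Z.∑ n (λ l → Z.∑ n (λ k → A i k * B k l * x l))    ≡⟨ Z.∑-cong (λ l → Z.∑-*ʳ (x l) _) ⟩
          dot ((A Z.⊗ B) i) x                                ∎
      dot-2S : ∀ v → dot v (λ i → α * a i + β * b i + γ * c i) ≡ + 2 * dot v (apply S a)
      dot-2S v = trans (Z.∑-cong (λ k → trans (cong (v k *_) (sym (expansion k))) (shuffle (v k) (apply S a k)))) (Z.∑-*ˡ (+ 2) _)
        where
        shuffle : ∀ v s → v * (+ 2 * s) ≡ + 2 * (v * s)
        shuffle = solve-∀
      -- Pairing 2 S a with `s`, which `S` kills, gives κ times this sum.
      sum≡0 : α + β + γ ≡ 0ℤ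
      sum≡0 = [ (λ κ≡0 → contradiction (trans (sym κ≡0) (trans κ≡ (ℤₚ.+-comm (+ n) (+ 2)))) λ ()) , (λ z → z) ]′ (ℤₚ.i*j≡0⇒i≡0∨j≡0 κ (begin
        κ * (α + β + γ)                             ≡⟨ lemma κ α β γ ⟩
        α * κ + β * κ + γ * κ                       ≡⟨ cong₂ (λ p q → p + γ * q) (cong₂ (λ p q → α * p + β * q) (trans (dot-comm s a) as) (trans (dot-comm s b) bs)) (trans (dot-comm s c) cs) ⟨
        α * dot s a + β * dot s b + γ * dot s c     ≡⟨ dot-linear₃ʳ α β γ s a b c ⟨
        dot s (λ i → α * a i + β * b i + γ * c i)   ≡⟨ dot-2S s ⟩
        + 2 * dot s (apply S a)                     ≡⟨ cong (+ 2 *_) (trans (apply-skew (skew-of seidel) s a) (cong -_ (Z.∑-0 (λ k → trans (cong (_* a k) (Ss≡0 k)) (ℤₚ.*-zeroˡ (a k)))))) ⟩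
        0ℤ                                          ∎))
        where
        lemma : ∀ κ α β γ → κ * (α + β + γ) ≡ α * κ + β * κ + γ * κ
        lemma = solve-∀
      -- Skewness makes `a` orthogonal to S a. As `a` has squared norm 4τ + 1 and product 1 with the
      -- other two, pairing 2 S a with `a` gives 4τα plus the vanishing sum.
      α≡0 : α ≡ 0ℤ
      α≡0 = *-cancel-suc m (*-cancel-suc 3 (begin
        + 4 * (τ * α)
          ≡⟨ lemma τ α β γ ⟩
        (α * (+ 4 * τ + 1ℤ) + β * 1ℤ + γ * 1ℤ) - (α + β + γ)
          ≡⟨ cong₂ _-_ (cong₂ (λ p q → p + γ * q) (cong₂ (λ p q → α * p + β * q) (sym (trans aa n≡)) (sym ab)) (sym ac)) sum≡0 ⟩
        (α * dot a a + β * dot a b + γ * dot a c) - 0ℤ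
          ≡⟨ cong (_- 0ℤ) (trans (sym (dot-linear₃ʳ α β γ a a b c)) (trans (dot-2S a) (cong (+ 2 *_) (apply-skew-self (skew-of seidel) a)))) ⟩
        0ℤ
          ≡⟨ cong (+ 4 *_) (ℤₚ.*-zeroʳ τ) ⟨
        + 4 * (τ * 0ℤ) ∎))
        where
        lemma : ∀ τ α β γ → + 4 * (τ * α) ≡ (α * (+ 4 * τ + 1ℤ) + β * 1ℤ + γ * 1ℤ) - (α + β + γ)
        lemma = solve-∀
      double : ∀ i → + 2 * apply S a i ≡ β * (b i - c i)
      double i = trans (expansion i) (trans (eliminate α β γ (a i) (b i) (c i)) (trans (cong₂ (λ p q → β * (b i - c i) + (p * (a i - c i) + q * c i)) α≡0 sum≡0) (ℤₚ.+-identityʳ _)))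
        where
        eliminate : ∀ α β γ a b c → α * a + β * b + γ * c ≡ β * (b - c) + (α * (a - c) + (α + β + γ) * c)
        eliminate = solve-∀
      dot-next : + 2 * dot b (apply S a) ≡ β * (+ n - 1ℤ)
      dot-next = trans (double-dot b) (cong (β *_) (cong₂ (λ p q → 1ℤ * p + - 1ℤ * q) bb bc) ∙ lemma β (+ n))
        where
        infixr 4 _∙_
        _∙_ = trans
        lemma : ∀ β n → β * (1ℤ * n + - 1ℤ * 1ℤ) ≡ β * (n - 1ℤ)
        lemma = solve-∀
        double-dot : ∀ v → + 2 * dot v (apply S a) ≡ β * (1ℤ * dot v b + - 1ℤ * dot v c)
        double-dot v = begin
          + 2 * dot v (apply S a)                       ≡⟨ Z.∑-*ˡ (+ 2) _ ⟨
          Z.∑ n (λ k → + 2 * (v k * apply S a k))       ≡⟨ Z.∑-cong (λ k → trans (shuffle (v k) (apply S a k)) (trans (cong (v k *_) (double k)) (shuffle₂ (v k) β (b k) (c k)))) ⟩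
          Z.∑ n (λ k → β * (v k * (1ℤ * b k + - 1ℤ * c k))) ≡⟨ trans (Z.∑-*ˡ β _) (cong (β *_) (dot-linearʳ 1ℤ (- 1ℤ) v b c)) ⟩
          β * (1ℤ * dot v b + - 1ℤ * dot v c)           ∎
          where
          shuffle : ∀ v s → + 2 * (v * s) ≡ v * (+ 2 * s)
          shuffle = solve-∀
          shuffle₂ : ∀ v β b c → v * (β * (b - c)) ≡ β * (v * (1ℤ * b + - 1ℤ * c))
          shuffle₂ = solve-∀
      dot-previous : + 2 * dot c (apply S a) ≡ - (β * (+ n - 1ℤ))
      dot-previous = begin
        + 2 * dot c (apply S a)                     ≡⟨ dot-2S c ⟨
        dot c (λ i → α * a i + β * b i + γ * c i)   ≡⟨ dot-linear₃ʳ α β γ c a b c ⟩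
        α * dot c a + β * dot c b + γ * dot c c     ≡⟨ cong₂ (λ p q → p + γ * q) (cong₂ (λ p q → α * p + β * q) ca cb) cc ⟩
        α * 1ℤ + β * 1ℤ + γ * + n                   ≡⟨ eliminate α β γ (+ n) ⟩
        - (β * (+ n - 1ℤ)) + ((α + β + γ) * + n - α * (+ n - 1ℤ)) ≡⟨ cong₂ (λ p q → - (β * (+ n - 1ℤ)) + (p * + n - q * (+ n - 1ℤ))) sum≡0 α≡0 ⟩
        - (β * (+ n - 1ℤ)) + 0ℤ                     ≡⟨ ℤₚ.+-identityʳ _ ⟩
        - (β * (+ n - 1ℤ))                          ∎
        where
        eliminate : ∀ α β γ n → α * 1ℤ + β * 1ℤ + γ * n ≡ - (β * (n - 1ℤ)) + ((α + β + γ) * n - α * (n - 1ℤ))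
        eliminate = solve-∀

    rotate : ∀ {p q r : ℤ} {x} → x ≡ p + q + r → x ≡ q + r + p
    rotate {p} {q} {r} e = trans e (lemma p q r)
      where
      lemma : ∀ p q r → p + q + r ≡ q + r + p
      lemma = solve-∀
    ab₀ = trans (dot-comm a₀ b₀) ba₀
    bc₀ = trans (dot-comm b₀ c₀) cb₀
    M≡₁ : ∀ i j → M i j ≡ b₀ i * b₀ j + c₀ i * c₀ j + a₀ i * a₀ j
    M≡₁ i j = rotate {a₀ i * a₀ j} (M≡₀ i j)
    M≡₂ : ∀ i j → M i j ≡ c₀ i * c₀ j + a₀ i * a₀ j + b₀ i * b₀ j
    M≡₂ i j = rotate {b₀ i * b₀ j} (M≡₁ i j)
    module ra = Rotation a₀ b₀ c₀ x₀ ua₀ ub₀ uc₀ ab₀ bc₀ ca₀ M≡₀ Mx₀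
    module rb = Rotation b₀ c₀ a₀ y₀ ub₀ uc₀ ua₀ bc₀ ca₀ ab₀ M≡₁ My₀
    module rc = Rotation c₀ a₀ b₀ z₀ uc₀ ua₀ ub₀ ca₀ ab₀ bc₀ M≡₂ Mz₀

    n-1≡4τ : + n - 1ℤ ≡ + 4 * τ
    n-1≡4τ = trans (cong (_- 1ℤ) n≡) (lemma τ)
      where
      lemma : ∀ x → + 4 * x + 1ℤ - 1ℤ ≡ + 4 * x
      lemma = solve-∀
    cancel-4τ : ∀ {x y} → x * (+ n - 1ℤ) ≡ y * (+ n - 1ℤ) → x ≡ y
    cancel-4τ {x} {y} e = *-cancel-suc m (*-cancel-suc 3 (trans (lemma x τ) (trans (cong (x *_) (sym n-1≡4τ)) (trans e (trans (cong (y *_) n-1≡4τ) (sym (lemma y τ)))))))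
      where
      lemma : ∀ x τ → + 4 * (τ * x) ≡ x * (+ 4 * τ)
      lemma = solve-∀
    adjoint : ∀ u v → + 2 * dot u (apply S v) ≡ - (+ 2 * dot v (apply S u))
    adjoint u v = trans (cong (+ 2 *_) (trans (apply-skew (skew-of seidel) u v) (cong -_ (dot-comm _ v)))) (sym (ℤₚ.neg-distribʳ-* (+ 2) _))
    -- Skewness equates the product of `b₀` with S a₀ to minus that of `a₀` with S b₀; doubled,
    -- these are n - 1 times `ra.β` and minus n - 1 times `rb.β`.
    β≡β′ : ra.β ≡ rb.β
    β≡β′ = cancel-4τ (trans (sym ra.dot-next) (trans (adjoint b₀ a₀) (trans (cong -_ rb.dot-previous) (ℤₚ.neg-involutive _))))
    β′≡β″ : rb.β ≡ rc.β
    β′≡β″ = cancel-4τ (trans (sym rb.dot-next) (trans (adjoint c₀ b₀) (trans (cong -_ rc.dot-previous) (ℤₚ.neg-involutive _))))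
    β = ra.β
    norm : dot (apply S a₀) (apply S a₀) ≡ + 2 * (+ n - 1ℤ)
    norm = begin
      dot (apply S a₀) (apply S a₀)
        ≡⟨ ℤₚ.neg-involutive _ ⟨
      - - dot (apply S a₀) (apply S a₀)
        ≡⟨ cong -_ (apply-skew (skew-of seidel) a₀ (apply S a₀)) ⟨
      - dot a₀ (apply S (apply S a₀))
        ≡⟨ cong -_ (dot-cong {u = a₀} (λ _ → refl) (λ i → trans (apply-SS a₀ i) (trans (cong (_- κ * a₀ i) (ra.apply-M a₀ i)) (trans
             (cong₂ (λ p q → p + q * c₀ i - κ * a₀ i) (cong₂ (λ p q → p * a₀ i + q * b₀ i) ra.aa ba₀) ca₀)
             (trans (cong (λ k → + n * a₀ i + 1ℤ * b₀ i + 1ℤ * c₀ i - k * a₀ i) κ≡) (lemma₁ (+ n) (a₀ i) (b₀ i) (c₀ i))))))) ⟩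
      - dot a₀ (λ i → - (+ 2) * a₀ i + 1ℤ * b₀ i + 1ℤ * c₀ i)
        ≡⟨ cong -_ (trans (dot-linear₃ʳ (- (+ 2)) 1ℤ 1ℤ a₀ a₀ b₀ c₀) (cong₂ (λ p q → p + 1ℤ * q) (cong₂ (λ p q → - (+ 2) * p + 1ℤ * q) ra.aa ab₀) ra.ac)) ⟩
      - (- (+ 2) * + n + 1ℤ * 1ℤ + 1ℤ * 1ℤ)
        ≡⟨ lemma₂ (+ n) ⟩
      + 2 * (+ n - 1ℤ) ∎
      where
      lemma₁ : ∀ n a b c → n * a + 1ℤ * b + 1ℤ * c - (n + + 2) * a ≡ - (+ 2) * a + 1ℤ * b + 1ℤ * c
      lemma₁ = solve-∀
      lemma₂ : ∀ n → - (- (+ 2) * n + 1ℤ * 1ℤ + 1ℤ * 1ℤ) ≡ + 2 * (n - 1ℤ)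
      lemma₂ = solve-∀
    -- Squared norms in 2 S a = β (b - c): the left side has 8 (n - 1), and b - c has 2 (n - 1).
    β² : β * β ≡ + 4
    β² = *-cancel-suc 1 (cancel-4τ (begin
      + 2 * (β * β) * (+ n - 1ℤ)
        ≡⟨ lemma₁ β (+ n) ⟩
      β * β * (+ n + + n - + 2 * 1ℤ)
        ≡⟨ cong₂ (λ p q → β * β * (p - + 2 * q)) (cong₂ _+_ (sym ra.bb) (sym ra.cc)) (sym bc₀) ⟩
      β * β * (dot b₀ b₀ + dot c₀ c₀ - + 2 * dot b₀ c₀)
        ≡⟨ cong (λ z → β * β * (dot b₀ b₀ + dot c₀ c₀ + z)) (ℤₚ.neg-distribˡ-* (+ 2) (dot b₀ c₀)) ⟩
      β * β * (dot b₀ b₀ + dot c₀ c₀ + - (+ 2) * dot b₀ c₀)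
        ≡⟨ cong (β * β *_) (trans (Z.∑-+ _ _) (cong₂ _+_ (Z.∑-+ _ _) (Z.∑-*ˡ (- (+ 2)) _))) ⟨
      β * β * Z.∑ n (λ k → b₀ k * b₀ k + c₀ k * c₀ k + - (+ 2) * (b₀ k * c₀ k))
        ≡⟨ Z.∑-*ˡ (β * β) _ ⟨
      Z.∑ n (λ k → β * β * (b₀ k * b₀ k + c₀ k * c₀ k + - (+ 2) * (b₀ k * c₀ k)))
        ≡⟨ Z.∑-cong (λ k → trans (lemma₂ β (b₀ k) (c₀ k)) (trans (cong (λ z → z * z) (sym (ra.double k))) (lemma₃ (apply S a₀ k)))) ⟩
      Z.∑ n (λ k → + 4 * (apply S a₀ k * apply S a₀ k))
        ≡⟨ trans (Z.∑-*ˡ (+ 4) _) (cong (+ 4 *_) norm) ⟩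
      + 4 * (+ 2 * (+ n - 1ℤ))
        ≡⟨ lemma₄ (+ n) ⟩
      + 2 * + 4 * (+ n - 1ℤ) ∎))
      where
      lemma₁ : ∀ β n → + 2 * (β * β) * (n - 1ℤ) ≡ β * β * (n + n - + 2 * 1ℤ)
      lemma₁ = solve-∀
      lemma₂ : ∀ β b c → β * β * (b * b + c * c + - (+ 2) * (b * c)) ≡ (β * (b - c)) * (β * (b - c))
      lemma₂ = solve-∀
      lemma₃ : ∀ x → (+ 2 * x) * (+ 2 * x) ≡ + 4 * (x * x)
      lemma₃ = solve-∀
      lemma₄ : ∀ n → + 4 * (+ 2 * (n - 1ℤ)) ≡ + 2 * + 4 * (n - 1ℤ)
      lemma₄ = solve-∀
    half-β : ∃ λ e → Unit e × β ≡ + 2 * e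
    half-β = [ (λ p → 1ℤ , inj₁ refl , ℤₚ.i-j≡0⇒i≡j β (+ 2) p) , (λ p → - 1ℤ , inj₂ refl , ℤₚ.i-j≡0⇒i≡j β (- (+ 2)) p) ]′
      (ℤₚ.i*j≡0⇒i≡0∨j≡0 (β - + 2) (trans (lemma β) (ℤₚ.i≡j⇒i-j≡0 β²)))
      where
      lemma : ∀ x → (x - + 2) * (x - - (+ 2)) ≡ x * x - + 4
      lemma = solve-∀
    e = proj₁ half-β
    e-unit = proj₁ (proj₂ half-β)
    halve : ∀ (d : Vector ℤ n) {v} → (∀ i → + 2 * apply S v i ≡ β * d i) → ∀ i → apply S v i ≡ e * d i
    halve d eq i = *-cancel-suc 1 (trans (eq i) (trans (cong (_* d i) (proj₂ (proj₂ half-β))) (ℤₚ.*-assoc (+ 2) e (d i))))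

  -- The rank three case: four classes of indices and their sign vectors.

  Bit : ℤ → Set
  Bit x = x ≡ 0ℤ ⊎ x ≡ 1ℤ

  bit-+ : ∀ {x y} → Bit x → Bit y → x * y ≡ 0ℤ → Bit (x + y)
  bit-+ (inj₁ refl) (inj₁ refl) _ = inj₁ refl
  bit-+ (inj₁ refl) (inj₂ refl) _ = inj₂ refl
  bit-+ (inj₂ refl) (inj₁ refl) _ = inj₂ refl
  bit-+ (inj₂ refl) (inj₂ refl) ()

  bit-+-zero : ∀ {x y} → Bit x → Bit y → x + y ≡ 0ℤ → x ≡ 0ℤ × y ≡ 0ℤ
  bit-+-zero (inj₁ refl) (inj₁ refl) _ = refl , refl
  bit-+-zero (inj₁ refl) (inj₂ refl) ()
  bit-+-zero (inj₂ refl) (inj₁ refl) ()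
  bit-+-zero (inj₂ refl) (inj₂ refl) ()

  bit² : ∀ {x} → Bit x → x * x ≡ x
  bit² (inj₁ refl) = refl
  bit² (inj₂ refl) = refl

  bit-complement : ∀ {x} → Bit x → 0ℤ ℤ.≤ 1ℤ - x
  bit-complement (inj₁ refl) = +≤+ ℕ.z≤n
  bit-complement (inj₂ refl) = +≤+ ℕ.z≤n

  bit-zero : ∀ {x} → Bit x → 1ℤ - x ≢ 0ℤ → x ≡ 0ℤ
  bit-zero (inj₁ e)    _ = e
  bit-zero (inj₂ refl) h = contradiction refl h

  ∑-nonzero : ∀ {n} (t : Vector ℤ n) → Z.∑ n t ≢ 0ℤ → ∃ λ i → t i ≢ 0ℤ
  ∑-nonzero t ≢0 with any? (λ i → ¬? (t i ℤ.≟ 0ℤ))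
  ... | yes p = p
  ... | no ¬p = contradiction (Z.∑-0 (λ i → decidable-stable (t i ℤ.≟ 0ℤ) (λ ti≢0 → ¬p (i , ti≢0)))) ≢0

  pos-*-nonneg : ∀ m {x} → 0ℤ ℤ.≤ x → 0ℤ ℤ.≤ + suc m * x
  pos-*-nonneg m {+ n} _ = subst (0ℤ ℤ.≤_) (ℤₚ.pos-* (suc m) n) (+≤+ ℕ.z≤n)

  nonneg-* : ∀ {x y} → 0ℤ ℤ.≤ x → 0ℤ ℤ.≤ y → 0ℤ ℤ.≤ x * y
  nonneg-* {+ m} {+ n} _ _ = subst (0ℤ ℤ.≤_) (ℤₚ.pos-* m n) (+≤+ ℕ.z≤n)

  nonneg-8x+1 : ∀ x → 0ℤ ℤ.≤ + 8 * x + 1ℤ → 0ℤ ℤ.≤ x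
  nonneg-8x+1 (+ n)        _ = +≤+ ℕ.z≤n
  nonneg-8x+1 -[1+ 0 ]     ()
  nonneg-8x+1 -[1+ suc n ] h = contradiction (pos-cancel-nonneg 7 (subst (0ℤ ℤ.≤_) (lemma -[1+ suc n ]) (ℤₚ.+-mono-≤ h (+≤+ {0} {7} ℕ.z≤n)))) λ ()
    where
    lemma : ∀ x → + 8 * x + 1ℤ + + 7 ≡ + 8 * (x + 1ℤ)
    lemma = solve-∀

  ∑-affine : ∀ {n} α β (s : Vector ℤ n) → Z.∑ n (λ k → α * s k + β * 1ℤ) ≡ α * Z.∑ n s + β * + n
  ∑-affine {n} α β s = trans (∑-combine α β s (λ _ → 1ℤ)) (cong (λ z → α * Z.∑ n s + β * z) (∑-1 n))

  -- M is, up to the signs d, the matrix 4P - J for an equivalence relation P; a class has τ + x elements, and the diagonal of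
  -- M (M² - 4 τ M) = κ (M² - 4 τ M) reads 4 x (x - 1) + (sum of all x) = τ + 1.
  module Classes {n} (m : ℕ) {τ κ : ℤ} (τ≡ : τ ≡ + suc m) (n≡ : + n ≡ + 4 * τ + 1ℤ) (κ≡ : κ ≡ + 4 * τ + + 3) (i₀ : Fin n)
    (M P : Matrix ℤ n) (d : Vector ℤ n) (d-unit : ∀ i → Unit (d i))
    (P-bit : ∀ i j → Bit (P i j)) (P-refl : ∀ i → P i i ≡ 1ℤ) (P-sym : ∀ i j → P j i ≡ P i j)
    (P-class : ∀ {i j} → P i j ≡ 1ℤ → ∀ k → P i k ≡ P j k)
    (M≡ : ∀ i j → M i j ≡ d i * d j * (+ 4 * P i j - 1ℤ)) where

    size excess : Vector ℤ n
    size i = Z.∑ n (P i)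
    excess i = size i - τ

    size≡ : ∀ i → size i ≡ τ + excess i
    size≡ i = lemma (size i) τ
      where
      lemma : ∀ s t → s ≡ t + (s - t)
      lemma = solve-∀

    P-excess : ∀ i j → Bit (P i j) → P i j * excess j ≡ P i j * excess i
    P-excess i j (inj₁ e) = trans (cong (_* excess j) e) (sym (cong (_* excess i) e))
    P-excess i j (inj₂ e) = cong (λ z → P i j * (z - τ)) (sym (Z.∑-cong (P-class e)))

    PP : ∀ i j → Z.∑ n (λ k → P i k * P k j) ≡ size i * P i j
    PP i j = trans (Z.∑-cong (λ k → pointwise k (P-bit i k))) (Z.∑-*ʳ (P i j) (P i))
      where
      pointwise : ∀ k → Bit (P i k) → P i k * P k j ≡ P i k * P i j
      pointwise k (inj₁ e) = trans (cong (_* P k j) e) (sym (cong (_* P i j) e))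
      pointwise k (inj₂ e) = cong (P i k *_) (sym (P-class e j))

    H : Matrix ℤ n
    H i j = (M Z.⊗ M) i j - + 4 * τ * M i j

    M² : ∀ i j → (M Z.⊗ M) i j ≡ d i * d j * (+ 16 * (size i * P i j) - + 4 * size i - + 4 * size j + + n)
    M² i j = begin
      Z.∑ n (λ k → M i k * M k j)
        ≡⟨ Z.∑-cong (λ k → trans (cong₂ _*_ (M≡ i k) (M≡ k j)) (trans (lemma₁ (d i) (d j) (d k) (P i k) (P k j)) (cong (λ z → z * pairing k) (unit² (d-unit k))))) ⟩
      Z.∑ n (λ k → 1ℤ * pairing k)
        ≡⟨ trans (Z.∑-*ˡ 1ℤ pairing) (trans (ℤₚ.*-identityˡ _) (Z.∑-*ˡ (d i * d j) _)) ⟩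
      d i * d j * Z.∑ n (λ k → + 16 * (P i k * P k j) + (- (+ 4) * P i k + (- (+ 4) * P k j + 1ℤ)))
        ≡⟨ cong (d i * d j *_) (trans (Z.∑-+ _ _) (cong₂ _+_ (trans (Z.∑-*ˡ (+ 16) _) (cong (+ 16 *_) (PP i j)))
             (trans (Z.∑-+ _ _) (cong₂ _+_ (Z.∑-*ˡ (- (+ 4)) (P i)) (trans (Z.∑-+ _ _) (cong₂ _+_ (trans (Z.∑-*ˡ (- (+ 4)) (λ k → P k j)) (cong (- (+ 4) *_) (Z.∑-cong (λ k → P-sym j k)))) (∑-1 n))))))) ⟩
      d i * d j * (+ 16 * (size i * P i j) + (- (+ 4) * size i + (- (+ 4) * size j + + n)))
        ≡⟨ cong (d i * d j *_) (lemma₂ (size i * P i j) (size i) (size j) (+ n)) ⟩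
      d i * d j * (+ 16 * (size i * P i j) - + 4 * size i - + 4 * size j + + n) ∎
      where
      pairing : Vector ℤ n
      pairing k = d i * d j * (+ 16 * (P i k * P k j) + (- (+ 4) * P i k + (- (+ 4) * P k j + 1ℤ)))
      lemma₁ : ∀ a b c p q → a * c * (+ 4 * p - 1ℤ) * (c * b * (+ 4 * q - 1ℤ)) ≡ c * c * (a * b * (+ 16 * (p * q) + (- (+ 4) * p + (- (+ 4) * q + 1ℤ))))
      lemma₁ = solve-∀
      lemma₂ : ∀ x y z n → + 16 * x + (- (+ 4) * y + (- (+ 4) * z + n)) ≡ + 16 * x - + 4 * y - + 4 * z + n
      lemma₂ = solve-∀

    H≡ : ∀ i j → H i j ≡ d i * d j * (+ 16 * (excess i * P i j) - + 4 * excess i - + 4 * excess j + 1ℤ)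
    H≡ i j = begin
      (M Z.⊗ M) i j - + 4 * τ * M i j
        ≡⟨ cong₂ (λ x y → x - + 4 * τ * y) (M² i j) (M≡ i j) ⟩
      d i * d j * (+ 16 * (size i * P i j) - + 4 * size i - + 4 * size j + + n) - + 4 * τ * (d i * d j * (+ 4 * P i j - 1ℤ))
        ≡⟨ cong (λ z → d i * d j * (+ 16 * (size i * P i j) - + 4 * size i - + 4 * size j + z) - + 4 * τ * (d i * d j * (+ 4 * P i j - 1ℤ))) n≡ ⟩
      d i * d j * (+ 16 * (size i * P i j) - + 4 * size i - + 4 * size j + (+ 4 * τ + 1ℤ)) - + 4 * τ * (d i * d j * (+ 4 * P i j - 1ℤ))
        ≡⟨ lemma (d i * d j) (size i) (size j) (P i j) τ ⟩
      d i * d j * (+ 16 * (excess i * P i j) - + 4 * excess i - + 4 * excess j + 1ℤ) ∎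
      where
      lemma : ∀ e s s′ p t → e * (+ 16 * (s * p) - + 4 * s - + 4 * s′ + (+ 4 * t + 1ℤ)) - + 4 * t * (e * (+ 4 * p - 1ℤ)) ≡
              e * (+ 16 * ((s - t) * p) - + 4 * (s - t) - + 4 * (s′ - t) + 1ℤ)
      lemma = solve-∀

    H-diagonal : ∀ i → H i i ≡ + 8 * excess i + 1ℤ
    H-diagonal i = trans (H≡ i i) (trans (cong₂ (λ x y → x * (+ 16 * (excess i * y) - + 4 * excess i - + 4 * excess i + 1ℤ)) (unit² (d-unit i)) (P-refl i)) (lemma (excess i)))
      where
      lemma : ∀ x → 1ℤ * (+ 16 * (x * 1ℤ) - + 4 * x - + 4 * x + 1ℤ) ≡ + 8 * x + 1ℤ
      lemma = solve-∀

    module _ (MH : ∀ i → (M Z.⊗ H) i i ≡ κ * H i i) (H-nonneg : ∀ i → 0ℤ ℤ.≤ H i i) where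

      total : ℤ
      total = Z.∑ n excess

      excess-equation : ∀ i → + 4 * (excess i * (excess i - 1ℤ)) + total ≡ τ + 1ℤ
      excess-equation i = *-cancel-suc 3 (begin
        + 4 * (+ 4 * (x * (x - 1ℤ)) + total)
          ≡⟨ lemma₁ x τ total ⟩
        ((+ 16 * x + + 4) * (τ + x) + (+ 4 * total + (+ 4 * x - 1ℤ) * (+ 4 * τ + 1ℤ))) - (+ 4 * τ + + 3) * (+ 8 * x + 1ℤ) + + 4 * (τ + 1ℤ)
          ≡⟨ cong (λ z → z - (+ 4 * τ + + 3) * (+ 8 * x + 1ℤ) + + 4 * (τ + 1ℤ)) sum-up ⟨
        (M Z.⊗ H) i i - (+ 4 * τ + + 3) * (+ 8 * x + 1ℤ) + + 4 * (τ + 1ℤ)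
          ≡⟨ cong (_+ + 4 * (τ + 1ℤ)) (ℤₚ.i≡j⇒i-j≡0 (trans (MH i) (cong₂ _*_ κ≡ (H-diagonal i)))) ⟩
        0ℤ + + 4 * (τ + 1ℤ)
          ≡⟨ ℤₚ.+-identityˡ _ ⟩
        + 4 * (τ + 1ℤ) ∎)
        where
        x = excess i
        lemma₁ : ∀ x t s → + 4 * (+ 4 * (x * (x - 1ℤ)) + s) ≡
          ((+ 16 * x + + 4) * (t + x) + (+ 4 * s + (+ 4 * x - 1ℤ) * (+ 4 * t + 1ℤ))) - (+ 4 * t + + 3) * (+ 8 * x + 1ℤ) + + 4 * (t + 1ℤ)
        lemma₁ = solve-∀
        signs : ∀ a b p x y → a * b * (+ 4 * p - 1ℤ) * (b * a * (+ 16 * (y * p) - + 4 * y - + 4 * x + 1ℤ)) ≡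
                (a * a) * (b * b) * ((+ 4 * p - 1ℤ) * (+ 16 * (p * y) - + 4 * y - + 4 * x + 1ℤ))
        signs = solve-∀
        values : ∀ p x y → (+ 4 * p - 1ℤ) * (+ 16 * (p * x) - + 4 * y - + 4 * x + 1ℤ) ≡
                 + 64 * (p * p) * x - + 16 * (p * y) - + 16 * p * x + + 4 * p - + 16 * (p * x) + + 4 * y + + 4 * x - 1ℤ
        values = solve-∀
        values₂ : ∀ p x y → + 64 * p * x - + 16 * (p * x) - + 16 * p * x + + 4 * p - + 16 * (p * x) + + 4 * y + + 4 * x - 1ℤ ≡
                  (+ 16 * x + + 4) * p + (+ 4 * y + (+ 4 * x - 1ℤ) * 1ℤ)
        values₂ = solve-∀
        entry : ∀ j → M i j * H j i ≡ (+ 16 * x + + 4) * P i j + (+ 4 * excess j + (+ 4 * x - 1ℤ) * 1ℤ)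
        entry j = begin
          M i j * H j i
            ≡⟨ cong₂ _*_ (M≡ i j) (trans (H≡ j i) (cong (λ z → d j * d i * (+ 16 * (excess j * z) - + 4 * excess j - + 4 * x + 1ℤ)) (P-sym i j))) ⟩
          d i * d j * (+ 4 * P i j - 1ℤ) * (d j * d i * (+ 16 * (excess j * P i j) - + 4 * excess j - + 4 * x + 1ℤ))
            ≡⟨ signs (d i) (d j) (P i j) x (excess j) ⟩
          (d i * d i) * (d j * d j) * ((+ 4 * P i j - 1ℤ) * (+ 16 * (P i j * excess j) - + 4 * excess j - + 4 * x + 1ℤ))
            ≡⟨ cong₂ (λ u v → u * ((+ 4 * P i j - 1ℤ) * (+ 16 * v - + 4 * excess j - + 4 * x + 1ℤ))) (cong₂ _*_ (unit² (d-unit i)) (unit² (d-unit j))) (P-excess i j (P-bit i j)) ⟩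
          1ℤ * ((+ 4 * P i j - 1ℤ) * (+ 16 * (P i j * x) - + 4 * excess j - + 4 * x + 1ℤ))
            ≡⟨ trans (ℤₚ.*-identityˡ _) (values (P i j) x (excess j)) ⟩
          + 64 * (P i j * P i j) * x - + 16 * (P i j * excess j) - + 16 * P i j * x + + 4 * P i j - + 16 * (P i j * x) + + 4 * excess j + + 4 * x - 1ℤ
            ≡⟨ cong₂ (λ u v → + 64 * u * x - + 16 * v - + 16 * P i j * x + + 4 * P i j - + 16 * (P i j * x) + + 4 * excess j + + 4 * x - 1ℤ) (bit² (P-bit i j)) (P-excess i j (P-bit i j)) ⟩
          + 64 * P i j * x - + 16 * (P i j * x) - + 16 * P i j * x + + 4 * P i j - + 16 * (P i j * x) + + 4 * excess j + + 4 * x - 1ℤ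
            ≡⟨ values₂ (P i j) x (excess j) ⟩
          (+ 16 * x + + 4) * P i j + (+ 4 * excess j + (+ 4 * x - 1ℤ) * 1ℤ) ∎
        sum-up : (M Z.⊗ H) i i ≡ (+ 16 * x + + 4) * (τ + x) + (+ 4 * total + (+ 4 * x - 1ℤ) * (+ 4 * τ + 1ℤ))
        sum-up = begin
          Z.∑ n (λ j → M i j * H j i)
            ≡⟨ Z.∑-cong entry ⟩
          Z.∑ n (λ j → (+ 16 * x + + 4) * P i j + (+ 4 * excess j + (+ 4 * x - 1ℤ) * 1ℤ))
            ≡⟨ trans (Z.∑-+ _ _) (cong₂ _+_ (Z.∑-*ˡ (+ 16 * x + + 4) (P i)) (∑-affine (+ 4) (+ 4 * x - 1ℤ) excess)) ⟩
          (+ 16 * x + + 4) * size i + (+ 4 * total + (+ 4 * x - 1ℤ) * + n)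
            ≡⟨ cong₂ (λ u v → (+ 16 * x + + 4) * u + (+ 4 * total + (+ 4 * x - 1ℤ) * v)) (size≡ i) n≡ ⟩
          (+ 16 * x + + 4) * (τ + x) + (+ 4 * total + (+ 4 * x - 1ℤ) * (+ 4 * τ + 1ℤ)) ∎

      excess-nonneg : ∀ i → 0ℤ ℤ.≤ excess i
      excess-nonneg i = nonneg-8x+1 (excess i) (subst (0ℤ ℤ.≤_) (H-diagonal i) (H-nonneg i))

      -- If every excess vanished, `excess-equation` would read 0 = τ + 1.
      large : ∃ λ i → excess i ≢ 0ℤ
      large with any? (λ i → ¬? (excess i ℤ.≟ 0ℤ))
      ... | yes p = p
      ... | no ¬p = contradiction (trans (sym (excess-equation i₀)) (trans (cong₂ (λ u v → + 4 * (u * (u - 1ℤ)) + v) (zeros i₀) (Z.∑-0 zeros)) refl))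
                      (λ e → contradiction (trans (cong (_+ 1ℤ) (sym τ≡)) e) λ ())
        where
        zeros : ∀ i → excess i ≡ 0ℤ
        zeros i = decidable-stable (excess i ℤ.≟ 0ℤ) (λ h → ¬p (i , h))

      i₁ : Fin n
      i₁ = proj₁ large

      y : ℤ
      y = excess i₁ - 1ℤ

      y-nonneg : 0ℤ ℤ.≤ y
      y-nonneg = positive (excess-nonneg i₁) (proj₂ large)
        where
        positive : ∀ {x} → 0ℤ ℤ.≤ x → x ≢ 0ℤ → 0ℤ ℤ.≤ x - 1ℤ
        positive {+ 0}     _ h = contradiction refl h
        positive {+ suc k} _ _ = +≤+ ℕ.z≤n

      rest-nonneg : ∀ j → 0ℤ ℤ.≤ (1ℤ - P i₁ j) * excess j
      rest-nonneg j = nonneg-* (bit-complement (P-bit i₁ j)) (excess-nonneg j)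

      -- The total excess is (τ + x) x over the class of `i₁` plus the rest. Substituting x = y + 1
      -- turns `excess-equation` into rest + y (τ + 6) + 5 y² = 0. All terms are nonnegative, so y =
      -- 0 and every other class has exactly τ elements.
      rest-sum : Z.∑ n (λ j → (1ℤ - P i₁ j) * excess j) + (y * (τ + + 6) + + 5 * (y * y)) ≡ 0ℤ
      rest-sum = begin
        Z.∑ n (λ j → (1ℤ - P i₁ j) * excess j) + (y * (τ + + 6) + + 5 * (y * y))
          ≡⟨ cong (_+ (y * (τ + + 6) + + 5 * (y * y))) (trans (Z.∑-cong pointwise) (∑-combine 1ℤ (- x) excess (P i₁))) ⟩
        1ℤ * total + - x * size i₁ + (y * (τ + + 6) + + 5 * (y * y))
          ≡⟨ cong (λ z → 1ℤ * total + - x * z + (y * (τ + + 6) + + 5 * (y * y))) (size≡ i₁) ⟩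
        1ℤ * total + - x * (τ + x) + (y * (τ + + 6) + + 5 * (y * y))
          ≡⟨ lemma₂ x τ total ⟩
        (+ 4 * (x * (x - 1ℤ)) + total) - (τ + 1ℤ)
          ≡⟨ ℤₚ.i≡j⇒i-j≡0 (excess-equation i₁) ⟩
        0ℤ ∎
        where
        x = excess i₁
        lemma₁ : ∀ p x → (1ℤ - p) * x ≡ 1ℤ * x + - 1ℤ * (p * x)
        lemma₁ = solve-∀
        lemma₃ : ∀ p x y → 1ℤ * x + - 1ℤ * (p * y) ≡ 1ℤ * x + - y * p
        lemma₃ = solve-∀
        pointwise : ∀ j → (1ℤ - P i₁ j) * excess j ≡ 1ℤ * excess j + - x * P i₁ j
        pointwise j = trans (lemma₁ (P i₁ j) (excess j)) (trans (cong (λ z → 1ℤ * excess j + - 1ℤ * z) (P-excess i₁ j (P-bit i₁ j))) (lemma₃ (P i₁ j) (excess j) x))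
        lemma₂ : ∀ x t s → 1ℤ * s + - x * (t + x) + ((x - 1ℤ) * (t + + 6) + + 5 * ((x - 1ℤ) * (x - 1ℤ))) ≡ (+ 4 * (x * (x - 1ℤ)) + s) - (t + 1ℤ)
        lemma₂ = solve-∀

      private
        τ+6-nonneg : 0ℤ ℤ.≤ τ + + 6
        τ+6-nonneg = subst (λ z → 0ℤ ℤ.≤ z + + 6) (sym τ≡) (+≤+ ℕ.z≤n)
        split₁ = nonneg-sum-zero (∑-nonneg rest-nonneg) (ℤₚ.+-mono-≤ (nonneg-* y-nonneg τ+6-nonneg) (pos-*-nonneg 4 (square-nonneg y))) rest-sum
        split₂ = nonneg-sum-zero (nonneg-* y-nonneg τ+6-nonneg) (pos-*-nonneg 4 (square-nonneg y)) (proj₂ split₁)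

      excess-i₁ : excess i₁ ≡ 1ℤ
      excess-i₁ = ℤₚ.i-j≡0⇒i≡j (excess i₁) 1ℤ (square-zero y (*-cancel-suc 4 (proj₂ split₂)))

      size-i₁ : size i₁ ≡ τ + 1ℤ
      size-i₁ = trans (size≡ i₁) (cong (λ z → τ + z) excess-i₁)

      size-other : ∀ {j} → P i₁ j ≡ 0ℤ → size j ≡ τ
      size-other {j} e = trans (size≡ j) (trans (cong (λ z → τ + z) excess≡0) (ℤₚ.+-identityʳ τ))
        where
        excess≡0 : excess j ≡ 0ℤ
        excess≡0 = trans (sym (trans (cong (λ z → (1ℤ - z) * excess j) e) (ℤₚ.*-identityˡ _))) (∑-nonneg-zero rest-nonneg (proj₁ split₁) j)

      disjoint : ∀ {i j} → P i j ≡ 0ℤ → ∀ k → P i k * P j k ≡ 0ℤ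
      disjoint {i} {j} e k = [ (λ z → cong (_* P j k) z) , (λ o → trans (cong (P i k *_) (trans (P-sym k j) (trans (sym (P-class o j)) e))) (ℤₚ.*-zeroʳ (P i k))) ]′ (P-bit i k)

      record Representatives : Set where
        field
          i₂ i₃ i₄ : Fin n
          size₂ : size i₂ ≡ τ
          size₃ : size i₃ ≡ τ
          size₄ : size i₄ ≡ τ
          P₁₂ : ∀ k → P i₁ k * P i₂ k ≡ 0ℤ
          P₁₃ : ∀ k → P i₁ k * P i₃ k ≡ 0ℤ
          P₁₄ : ∀ k → P i₁ k * P i₄ k ≡ 0ℤ
          P₂₃ : ∀ k → P i₂ k * P i₃ k ≡ 0ℤ
          P₂₄ : ∀ k → P i₂ k * P i₄ k ≡ 0ℤ
          P₃₄ : ∀ k → P i₃ k * P i₄ k ≡ 0ℤ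
          cover : ∀ k → P i₁ k + P i₂ k + P i₃ k + P i₄ k ≡ 1ℤ

      private
        positive-multiple : ∀ k → + suc k * τ ≢ 0ℤ
        positive-multiple k e = contradiction (trans (sym τ≡) (*-cancel-suc k (trans e (sym (ℤₚ.*-zeroʳ (+ suc k)))))) λ ()
        product-sum : ∀ {a b c} → a * c ≡ 0ℤ → b * c ≡ 0ℤ → (a + b) * c ≡ 0ℤ
        product-sum {a} {b} {c} e f = trans (ℤₚ.*-distribʳ-+ c a b) (cong₂ _+_ e f)
        remaining : ∀ (s : Vector ℤ n) {σ ρ} → Z.∑ n s ≡ σ → + 4 * τ + 1ℤ - σ ≡ ρ → Z.∑ n (λ k → 1ℤ - s k) ≡ ρ
        remaining s {σ} {ρ} e f = begin
          Z.∑ n (λ k → 1ℤ - s k)              ≡⟨ Z.∑-cong (λ k → lemma (s k)) ⟩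
          Z.∑ n (λ k → - 1ℤ * s k + 1ℤ * 1ℤ)  ≡⟨ ∑-affine (- 1ℤ) 1ℤ s ⟩
          - 1ℤ * Z.∑ n s + 1ℤ * + n           ≡⟨ cong₂ (λ u v → - 1ℤ * u + 1ℤ * v) e n≡ ⟩
          - 1ℤ * σ + 1ℤ * (+ 4 * τ + 1ℤ)      ≡⟨ trans (lemma₂ σ (+ 4 * τ + 1ℤ)) f ⟩
          ρ                                   ∎
          where
          lemma : ∀ s → 1ℤ - s ≡ - 1ℤ * s + 1ℤ * 1ℤ
          lemma = solve-∀
          lemma₂ : ∀ s n → - 1ℤ * s + 1ℤ * n ≡ n - s
          lemma₂ = solve-∀
        outside : ∀ (s : Vector ℤ n) → (∀ k → Bit (s k)) → ∀ {σ} ρ → Z.∑ n s ≡ σ → + 4 * τ + 1ℤ - σ ≡ + suc ρ * τ → ∃ λ j → s j ≡ 0ℤ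
        outside s s-bit ρ e f = proj₁ found , bit-zero (s-bit (proj₁ found)) (proj₂ found)
          where
          found = ∑-nonzero (λ k → 1ℤ - s k) (λ z → positive-multiple ρ (trans (sym (remaining s e f)) z))

      -- Classes of τ + 1, τ, τ and τ elements successively leave 3τ, 2τ, τ and none of the 4τ + 1
      -- indices; since τ is positive, a new representative exists as long as some remain.
      representatives : Representatives
      representatives = record
        { i₂ = i₂ ; i₃ = i₃ ; i₄ = i₄ ; size₂ = size₂ ; size₃ = size₃ ; size₄ = size₄
        ; P₁₂ = P₁₂ ; P₁₃ = P₁₃ ; P₁₄ = P₁₄ ; P₂₃ = P₂₃ ; P₂₄ = P₂₄ ; P₃₄ = P₃₄
        ; cover = λ k → sym (ℤₚ.i-j≡0⇒i≡j 1ℤ (s₄ k) (∑-nonneg-zero (λ k → bit-complement (s₄-bit k)) (remaining s₄ sum₄ (lemma₄ τ)) k)) }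
        where
        found₂ = outside (P i₁) (P-bit i₁) 2 size-i₁ (lemma τ)
          where
          lemma : ∀ t → + 4 * t + 1ℤ - (t + 1ℤ) ≡ + 3 * t
          lemma = solve-∀
        i₂ = proj₁ found₂
        size₂ = size-other (proj₂ found₂)
        P₁₂ = disjoint (proj₂ found₂)
        s₂ s₃ s₄ : Vector ℤ n
        s₂ k = P i₁ k + P i₂ k
        s₂-bit : ∀ k → Bit (s₂ k)
        s₂-bit k = bit-+ (P-bit i₁ k) (P-bit i₂ k) (P₁₂ k)
        sum₂ : Z.∑ n s₂ ≡ τ + 1ℤ + τ
        sum₂ = trans (Z.∑-+ (P i₁) (P i₂)) (cong₂ _+_ size-i₁ size₂)
        found₃ = outside s₂ s₂-bit 1 sum₂ (lemma τ)
          where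
          lemma : ∀ t → + 4 * t + 1ℤ - (t + 1ℤ + t) ≡ + 2 * t
          lemma = solve-∀
        i₃ = proj₁ found₃
        out₃ = bit-+-zero (P-bit i₁ i₃) (P-bit i₂ i₃) (proj₂ found₃)
        size₃ = size-other (proj₁ out₃)
        P₁₃ = disjoint (proj₁ out₃)
        P₂₃ = disjoint (proj₂ out₃)
        s₃ k = s₂ k + P i₃ k
        s₃-bit : ∀ k → Bit (s₃ k)
        s₃-bit k = bit-+ (s₂-bit k) (P-bit i₃ k) (product-sum {P i₁ k} (P₁₃ k) (P₂₃ k))
        sum₃ : Z.∑ n s₃ ≡ τ + 1ℤ + τ + τ
        sum₃ = trans (Z.∑-+ s₂ (P i₃)) (cong₂ _+_ sum₂ size₃)
        found₄ = outside s₃ s₃-bit 0 sum₃ (lemma τ)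
          where
          lemma : ∀ t → + 4 * t + 1ℤ - (t + 1ℤ + t + t) ≡ + 1 * t
          lemma = solve-∀
        i₄ = proj₁ found₄
        out₄ = bit-+-zero (s₂-bit i₄) (P-bit i₃ i₄) (proj₂ found₄)
        out₄′ = bit-+-zero (P-bit i₁ i₄) (P-bit i₂ i₄) (proj₁ out₄)
        size₄ = size-other (proj₁ out₄′)
        P₁₄ = disjoint (proj₁ out₄′)
        P₂₄ = disjoint (proj₂ out₄′)
        P₃₄ = disjoint (proj₂ out₄)
        s₄ k = s₃ k + P i₄ k
        s₄-bit : ∀ k → Bit (s₄ k)
        s₄-bit k = bit-+ (s₃-bit k) (P-bit i₄ k) (product-sum {s₂ k} (product-sum {P i₁ k} (P₁₄ k) (P₂₄ k)) (P₃₄ k))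
        sum₄ : Z.∑ n s₄ ≡ τ + 1ℤ + τ + τ + τ
        sum₄ = trans (Z.∑-+ s₃ (P i₄)) (cong₂ _+_ sum₃ size₄)
        lemma₄ : ∀ t → + 4 * t + 1ℤ - (t + 1ℤ + t + t + t) ≡ 0ℤ
        lemma₄ = solve-∀

  record Partition {n} (p q r s : Vector ℤ n) : Set where
    field
      p-bit : ∀ i → Bit (p i)
      q-bit : ∀ i → Bit (q i)
      r-bit : ∀ i → Bit (r i)
      s-bit : ∀ i → Bit (s i)
      pq : ∀ i → p i * q i ≡ 0ℤ
      pr : ∀ i → p i * r i ≡ 0ℤ
      ps : ∀ i → p i * s i ≡ 0ℤ
      qr : ∀ i → q i * r i ≡ 0ℤ
      qs : ∀ i → q i * s i ≡ 0ℤ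
      rs : ∀ i → r i * s i ≡ 0ℤ
      cover : ∀ i → p i + q i + r i + s i ≡ 1ℤ

  partition-swap₂₃ : ∀ {n} {p q r s : Vector ℤ n} → Partition p q r s → Partition p r q s
  partition-swap₂₃ {p = p} {q} {r} {s} π = record
    { p-bit = p-bit ; q-bit = r-bit ; r-bit = q-bit ; s-bit = s-bit
    ; pq = pr ; pr = pq ; ps = ps ; qr = λ i → trans (ℤₚ.*-comm (r i) (q i)) (qr i) ; qs = rs ; rs = qs
    ; cover = λ i → trans (lemma (p i) (q i) (r i) (s i)) (cover i) }
    where
    open Partition π
    lemma : ∀ p q r s → p + r + q + s ≡ p + q + r + s
    lemma = solve-∀

  partition-swap₃₄ : ∀ {n} {p q r s : Vector ℤ n} → Partition p q r s → Partition p q s r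
  partition-swap₃₄ {p = p} {q} {r} {s} π = record
    { p-bit = p-bit ; q-bit = q-bit ; r-bit = s-bit ; s-bit = r-bit
    ; pq = pq ; pr = ps ; ps = pr ; qr = qs ; qs = qr ; rs = λ i → trans (ℤₚ.*-comm (s i) (r i)) (rs i)
    ; cover = λ i → trans (lemma (p i) (q i) (r i) (s i)) (cover i) }
    where
    open Partition π
    lemma : ∀ p q r s → p + q + s + r ≡ p + q + r + s
    lemma = solve-∀

  module _ {n} (d : Vector ℤ n) where

    -- Up to `d`, the sign is + on the classes `p`, `q` and - on `r`, `s`. The three such pairings
    -- of four classes are the nonconstant rows of a Hadamard matrix of order four.
    signVector : Vector ℤ n → Vector ℤ n → Vector ℤ n → Vector ℤ n → Vector ℤ n
    signVector p q r s i = d i * ((p i + q i) - (r i + s i))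

    signVector-swap : ∀ p q r s i → signVector p q s r i ≡ signVector p q r s i
    signVector-swap p q r s i = cong (λ z → d i * ((p i + q i) - z)) (ℤₚ.+-comm (s i) (r i))

    module _ (d-unit : ∀ i → Unit (d i)) {p q r s : Vector ℤ n} (π : Partition p q r s) where
      open Partition π

      signVector-unit : ∀ i → Unit (signVector p q r s i)
      signVector-unit i = unit-* (d-unit i) (unit-root _ (begin
        ((p i + q i) - (r i + s i)) * ((p i + q i) - (r i + s i))
          ≡⟨ lemma (p i) (q i) (r i) (s i) ⟩
        (p i + q i + r i + s i) * (p i + q i + r i + s i) - + 4 * ((p i * r i + p i * s i) + (q i * r i + q i * s i))
          ≡⟨ cong₂ (λ u v → u * u - + 4 * v) (cover i) (cong₂ _+_ (cong₂ _+_ (pr i) (ps i)) (cong₂ _+_ (qr i) (qs i))) ⟩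
        1ℤ ∎))
        where
        lemma : ∀ p q r s → ((p + q) - (r + s)) * ((p + q) - (r + s)) ≡ (p + q + r + s) * (p + q + r + s) - + 4 * ((p * r + p * s) + (q * r + q * s))
        lemma = solve-∀

      -- The two sign patterns agree on `p` and `s` and differ on `q` and `r`.
      signVector-dot : dot (signVector p r q s) (signVector p q r s) ≡ (1ℤ * Z.∑ n p + - 1ℤ * Z.∑ n q) + (- 1ℤ * Z.∑ n r + 1ℤ * Z.∑ n s)
      signVector-dot = trans (Z.∑-cong entry) (trans (Z.∑-+ _ _) (cong₂ _+_ (∑-combine 1ℤ (- 1ℤ) p q) (∑-combine (- 1ℤ) 1ℤ r s)))
        where
        lemma₁ : ∀ d p q r s → d * ((p + r) - (q + s)) * (d * ((p + q) - (r + s))) ≡ d * d * (((p * p - q * q) + (s * s - r * r)) + (+ 2 * (q * r) - + 2 * (p * s)))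
        lemma₁ = solve-∀
        lemma₂ : ∀ p q r s → 1ℤ * (((p - q) + (s - r)) + (+ 2 * 0ℤ - + 2 * 0ℤ)) ≡ (1ℤ * p + - 1ℤ * q) + (- 1ℤ * r + 1ℤ * s)
        lemma₂ = solve-∀
        entry : ∀ i → signVector p r q s i * signVector p q r s i ≡ (1ℤ * p i + - 1ℤ * q i) + (- 1ℤ * r i + 1ℤ * s i)
        entry i = trans (lemma₁ (d i) (p i) (q i) (r i) (s i)) (trans
          (cong₂ _*_ (unit² (d-unit i)) (cong₂ _+_
            (cong₂ _+_ (cong₂ _-_ (bit² (p-bit i)) (bit² (q-bit i))) (cong₂ _-_ (bit² (s-bit i)) (bit² (r-bit i))))
            (cong₂ (λ u v → + 2 * u - + 2 * v) (qr i) (ps i))))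
          (lemma₂ (p i) (q i) (r i) (s i)))

      module _ (M : Matrix ℤ n) (i₁ i₂ : Fin n)
               (M₁ : ∀ i → M i i₁ ≡ d i * d i₁ * (+ 4 * p i - 1ℤ)) (M₂ : ∀ i → M i i₂ ≡ d i * d i₂ * (+ 4 * q i - 1ℤ)) where

        -- With signs corrected, the columns of `M` at `i₁` and `i₂` add up to `d` times 4 (p + q) -
        -- 2, which is twice the sign vector because the four indicators sum to 1. These are the
        -- integral preimages that `augment-triple` asks for.
        preimage : Vector ℤ n
        preimage k = d i₁ * δ i₁ k + d i₂ * δ i₂ k

        apply-preimage : ∀ i → apply M preimage i ≡ + 2 * signVector p q r s i
        apply-preimage i = begin
          dot (M i) preimage
            ≡⟨ dot-linearʳ (d i₁) (d i₂) (M i) (δ i₁) (δ i₂) ⟩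
          d i₁ * dot (M i) (δ i₁) + d i₂ * dot (M i) (δ i₂)
            ≡⟨ cong₂ (λ u v → d i₁ * u + d i₂ * v) (trans (∑-δ (M i) i₁) (M₁ i)) (trans (∑-δ (M i) i₂) (M₂ i)) ⟩
          d i₁ * (d i * d i₁ * (+ 4 * p i - 1ℤ)) + d i₂ * (d i * d i₂ * (+ 4 * q i - 1ℤ))
            ≡⟨ lemma₁ (d i) (d i₁) (d i₂) (p i) (q i) ⟩
          d i * ((d i₁ * d i₁) * (+ 4 * p i - 1ℤ) + (d i₂ * d i₂) * (+ 4 * q i - 1ℤ))
            ≡⟨ cong₂ (λ u v → d i * (u * (+ 4 * p i - 1ℤ) + v * (+ 4 * q i - 1ℤ))) (unit² (d-unit i₁)) (unit² (d-unit i₂)) ⟩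
          d i * (1ℤ * (+ 4 * p i - 1ℤ) + 1ℤ * (+ 4 * q i - 1ℤ))
            ≡⟨ lemma₂ (d i) (p i) (q i) (r i) (s i) ⟩
          + 2 * (d i * ((p i + q i) - (r i + s i))) + + 2 * (d i * ((p i + q i + r i + s i) - 1ℤ))
            ≡⟨ cong (λ z → + 2 * signVector p q r s i + + 2 * (d i * z)) (ℤₚ.i≡j⇒i-j≡0 (cover i)) ⟩
          + 2 * signVector p q r s i + + 2 * (d i * 0ℤ)
            ≡⟨ lemma₃ (signVector p q r s i) (d i) ⟩
          + 2 * signVector p q r s i ∎
          where
          lemma₁ : ∀ d e f p q → e * (d * e * (+ 4 * p - 1ℤ)) + f * (d * f * (+ 4 * q - 1ℤ)) ≡ d * ((e * e) * (+ 4 * p - 1ℤ) + (f * f) * (+ 4 * q - 1ℤ))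
          lemma₁ = solve-∀
          lemma₂ : ∀ d p q r s → d * (1ℤ * (+ 4 * p - 1ℤ) + 1ℤ * (+ 4 * q - 1ℤ)) ≡ + 2 * (d * ((p + q) - (r + s))) + + 2 * (d * ((p + q + r + s) - 1ℤ))
          lemma₂ = solve-∀
          lemma₃ : ∀ x d → + 2 * x + + 2 * (d * 0ℤ) ≡ + 2 * x
          lemma₃ = solve-∀

  module ClassExtension {n} (m : ℕ) {τ κ : ℤ} (τ≡ : τ ≡ + suc m) (n≡ : + n ≡ + 4 * τ + 1ℤ) (κ≡ : κ ≡ + 4 * τ + + 3) (i₀ : Fin n)
    {S M : Matrix ℤ n} (P : Matrix ℤ n) (d : Vector ℤ n) (d-unit : ∀ i → Unit (d i))
    (P-bit : ∀ i j → Bit (P i j)) (P-refl : ∀ i → P i i ≡ 1ℤ) (P-sym : ∀ i j → P j i ≡ P i j)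
    (P-class : ∀ {i j} → P i j ≡ 1ℤ → ∀ k → P i k ≡ P j k)
    (M≡ : ∀ i j → M i j ≡ d i * d j * (+ 4 * P i j - 1ℤ)) where

    open Classes m τ≡ n≡ κ≡ i₀ M P d d-unit P-bit P-refl P-sym P-class M≡ hiding (y)

    class-extension : (MH : ∀ i → (M Z.⊗ H) i i ≡ κ * H i i) (H-nonneg : ∀ i → 0ℤ ℤ.≤ H i i) →
                      Defect κ S M → (∀ i j → (S Z.⊗ M) i j ≡ (M Z.⊗ S) i j) → Extension κ (suc (suc (suc n)))
    class-extension MH H-nonneg defect SM≡MS = augment-triple m {S = S} {M} {κ} {a} {b} {c} {x} {y} {z} defect
      (trans n≡ (cong (λ z → + 4 * z + 1ℤ) τ≡)) κ≡n+2 SM≡MS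
      (signVector-unit d d-unit π) (signVector-unit d d-unit π₂) (signVector-unit d d-unit π₃)
      ba ca cb M-split (apply-preimage d d-unit π M i₁ₛ i₂ (M-class i₁ₛ) (M-class i₂))
      (apply-preimage d d-unit π₂ M i₁ₛ i₃ (M-class i₁ₛ) (M-class i₃)) (apply-preimage d d-unit π₃ M i₁ₛ i₄ (M-class i₁ₛ) (M-class i₄))
      where
      open Representatives (representatives MH H-nonneg)
      i₁ₛ = i₁ MH H-nonneg
      χ₁ = P i₁ₛ
      χ₂ = P i₂
      χ₃ = P i₃
      χ₄ = P i₄
      π : Partition χ₁ χ₂ χ₃ χ₄
      π = record { p-bit = P-bit i₁ₛ ; q-bit = P-bit i₂ ; r-bit = P-bit i₃ ; s-bit = P-bit i₄
                 ; pq = P₁₂ ; pr = P₁₃ ; ps = P₁₄ ; qr = P₂₃ ; qs = P₂₄ ; rs = P₃₄ ; cover = cover }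
      π₂ : Partition χ₁ χ₃ χ₂ χ₄
      π₂ = partition-swap₂₃ π
      π₃ : Partition χ₁ χ₄ χ₂ χ₃
      π₃ = partition-swap₂₃ (partition-swap₃₄ π)
      a b c x y z : Vector ℤ n
      a = signVector d χ₁ χ₂ χ₃ χ₄
      b = signVector d χ₁ χ₃ χ₂ χ₄
      c = signVector d χ₁ χ₄ χ₂ χ₃
      M-class : ∀ j i → M i j ≡ d i * d j * (+ 4 * P j i - 1ℤ)
      M-class j i = trans (M≡ i j) (cong (λ z → d i * d j * (+ 4 * z - 1ℤ)) (P-sym j i))
      x = preimage d d-unit π M i₁ₛ i₂ (M-class i₁ₛ) (M-class i₂)
      y = preimage d d-unit π₂ M i₁ₛ i₃ (M-class i₁ₛ) (M-class i₃)
      z = preimage d d-unit π₃ M i₁ₛ i₄ (M-class i₁ₛ) (M-class i₄)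
      κ≡n+2 : κ ≡ + n + + 2
      κ≡n+2 = trans κ≡ (trans (lemma τ) (cong (_+ + 2) (sym n≡)))
        where
        lemma : ∀ t → + 4 * t + + 3 ≡ + 4 * t + 1ℤ + + 2
        lemma = solve-∀
      sizes : ∀ {u v w} → u ≡ τ → v ≡ τ → w ≡ τ → (1ℤ * Z.∑ n χ₁ + - 1ℤ * u) + (- 1ℤ * v + 1ℤ * w) ≡ 1ℤ
      sizes refl refl refl = trans (cong (λ z → (1ℤ * z + - 1ℤ * τ) + (- 1ℤ * τ + 1ℤ * τ)) (size-i₁ MH H-nonneg)) (lemma τ)
        where
        lemma : ∀ t → (1ℤ * (t + 1ℤ) + - 1ℤ * t) + (- 1ℤ * t + 1ℤ * t) ≡ 1ℤ
        lemma = solve-∀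
      ba : dot b a ≡ 1ℤ
      ba = trans (signVector-dot d d-unit π) (sizes size₂ size₃ size₄)
      ca : dot c a ≡ 1ℤ
      ca = trans (dot-cong {u = c} (λ _ → refl) (λ i → sym (signVector-swap d χ₁ χ₂ χ₃ χ₄ i)))
        (trans (signVector-dot d d-unit (partition-swap₃₄ π)) (sizes size₂ size₄ size₃))
      cb : dot c b ≡ 1ℤ
      cb = trans (dot-cong (λ i → sym (signVector-swap d χ₁ χ₄ χ₂ χ₃ i)) (λ i → sym (signVector-swap d χ₁ χ₃ χ₂ χ₄ i)))
        (trans (signVector-dot d d-unit (partition-swap₃₄ π₂)) (sizes size₃ size₄ size₂))
      P-pick : ∀ j i k → P j i * P i k ≡ P j i * P j k
      P-pick j i k = [ (λ e → trans (cong (_* P i k) e) (sym (cong (_* P j k) e))) , (λ e → cong (P j i *_) (sym (P-class e k))) ]′ (P-bit j i)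
      P-split : ∀ i k → P i k ≡ χ₁ i * χ₁ k + χ₂ i * χ₂ k + χ₃ i * χ₃ k + χ₄ i * χ₄ k
      P-split i k = begin
        P i k
          ≡⟨ ℤₚ.*-identityˡ (P i k) ⟨
        1ℤ * P i k
          ≡⟨ cong (_* P i k) (cover i) ⟨
        (χ₁ i + χ₂ i + χ₃ i + χ₄ i) * P i k
          ≡⟨ lemma (χ₁ i) (χ₂ i) (χ₃ i) (χ₄ i) (P i k) ⟩
        χ₁ i * P i k + χ₂ i * P i k + χ₃ i * P i k + χ₄ i * P i k
          ≡⟨ cong₂ _+_ (cong₂ _+_ (cong₂ _+_ (P-pick i₁ₛ i k) (P-pick i₂ i k)) (P-pick i₃ i k)) (P-pick i₄ i k) ⟩
        χ₁ i * χ₁ k + χ₂ i * χ₂ k + χ₃ i * χ₃ k + χ₄ i * χ₄ k ∎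
        where
        lemma : ∀ p q r s x → (p + q + r + s) * x ≡ p * x + q * x + r * x + s * x
        lemma = solve-∀
      -- The constant 1 is replaced by the product of two `cover` sums, so that `tetrahedron` is
      -- bilinear in the indicators. It says that the outer products of the three nonconstant rows
      -- of a Hadamard matrix of order four add up to 4 I - J.
      M-split : ∀ i j → M i j ≡ a i * a j + b i * b j + c i * c j
      M-split i j = begin
        M i j
          ≡⟨ M≡ i j ⟩
        d i * d j * (+ 4 * P i j - 1ℤ)
          ≡⟨ cong₂ (λ u v → d i * d j * (+ 4 * u - v)) (P-split i j) (cong₂ _*_ (sym (cover i)) (sym (cover j))) ⟩
        d i * d j * (+ 4 * (χ₁ i * χ₁ j + χ₂ i * χ₂ j + χ₃ i * χ₃ j + χ₄ i * χ₄ j) -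
                     (χ₁ i + χ₂ i + χ₃ i + χ₄ i) * (χ₁ j + χ₂ j + χ₃ j + χ₄ j))
          ≡⟨ cong (d i * d j *_) (tetrahedron (χ₁ i) (χ₂ i) (χ₃ i) (χ₄ i) (χ₁ j) (χ₂ j) (χ₃ j) (χ₄ j)) ⟩
        d i * d j * (u i * u j + v i * v j + w i * w j)
          ≡⟨ lemma (d i) (d j) (u i) (u j) (v i) (v j) (w i) (w j) ⟩
        a i * a j + b i * b j + c i * c j ∎
        where
        u v w : Vector ℤ n
        u i = (χ₁ i + χ₂ i) - (χ₃ i + χ₄ i)
        v i = (χ₁ i + χ₃ i) - (χ₂ i + χ₄ i)
        w i = (χ₁ i + χ₄ i) - (χ₂ i + χ₃ i)
        tetrahedron : ∀ p q r s p′ q′ r′ s′ →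
          + 4 * (p * p′ + q * q′ + r * r′ + s * s′) - (p + q + r + s) * (p′ + q′ + r′ + s′) ≡
          ((p + q) - (r + s)) * ((p′ + q′) - (r′ + s′)) + ((p + r) - (q + s)) * ((p′ + r′) - (q′ + s′)) + ((p + s) - (q + r)) * ((p′ + s′) - (q′ + r′))
        tetrahedron = solve-∀
        lemma : ∀ d d′ u u′ v v′ w w′ → d * d′ * (u * u′ + v * v′ + w * w′) ≡ d * u * (d′ * u′) + d * v * (d′ * v′) + d * w * (d′ * w′)
        lemma = solve-∀

  parity : ∀ e → ∃ λ h → e ≡ + 2 * h ⊎ e ≡ + 2 * h + 1ℤ
  parity (+ n)    = natural n
    where
    lemma : ∀ h → + 2 * h + 1ℤ + 1ℤ ≡ + 2 * (h + 1ℤ)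
    lemma = solve-∀
    natural : ∀ n → ∃ λ h → + n ≡ + 2 * h ⊎ + n ≡ + 2 * h + 1ℤ
    natural zero = 0ℤ , inj₁ refl
    natural (suc n) = next (natural n)
      where
      next : (∃ λ h → + n ≡ + 2 * h ⊎ + n ≡ + 2 * h + 1ℤ) → ∃ λ h → + suc n ≡ + 2 * h ⊎ + suc n ≡ + 2 * h + 1ℤ
      next (h , inj₁ e) = h , inj₂ (trans (ℤₚ.+-comm 1ℤ (+ n)) (cong (_+ 1ℤ) e))
      next (h , inj₂ e) = h + 1ℤ , inj₁ (trans (ℤₚ.+-comm 1ℤ (+ n)) (trans (cong (_+ 1ℤ) e) (lemma h)))
  parity -[1+ n ] = negate (parity (+ n))
    where
    lemma₁ : ∀ h → - (+ 2 * h) - 1ℤ ≡ + 2 * (- h - 1ℤ) + 1ℤ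
    lemma₁ = solve-∀
    lemma₂ : ∀ h → - (+ 2 * h + 1ℤ) - 1ℤ ≡ + 2 * (- h - 1ℤ)
    lemma₂ = solve-∀
    shift : ∀ n → -[1+ n ] ≡ - (+ n) - 1ℤ
    shift n = trans (ℤₚ.neg-distrib-+ 1ℤ (+ n)) (ℤₚ.+-comm (- 1ℤ) (- (+ n)))
    negate : (∃ λ h → + n ≡ + 2 * h ⊎ + n ≡ + 2 * h + 1ℤ) → ∃ λ h → -[1+ n ] ≡ + 2 * h ⊎ -[1+ n ] ≡ + 2 * h + 1ℤ
    negate (h , inj₁ e) = - h - 1ℤ , inj₂ (trans (shift n) (trans (cong (λ z → - z - 1ℤ) e) (lemma₁ h)))
    negate (h , inj₂ e) = - h - 1ℤ , inj₁ (trans (shift n) (trans (cong (λ z → - z - 1ℤ) e) (lemma₂ h)))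

  odd : ∀ {s} z → Unit s → s ≢ + 2 * z
  odd {s} z u e = no-half ∣ z ∣ (trans (sym (∣unit∣ u)) (trans (cong ∣_∣ e) (ℤₚ.abs-* (+ 2) z)))
    where
    ∣unit∣ : ∀ {s} → Unit s → ∣ s ∣ ≡ 1
    ∣unit∣ (inj₁ refl) = refl
    ∣unit∣ (inj₂ refl) = refl
    no-half : ∀ k → 1 ≢ 2 ℕ.* k
    no-half (suc k) e = ℕₚ.m+1+n≢0 k (sym (ℕₚ.suc-injective e))

  -- A sum of four signs is 4 minus twice the number of minus signs, so it is divisible by 4 only if
  -- that number is even.
  product-sign : ∀ {x y z} w → Unit x → Unit y → Unit z → x + y + z + 1ℤ ≡ + 4 * w → z ≡ x * y
  product-sign w (inj₁ refl) (inj₁ refl) (inj₁ refl) e = refl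
  product-sign w (inj₁ refl) (inj₁ refl) (inj₂ refl) e = contradiction (*-cancel-suc 1 {1ℤ} (trans e (ℤₚ.*-assoc (+ 2) (+ 2) w))) (odd w (inj₁ refl))
  product-sign w (inj₁ refl) (inj₂ refl) (inj₁ refl) e = contradiction (*-cancel-suc 1 {1ℤ} (trans e (ℤₚ.*-assoc (+ 2) (+ 2) w))) (odd w (inj₁ refl))
  product-sign w (inj₁ refl) (inj₂ refl) (inj₂ refl) e = refl
  product-sign w (inj₂ refl) (inj₁ refl) (inj₁ refl) e = contradiction (*-cancel-suc 1 {1ℤ} (trans e (ℤₚ.*-assoc (+ 2) (+ 2) w))) (odd w (inj₁ refl))
  product-sign w (inj₂ refl) (inj₁ refl) (inj₂ refl) e = refl
  product-sign w (inj₂ refl) (inj₂ refl) (inj₁ refl) e = refl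
  product-sign w (inj₂ refl) (inj₂ refl) (inj₂ refl) e = contradiction (*-cancel-suc 1 { - 1ℤ} (trans e (ℤₚ.*-assoc (+ 2) (+ 2) w))) (odd w (inj₂ refl))

  bit-between : ∀ x → 0ℤ ℤ.≤ 1ℤ - x → 0ℤ ℤ.≤ 1ℤ + + 2 * x → Bit x
  bit-between x h g = [ inj₁ , [ inj₂ , (λ e → contradiction (subst (λ z → 0ℤ ℤ.≤ 1ℤ + + 2 * z) e g) λ ()) ]′ ]′
    (small x h (pos-cancel-nonneg 1 (subst (0ℤ ℤ.≤_) (lemma x) (ℤₚ.+-mono-≤ g (+≤+ {0} {1} ℕ.z≤n)))))
    where
    lemma : ∀ x → 1ℤ + + 2 * x + 1ℤ ≡ + 2 * (1ℤ + x)
    lemma = solve-∀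

  record Classification {n} (M : Matrix ℤ n) : Set where
    field
      P : Matrix ℤ n
      d : Vector ℤ n
      d-unit : ∀ i → Unit (d i)
      P-bit : ∀ i j → Bit (P i j)
      P-refl : ∀ i → P i i ≡ 1ℤ
      P-sym : ∀ i j → P j i ≡ P i j
      P-class : ∀ {i j} → P i j ≡ 1ℤ → ∀ k → P i k ≡ P j k
      M≡ : ∀ i j → M i j ≡ d i * d j * (+ 4 * P i j - 1ℤ)

  module _ {n} {M : Matrix ℤ n} (i₀ : Fin n) (diagonal : ∀ i → M i i ≡ + 3) (symmetric : ∀ i j → M j i ≡ M i j)
           (bound : ∀ {s} → Unit s → ∀ i j → 0ℤ ℤ.≤ + 3 - s * M i j)
           (parallel : ∀ {s} → Unit s → ∀ i j → s * M i j ≡ + 3 → ∀ k → M i k ≡ s * M j k)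
           (mod4 : ∀ i j k → ∃ λ e → M i k + M i j + M j k ≡ 1ℤ + + 4 * e) where

    -- Modulo 4 each entry is a sign `- f i j`, and `mod4` at `i₀`, `i`, `j` makes the product of
    -- the three signs 1, whence f i j = d i d j. What remains is a factor 4 P - 1 between -3 and 3,
    -- so `P` takes the values 0 and 1; `parallel` at the extreme value 3 gives the class property.
    classify-signs : (f r : Matrix ℤ n) → (∀ i j → Unit (f i j)) → (∀ i j → M i j ≡ - f i j + + 4 * r i j) → Classification M
    classify-signs f r f-unit M≡fr = record
      { P = P ; d = d ; d-unit = d-unit ; P-bit = P-bit ; P-refl = P-refl ; P-sym = P-sym ; P-class = P-class ; M≡ = M≡ }
      where
      d : Vector ℤ n
      d i = f i₀ i
      d-unit : ∀ i → Unit (d i)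
      d-unit i = f-unit i₀ i
      P : Matrix ℤ n
      P i j = d i * d j * r i j
      dd : ∀ i j → (d i * d j) * (d i * d j) ≡ 1ℤ
      dd i j = unit² (unit-* (d-unit i) (d-unit j))
      f≡dd : ∀ i j → f i j ≡ d i * d j
      f≡dd i j = product-sign w (d-unit i) (d-unit j) (f-unit i j) (begin
        d i + d j + f i j + 1ℤ
          ≡⟨ lemma₁ (d i) (d j) (f i j) (r i₀ j) (r i₀ i) (r i j) ⟩
        + 4 * (r i₀ j + r i₀ i + r i j) - ((- d j + + 4 * r i₀ j) + (- d i + + 4 * r i₀ i) + (- f i j + + 4 * r i j)) + 1ℤ
          ≡⟨ cong (λ z → + 4 * (r i₀ j + r i₀ i + r i j) - z + 1ℤ) (trans (sym (cong₂ _+_ (cong₂ _+_ (M≡fr i₀ j) (M≡fr i₀ i)) (M≡fr i j))) (proj₂ (mod4 i₀ i j))) ⟩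
        + 4 * (r i₀ j + r i₀ i + r i j) - (1ℤ + + 4 * proj₁ (mod4 i₀ i j)) + 1ℤ
          ≡⟨ lemma₂ (r i₀ j + r i₀ i + r i j) (proj₁ (mod4 i₀ i j)) ⟩
        + 4 * w ∎)
        where
        w = r i₀ j + r i₀ i + r i j - proj₁ (mod4 i₀ i j)
        lemma₁ : ∀ a b c x y z → a + b + c + 1ℤ ≡ + 4 * (x + y + z) - ((- b + + 4 * x) + (- a + + 4 * y) + (- c + + 4 * z)) + 1ℤ
        lemma₁ = solve-∀
        lemma₂ : ∀ x e → + 4 * x - (1ℤ + + 4 * e) + 1ℤ ≡ + 4 * (x - e)
        lemma₂ = solve-∀
      M≡ : ∀ i j → M i j ≡ d i * d j * (+ 4 * P i j - 1ℤ)
      M≡ i j = begin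
        M i j                                                            ≡⟨ M≡fr i j ⟩
        - f i j + + 4 * r i j                                            ≡⟨ cong (λ z → - z + + 4 * r i j) (f≡dd i j) ⟩
        - (d i * d j) + + 4 * r i j                                      ≡⟨ lemma₁ (d i * d j) (r i j) ⟩
        - (d i * d j) + + 4 * (1ℤ * r i j)                               ≡⟨ cong (λ z → - (d i * d j) + + 4 * (z * r i j)) (dd i j) ⟨
        - (d i * d j) + + 4 * ((d i * d j) * (d i * d j) * r i j)        ≡⟨ lemma₂ (d i * d j) (r i j) ⟩
        d i * d j * (+ 4 * P i j - 1ℤ)                                   ∎
        where
        lemma₁ : ∀ e r → - e + + 4 * r ≡ - e + + 4 * (1ℤ * r)
        lemma₁ = solve-∀
        lemma₂ : ∀ e r → - e + + 4 * (e * e * r) ≡ e * (+ 4 * (e * r) - 1ℤ)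
        lemma₂ = solve-∀
      ddM : ∀ i j → d i * d j * M i j ≡ + 4 * P i j - 1ℤ
      ddM i j = trans (cong (d i * d j *_) (M≡ i j)) (trans (sym (ℤₚ.*-assoc (d i * d j) (d i * d j) _)) (trans (cong (_* (+ 4 * P i j - 1ℤ)) (dd i j)) (ℤₚ.*-identityˡ _)))
      P-bit : ∀ i j → Bit (P i j)
      P-bit i j = bit-between (P i j)
        (pos-cancel-nonneg 3 (subst (0ℤ ℤ.≤_) (trans (cong (λ z → + 3 - z) (ddM i j)) (lemma₁ (P i j))) (bound (unit-* (d-unit i) (d-unit j)) i j)))
        (pos-cancel-nonneg 1 (subst (0ℤ ℤ.≤_) (trans (lemma₂ (d i * d j) (M i j)) (trans (cong (λ z → + 3 + z) (ddM i j)) (lemma₃ (P i j)))) (bound (unit-neg (unit-* (d-unit i) (d-unit j))) i j)))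
        where
        lemma₁ : ∀ p → + 3 - (+ 4 * p - 1ℤ) ≡ + 4 * (1ℤ - p)
        lemma₁ = solve-∀
        lemma₂ : ∀ e x → + 3 - - e * x ≡ + 3 + e * x
        lemma₂ = solve-∀
        lemma₃ : ∀ p → + 3 + (+ 4 * p - 1ℤ) ≡ + 2 * (1ℤ + + 2 * p)
        lemma₃ = solve-∀
      P-from : ∀ {i j k l} → d i * d j * M i j ≡ d k * d l * M k l → P i j ≡ P k l
      P-from {i} {j} {k} {l} e = *-cancel-suc 3 (begin
        + 4 * P i j                ≡⟨ lemma (+ 4 * P i j) ⟩
        (+ 4 * P i j - 1ℤ) + 1ℤ    ≡⟨ cong (_+ 1ℤ) (trans (sym (ddM i j)) (trans e (ddM k l))) ⟩
        (+ 4 * P k l - 1ℤ) + 1ℤ    ≡⟨ lemma (+ 4 * P k l) ⟨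
        + 4 * P k l                ∎)
        where
        lemma : ∀ x → x ≡ (x - 1ℤ) + 1ℤ
        lemma = solve-∀
      P-refl : ∀ i → P i i ≡ 1ℤ
      P-refl i = *-cancel-suc 3 (trans (lemma (+ 4 * P i i)) (cong (_+ 1ℤ) (trans (sym (ddM i i)) (trans (cong₂ _*_ (unit² (d-unit i)) (diagonal i)) refl))))
        where
        lemma : ∀ x → x ≡ (x - 1ℤ) + 1ℤ
        lemma = solve-∀
      P-sym : ∀ i j → P j i ≡ P i j
      P-sym i j = P-from (cong₂ _*_ (ℤₚ.*-comm (d j) (d i)) (symmetric i j))
      P-class : ∀ {i j} → P i j ≡ 1ℤ → ∀ k → P i k ≡ P j k
      P-class {i} {j} e k = P-from (begin
        d i * d k * M i k                    ≡⟨ cong (d i * d k *_) (parallel (unit-* (d-unit i) (d-unit j)) i j (trans (ddM i j) (cong (λ z → + 4 * z - 1ℤ) e)) k) ⟩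
        d i * d k * (d i * d j * M j k)      ≡⟨ lemma (d i) (d j) (d k) (M j k) ⟩
        (d i * d i) * (d j * d k * M j k)    ≡⟨ trans (cong (_* (d j * d k * M j k)) (unit² (d-unit i))) (ℤₚ.*-identityˡ _) ⟩
        d j * d k * M j k                    ∎)
        where
        lemma : ∀ a b c x → a * c * (a * b * x) ≡ (a * a) * (b * c * x)
        lemma = solve-∀

    classify : Classification M
    classify = classify-signs (λ i j → proj₁ (sign i j)) (λ i j → proj₁ (proj₂ (sign i j)))
      (λ i j → proj₁ (proj₂ (proj₂ (sign i j)))) (λ i j → proj₂ (proj₂ (proj₂ (sign i j))))
      where
      -- `mod4` with its last two indices equal and the diagonal entry 3 gives M i j = 2 e - 1; the
      -- parity of `e` then decides the residue modulo 4.
      sign : ∀ i j → ∃ λ f → ∃ λ r → Unit f × M i j ≡ - f + + 4 * r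
      sign i j = pick (parity e)
        where
        e = proj₁ (mod4 i j j)
        lemma₀ : ∀ x → + 2 * x ≡ (x + x + + 3) - + 3
        lemma₀ = solve-∀
        lemma₁ : ∀ e → (1ℤ + + 4 * e) - + 3 ≡ + 2 * (+ 2 * e - 1ℤ)
        lemma₁ = solve-∀
        M≡2e-1 : M i j ≡ + 2 * e - 1ℤ
        M≡2e-1 = *-cancel-suc 1 (trans (lemma₀ (M i j)) (trans (cong (_- + 3) (trans (cong (λ z → M i j + M i j + z) (sym (diagonal j))) (proj₂ (mod4 i j j)))) (lemma₁ e)))
        even-case : ∀ h → + 2 * (+ 2 * h) - 1ℤ ≡ - 1ℤ + + 4 * h
        even-case = solve-∀
        odd-case : ∀ h → + 2 * (+ 2 * h + 1ℤ) - 1ℤ ≡ - - 1ℤ + + 4 * h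
        odd-case = solve-∀
        pick : (∃ λ h → e ≡ + 2 * h ⊎ e ≡ + 2 * h + 1ℤ) → ∃ λ f → ∃ λ r → Unit f × M i j ≡ - f + + 4 * r
        pick (h , inj₁ p) = 1ℤ , h , inj₁ refl , trans M≡2e-1 (trans (cong (λ z → + 2 * z - 1ℤ) p) (even-case h))
        pick (h , inj₂ p) = - 1ℤ , h , inj₂ refl , trans M≡2e-1 (trans (cong (λ z → + 2 * z - 1ℤ) p) (odd-case h))

  -- 3 M = H + L, where H = M² - 4τM and L = κM - M² are positive multiples of projections.
  augment₃ : ∀ {n} m {τ κ} {S M : Matrix ℤ n} → τ ≡ + suc m → + n ≡ + 4 * τ + 1ℤ → κ ≡ + 4 * τ + + 3 → Fin n → Defect κ S M →
    (∀ i j → (S Z.⊗ M) i j ≡ (M Z.⊗ S) i j) →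
    let H : Matrix ℤ n
        H i j = (M Z.⊗ M) i j - + 4 * τ * M i j
        L : Matrix ℤ n
        L i j = κ * M i j - (M Z.⊗ M) i j
    in (∀ i → (M Z.⊗ H) i i ≡ κ * H i i) → (∀ i j → (H Z.⊗ H) i j ≡ + 3 * κ * H i j) →
       (∀ i j → (L Z.⊗ L) i j ≡ + 12 * τ * L i j) → Extension κ (suc (suc (suc n)))
  augment₃ {n} m {τ} {κ} {S} {M} τ≡ n≡ κ≡ i₀ defect SM≡MS MH HH LL = conclude (classify {M = M} i₀ M-diagonal symmetric bound parallel mod4)
    where
    open Defect defect
    H L : Matrix ℤ n
    H i j = (M Z.⊗ M) i j - + 4 * τ * M i j
    L i j = κ * M i j - (M Z.⊗ M) i j
    κ-pos : ∃ λ k → κ ≡ + suc k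
    κ-pos = _ , trans κ≡ (cong (λ z → + 4 * z + + 3) τ≡)
    k = proj₁ κ-pos
    M-diagonal : ∀ i → M i i ≡ + 3
    M-diagonal i = trans (diagonal i) (trans (cong₂ (λ x y → x + 1ℤ - y) κ≡ n≡) (lemma τ))
      where
      lemma : ∀ t → + 4 * t + + 3 + 1ℤ - (+ 4 * t + 1ℤ) ≡ + 3
      lemma = solve-∀
    M²-sym : ∀ i j → (M Z.⊗ M) j i ≡ (M Z.⊗ M) i j
    M²-sym i j = Z.∑-cong (λ l → trans (ℤₚ.*-comm (M j l) (M l i)) (cong₂ _*_ (symmetric i l) (symmetric l j)))
    H-sym : ∀ i j → H j i ≡ H i j
    H-sym i j = cong₂ (λ x y → x - + 4 * τ * y) (M²-sym i j) (symmetric i j)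
    L-sym : ∀ i j → L j i ≡ L i j
    L-sym i j = cong₂ (λ x y → κ * y - x) (M²-sym i j) (symmetric i j)
    H+L : ∀ i j → H i j + L i j ≡ + 3 * M i j
    H+L i j = trans (cong (λ z → H i j + (z * M i j - (M Z.⊗ M) i j)) κ≡) (lemma τ (M i j) ((M Z.⊗ M) i j))
      where
      lemma : ∀ t x q → q - + 4 * t * x + ((+ 4 * t + + 3) * x - q) ≡ + 3 * x
      lemma = solve-∀
    ΔH ΔL : ℤ → Fin n → Fin n → ℤ
    ΔH s i j = Z.∑ n (λ l → (H i l - s * H j l) * (H i l - s * H j l))
    ΔL s i j = Z.∑ n (λ l → (L i l - s * L j l) * (L i l - s * L j l))
    ΔH-nonneg : ∀ s i j → 0ℤ ℤ.≤ + 4 * (τ * ΔH s i j)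
    ΔH-nonneg s i j = pos-*-nonneg 3 (subst (λ z → 0ℤ ℤ.≤ z * ΔH s i j) (sym τ≡) (pos-*-nonneg m (∑-nonneg (λ l → square-nonneg (H i l - s * H j l)))))
    ΔL-nonneg : ∀ s i j → 0ℤ ℤ.≤ κ * ΔL s i j
    ΔL-nonneg s i j = subst (λ z → 0ℤ ℤ.≤ z * ΔL s i j) (sym (proj₂ κ-pos)) (pos-*-nonneg k (∑-nonneg (λ l → square-nonneg (L i l - s * L j l))))
    -- By `row-difference`, `ΔH` and `ΔL` carry the factors 3κ and 12τ; the weights 4τ and κ bring
    -- both to 12τκ, so that H + L = 3 M applies. The constant 72 is 12 times the 6 taken out of 18
    -- - 6 s M.
    norms : ∀ {s} → Unit s → ∀ i j → + 4 * (τ * ΔH s i j) + κ * ΔL s i j ≡ + 72 * (τ * (κ * (+ 3 - s * M i j)))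
    norms {s} us i j = begin
      + 4 * (τ * ΔH s i j) + κ * ΔL s i j
        ≡⟨ cong₂ (λ x y → + 4 * (τ * x) + κ * y) (row-difference {M = H} {+ 3 * κ} H-sym HH us i j) (row-difference {M = L} {+ 12 * τ} L-sym LL us i j) ⟩
      + 4 * (τ * (+ 3 * κ * (H i i + H j j - + 2 * s * H i j))) + κ * (+ 12 * τ * (L i i + L j j - + 2 * s * L i j))
        ≡⟨ lemma₁ τ κ s (H i i) (H j j) (H i j) (L i i) (L j j) (L i j) ⟩
      + 12 * τ * κ * ((H i i + L i i) + (H j j + L j j) - + 2 * s * (H i j + L i j))
        ≡⟨ cong₂ (λ x y → + 12 * τ * κ * (x - + 2 * s * y)) (cong₂ _+_ (trans (H+L i i) (cong (+ 3 *_) (M-diagonal i))) (trans (H+L j j) (cong (+ 3 *_) (M-diagonal j)))) (H+L i j) ⟩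
      + 12 * τ * κ * (+ 3 * + 3 + + 3 * + 3 - + 2 * s * (+ 3 * M i j))
        ≡⟨ lemma₂ τ κ s (M i j) ⟩
      + 72 * (τ * (κ * (+ 3 - s * M i j))) ∎
      where
      lemma₁ : ∀ t κ s a b c a′ b′ c′ → + 4 * (t * (+ 3 * κ * (a + b - + 2 * s * c))) + κ * (+ 12 * t * (a′ + b′ - + 2 * s * c′)) ≡
               + 12 * t * κ * ((a + a′) + (b + b′) - + 2 * s * (c + c′))
      lemma₁ = solve-∀
      lemma₂ : ∀ t κ s x → + 12 * t * κ * (+ 3 * + 3 + + 3 * + 3 - + 2 * s * (+ 3 * x)) ≡ + 72 * (t * (κ * (+ 3 - s * x)))
      lemma₂ = solve-∀
    bound : ∀ {s} → Unit s → ∀ i j → 0ℤ ℤ.≤ + 3 - s * M i j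
    bound {s} us i j = pos-cancel-nonneg k (subst (λ z → 0ℤ ℤ.≤ z * (+ 3 - s * M i j)) (proj₂ κ-pos)
      (pos-cancel-nonneg m (subst (λ z → 0ℤ ℤ.≤ z * (κ * (+ 3 - s * M i j))) τ≡
        (pos-cancel-nonneg 71 (subst (0ℤ ℤ.≤_) (norms us i j) (ℤₚ.+-mono-≤ (ΔH-nonneg s i j) (ΔL-nonneg s i j)))))))
    parallel : ∀ {s} → Unit s → ∀ i j → s * M i j ≡ + 3 → ∀ l → M i l ≡ s * M j l
    parallel {s} us i j e l = *-cancel-suc 2 (begin
      + 3 * M i l                                        ≡⟨ H+L i l ⟨
      H i l + L i l                                      ≡⟨ cong₂ _+_ (ℤₚ.i-j≡0⇒i≡j (H i l) (s * H j l) (∑-squares-zero {t = λ l → H i l - s * H j l} ΔH≡0 l))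
                                                                      (ℤₚ.i-j≡0⇒i≡j (L i l) (s * L j l) (∑-squares-zero {t = λ l → L i l - s * L j l} ΔL≡0 l)) ⟩
      s * H j l + s * L j l                              ≡⟨ ℤₚ.*-distribˡ-+ s _ _ ⟨
      s * (H j l + L j l)                                ≡⟨ cong (s *_) (H+L j l) ⟩
      s * (+ 3 * M j l)                                  ≡⟨ lemma s (M j l) ⟩
      + 3 * (s * M j l)                                  ∎)
      where
      lemma : ∀ s x → s * (+ 3 * x) ≡ + 3 * (s * x)
      lemma = solve-∀
      zeros : ∀ t κ → + 72 * (t * (κ * 0ℤ)) ≡ 0ℤ
      zeros = solve-∀
      both : + 4 * (τ * ΔH s i j) ≡ 0ℤ × κ * ΔL s i j ≡ 0ℤ
      both = nonneg-sum-zero (ΔH-nonneg s i j) (ΔL-nonneg s i j) (trans (norms us i j) (trans (cong (λ z → + 72 * (τ * (κ * (+ 3 - z)))) e) (zeros τ κ)))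
      ΔH≡0 : ΔH s i j ≡ 0ℤ
      ΔH≡0 = *-cancel-suc m (trans (cong (_* ΔH s i j) (sym τ≡)) (trans (*-cancel-suc 3 {τ * ΔH s i j} {0ℤ} (proj₁ both)) (sym (ℤₚ.*-zeroʳ (+ suc m)))))
      ΔL≡0 : ΔL s i j ≡ 0ℤ
      ΔL≡0 = *-cancel-suc k (trans (cong (_* ΔL s i j) (sym (proj₂ κ-pos))) (trans (proj₂ both) (sym (ℤₚ.*-zeroʳ (+ suc k)))))
    -- By symmetry a diagonal entry of H² = 3κH is a sum of squares.
    H-nonneg : ∀ i → 0ℤ ℤ.≤ H i i
    H-nonneg i = pos-cancel-nonneg k (subst (λ z → 0ℤ ℤ.≤ z * H i i) (proj₂ κ-pos) (pos-cancel-nonneg 2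
      (subst (0ℤ ℤ.≤_) (trans (HH i i) (ℤₚ.*-assoc (+ 3) κ (H i i)))
        (∑-nonneg (λ l → subst (λ z → 0ℤ ℤ.≤ H i l * z) (sym (H-sym i l)) (square-nonneg (H i l)))))))
    unitRow-M : ∀ i j → dot (unitRow seidel i) (unitRow seidel j) ≡ (κ + 1ℤ) * δ i j - M i j
    unitRow-M i j = trans (unitRow-dot seidel i j) (trans (lemma (gram S i j) (M i j) (δ i j)) (trans (cong (λ z → z + δ i j - M i j) (complement i j)) (lemma₂ κ (δ i j) (M i j))))
      where
      lemma : ∀ g x d → g + d ≡ (x + g) + d - x
      lemma = solve-∀
      lemma₂ : ∀ κ d x → κ * d + d - x ≡ (κ + 1ℤ) * d - x
      lemma₂ = solve-∀
    -- Rows of S + I have products (κ + 1) δ - M, where κ + 1 = 4 (τ + 1); as n is 1 modulo 4,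
    -- `dots-mod-4` leaves the residue 1 for the three entries of `M`.
    mod4 : ∀ i j l → ∃ λ e → M i l + M i j + M j l ≡ 1ℤ + + 4 * e
    mod4 i j l = τ + (τ + 1ℤ) * (δ i l + δ i j + δ j l) - e , (begin
      M i l + M i j + M j l
        ≡⟨ lemma₁ (M i l) (M i j) (M j l) (+ n) ((κ + 1ℤ) * δ i l) ((κ + 1ℤ) * δ i j) ((κ + 1ℤ) * δ j l) ⟩
      + n + ((κ + 1ℤ) * δ i l + (κ + 1ℤ) * δ i j + (κ + 1ℤ) * δ j l) - (+ n + (((κ + 1ℤ) * δ i l - M i l) + ((κ + 1ℤ) * δ i j - M i j) + ((κ + 1ℤ) * δ j l - M j l)))
        ≡⟨ cong (λ z → + n + ((κ + 1ℤ) * δ i l + (κ + 1ℤ) * δ i j + (κ + 1ℤ) * δ j l) - z) (trans (cong (λ z → + n + z)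
             (sym (cong₂ _+_ (cong₂ _+_ (unitRow-M i l) (unitRow-M i j)) (unitRow-M j l)))) (proj₂ (dots-mod-4 seidel i j l))) ⟩
      + n + ((κ + 1ℤ) * δ i l + (κ + 1ℤ) * δ i j + (κ + 1ℤ) * δ j l) - + 4 * e
        ≡⟨ cong₂ (λ x y → x + ((y + 1ℤ) * δ i l + (y + 1ℤ) * δ i j + (y + 1ℤ) * δ j l) - + 4 * e) n≡ κ≡ ⟩
      + 4 * τ + 1ℤ + ((+ 4 * τ + + 3 + 1ℤ) * δ i l + (+ 4 * τ + + 3 + 1ℤ) * δ i j + (+ 4 * τ + + 3 + 1ℤ) * δ j l) - + 4 * e
        ≡⟨ lemma₂ τ (δ i l) (δ i j) (δ j l) e ⟩
      1ℤ + + 4 * (τ + (τ + 1ℤ) * (δ i l + δ i j + δ j l) - e) ∎)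
      where
      e = proj₁ (dots-mod-4 seidel i j l)
      lemma₁ : ∀ x y z n a b c → x + y + z ≡ n + (a + b + c) - (n + ((a - x) + (b - y) + (c - z)))
      lemma₁ = solve-∀
      lemma₂ : ∀ t a b c e → + 4 * t + 1ℤ + ((+ 4 * t + + 3 + 1ℤ) * a + (+ 4 * t + + 3 + 1ℤ) * b + (+ 4 * t + + 3 + 1ℤ) * c) - + 4 * e ≡ 1ℤ + + 4 * (t + (t + 1ℤ) * (a + b + c) - e)
      lemma₂ = solve-∀
    conclude : Classification M → Extension κ (suc (suc (suc n)))
    conclude C = ClassExtension.class-extension m τ≡ n≡ κ≡ i₀ P d d-unit P-bit P-refl P-sym P-class M≡ MH H-nonneg defect SM≡MS
      where open Classification C

open Augmentation

-- The relations for each factor f, and the equivalences with the first matrix.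

module Equivalences where

  open import Data.Integer using (_+_; _*_; _-_)
  open ≡-Reasoning

  ^-exponent : ∀ q {a b} → a ≡ b → q ^ₚ a ≃ q ^ₚ b
  ^-exponent q refl = ≃-refl

  -- The ring solver works with the constants as variables and leaves their product unevaluated,
  -- whereas `modulo` expects a single integer.
  merge-constants : ∀ {g} a b p r → g ≃ (constₚ a *ₚ constₚ b) *ₚ p +ₚ r → g ≃ constₚ (a * b) *ₚ p +ₚ r
  merge-constants a b p r e = ≃-trans e (+-cong {q = r} (*-cong {q = p} (const-*-const a b) ≃-refl) ≃-refl)

  module Spectral {n} {S : Matrix ℤ n} (seidel : IsSkewSeidel S) (c : ℤ) (k : ℕ) {s} (f : Poly) (s≢0 : s ≢ 0ℤ)
                  (f-parity : Parity S s f) (spectrum : charPoly n S ≃ f *ₚ (quad c ^ₚ suc k)) where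

    E = eval S
    q = quad c
    M = E q

    fq≡0 : ∀ i j → E (f *ₚ q) i j ≡ 0ℤ
    fq≡0 = reduced S (skew-of seidel) q f k s≢0 (parity-quad S (skew-of seidel) c) f-parity
      (λ i j → trans (eval-cong S (≃-sym spectrum) i j) (cayley-hamilton n S i j))

    defect : Defect c S M
    defect = record
      { seidel = seidel
      ; symmetric = λ i j → trans (Parity.transpose (parity-quad S (skew-of seidel) c) i j) (ℤₚ.*-identityˡ _)
      ; complement = λ i j → trans (cong (_+ gram S i j) (eval-quad S (skew-of seidel) c i j)) (lemma (c * δ i j) (gram S i j))
      }
      where
      lemma : ∀ x y → x + - y + y ≡ x
      lemma = solve-∀

    -- f q vanishes at `S`, so a congruence of polynomials modulo f q, with quotient `r`, becomes a
    -- matrix identity. This supplies M² = μ M and its analogues without any eigenvalue.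
    modulo : ∀ {g} a p r → g ≃ constₚ a *ₚ p +ₚ r *ₚ (f *ₚ q) → ∀ i j → E g i j ≡ a * E p i j
    modulo {g} a p r e i j = begin
      E g i j
        ≡⟨ eval-cong S {g} e i j ⟩
      E (constₚ a *ₚ p +ₚ r *ₚ (f *ₚ q)) i j
        ≡⟨ eval-+ S (constₚ a *ₚ p) (r *ₚ (f *ₚ q)) i j ⟩
      E (constₚ a *ₚ p) i j + E (r *ₚ (f *ₚ q)) i j
        ≡⟨ cong₂ _+_ (trans (eval-cong S (const-* a p) i j) (eval-· S a p i j)) (trans (eval-* S r (f *ₚ q) i j) (⊗-zeroʳ S {E r} fq≡0 i j)) ⟩
      a * E p i j + 0ℤ
        ≡⟨ ℤₚ.+-identityʳ _ ⟩
      a * E p i j ∎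

    S⊗ : ∀ p i j → (S Z.⊗ E p) i j ≡ E (X *ₚ p) i j
    S⊗ p i j = trans (Z.∑-cong (λ k → cong (_* E p k j) (sym (eval-X S i k)))) (sym (eval-* S X p i j))

    ⊗S : ∀ p i j → (E p Z.⊗ S) i j ≡ E (p *ₚ X) i j
    ⊗S p i j = trans (Z.∑-cong (λ k → cong (E p i k *_) (sym (eval-X S k j)))) (sym (eval-* S p X i j))

    commute : ∀ i j → (S Z.⊗ M) i j ≡ (M Z.⊗ S) i j
    commute i j = trans (S⊗ q i j) (trans (eval-cong S (*-comm X q) i j) (sym (⊗S q i j)))

  -1≢0 : - 1ℤ ≢ 0ℤ
  -1≢0 ()

  1≢0 : 1ℤ ≢ 0ℤ
  1≢0 ()

  conference-of : ∀ {n} {S : Matrix ℤ n} c k → IsSkewSeidel S → charPoly n S ≃ quad c ^ₚ suc k → Conference c S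
  conference-of {S = S} c k seidel cp = quad-zero⇒conference S (skew-of seidel) c (λ i j → trans (eval-cong S (≃-sym (*-identityˡ q)) i j) (fq≡0 i j))
    where
    open Spectral seidel c k (constₚ 1ℤ) 1≢0 (parity-const S (skew-of seidel) 1ℤ) (≃-trans cp (≃-sym (*-identityˡ _)))

  extend₁ : ∀ {n} {S : Matrix ℤ n} c k → IsSkewSeidel S → charPoly n S ≃ X *ₚ (quad c ^ₚ suc k) → + n ≡ c → Fin n → Extension c (suc n)
  extend₁ {suc n} {S} c k seidel cp refl _ = augment₁ defect
    (λ i j → trans (sym (eval-* S q q i j)) (modulo c q X (square X (constₚ c)) i j))
    (λ i j → trans (S⊗ q i j) (fq≡0 i j))
    where
    open Spectral seidel c k X -1≢0 (parity-X S (skew-of seidel)) cp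
    square : ∀ x c → (x *ₚ x +ₚ c) *ₚ (x *ₚ x +ₚ c) ≃ c *ₚ (x *ₚ x +ₚ c) +ₚ x *ₚ (x *ₚ (x *ₚ x +ₚ c))
    square = solve-∀-in polyACR

  extend₂ : ∀ {n} {S : Matrix ℤ n} c k → IsSkewSeidel S → charPoly n S ≃ quad 1ℤ *ₚ (quad c ^ₚ suc k) → + n + 1ℤ ≡ c →
            ∀ m → + n ≡ + 2 * + suc m → Fin n → Extension c (suc (suc n))
  extend₂ {n} {S} c k seidel cp refl m n≡ i₀ = augment₂ m i₀ refl n≡ defect
    (λ i j → trans (sym (eval-* S q q i j)) (modulo (+ n) q (constₚ 1ℤ) (square X (constₚ (+ n)) (constₚ 1ℤ) *-identityˡ) i j))
    commute
    (λ i j → trans (⊗-congʳ S {S} (S⊗ q) i j) (trans (S⊗ (X *ₚ q) i j)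
      (trans (modulo (- 1ℤ) q (constₚ 1ℤ) (twice X (constₚ (+ n)) (constₚ 1ℤ) (constₚ (- 1ℤ)) *-identityˡ (const-* (- 1ℤ))) i j) (ℤₚ.-1*i≡-i _))))
    where
    open Spectral seidel c k (quad 1ℤ) 1≢0 (parity-quad S (skew-of seidel) 1ℤ) cp
    -- `constₚ (+ n + 1ℤ)` computes to `constₚ (+ n) +ₚ constₚ 1ℤ`, so q is n plus x² + 1 and q² is
    -- n q modulo (x² + 1) q. The constant 1 enters as a variable `o` together with its unit law.
    square : ∀ x a o → (∀ p → o *ₚ p ≃ p) →
             (x *ₚ x +ₚ (a +ₚ o)) *ₚ (x *ₚ x +ₚ (a +ₚ o)) ≃ a *ₚ (x *ₚ x +ₚ (a +ₚ o)) +ₚ o *ₚ ((x *ₚ x +ₚ o) *ₚ (x *ₚ x +ₚ (a +ₚ o)))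
    square x a o one = ≃-trans (lemma x a o) (+-cong ≃-refl (≃-sym (one _)))
      where
      lemma : ∀ x a o → (x *ₚ x +ₚ (a +ₚ o)) *ₚ (x *ₚ x +ₚ (a +ₚ o)) ≃ a *ₚ (x *ₚ x +ₚ (a +ₚ o)) +ₚ (x *ₚ x +ₚ o) *ₚ (x *ₚ x +ₚ (a +ₚ o))
      lemma = solve-∀-in polyACR
    twice : ∀ x a o m → (∀ p → o *ₚ p ≃ p) → (∀ p → m *ₚ p ≃ negₚ p) →
            x *ₚ (x *ₚ (x *ₚ x +ₚ (a +ₚ o))) ≃ m *ₚ (x *ₚ x +ₚ (a +ₚ o)) +ₚ o *ₚ ((x *ₚ x +ₚ o) *ₚ (x *ₚ x +ₚ (a +ₚ o)))
    twice x a o m one minus = ≃-trans (lemma x (x *ₚ x +ₚ (a +ₚ o)))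
      (+-cong (≃-sym (minus _)) (≃-trans (*-distribʳ-one (x *ₚ x) (x *ₚ x +ₚ (a +ₚ o))) (≃-sym (one _))))
      where
      lemma : ∀ x q → x *ₚ (x *ₚ q) ≃ negₚ q +ₚ (x *ₚ x *ₚ q +ₚ q)
      lemma = solve-∀-in polyACR
      *-distribʳ-one : ∀ y q → y *ₚ q +ₚ q ≃ (y +ₚ o) *ₚ q
      *-distribʳ-one y q = ≃-sym (≃-trans (*-distribʳ q y o) (+-cong ≃-refl (one q)))

  extend₃ : ∀ {n} {S : Matrix ℤ n} m k → IsSkewSeidel S → let τ = + suc m ; κ = + 4 * τ + + 3 in
            charPoly n S ≃ (X *ₚ quad (+ 3)) *ₚ (quad κ ^ₚ suc k) → + n ≡ + 4 * τ + 1ℤ → Fin n → Extension κ (suc (suc (suc n)))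
  extend₃ {n} {S} m k seidel cp n≡ i₀ = augment₃ m refl n≡ refl i₀ defect commute
    (λ i → begin
      (M Z.⊗ H) i i                     ≡⟨ Z.∑-cong (λ j → cong (M i j *_) (H≡ j i)) ⟩
      (E q Z.⊗ E (q *ₚ u)) i i          ≡⟨ eval-* S q (q *ₚ u) i i ⟨
      E (q *ₚ (q *ₚ u)) i i             ≡⟨ modulo κ (q *ₚ u) X (MH X a b) i i ⟩
      κ * E (q *ₚ u) i i                ≡⟨ cong (κ *_) (H≡ i i) ⟨
      κ * H i i                         ∎)
    (λ i j → begin
      (H Z.⊗ H) i j                         ≡⟨ Z.∑-cong (λ l → cong₂ _*_ (H≡ i l) (H≡ l j)) ⟩
      (E (q *ₚ u) Z.⊗ E (q *ₚ u)) i j       ≡⟨ eval-* S (q *ₚ u) (q *ₚ u) i j ⟨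
      E ((q *ₚ u) *ₚ (q *ₚ u)) i j          ≡⟨ modulo (+ 3 * κ) (q *ₚ u) (X *ₚ (q +ₚ b)) (merge-constants (+ 3) κ (q *ₚ u) ((X *ₚ (q +ₚ b)) *ₚ ((X *ₚ u) *ₚ q)) (HH X a b)) i j ⟩
      + 3 * κ * E (q *ₚ u) i j              ≡⟨ cong (+ 3 * κ *_) (H≡ i j) ⟨
      + 3 * κ * H i j                       ∎)
    (λ i j → begin
      (L Z.⊗ L) i j                         ≡⟨ Z.∑-cong (λ l → cong₂ _*_ (L≡ i l) (L≡ l j)) ⟩
      (E ℓ Z.⊗ E ℓ) i j                     ≡⟨ eval-* S ℓ ℓ i j ⟨
      E (ℓ *ₚ ℓ) i j                        ≡⟨ modulo (+ 3 * (+ 4 * τ)) ℓ (X *ₚ (X *ₚ X +ₚ a)) (merge-constants (+ 3) (+ 4 * τ) ℓ ((X *ₚ (X *ₚ X +ₚ a)) *ₚ ((X *ₚ u) *ₚ q)) (LL X a b)) i j ⟩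
      + 3 * (+ 4 * τ) * E ℓ i j             ≡⟨ cong₂ _*_ (sym (ℤₚ.*-assoc (+ 3) (+ 4) τ)) (sym (L≡ i j)) ⟩
      + 12 * τ * L i j                      ∎)
    where
    τ = + suc m
    κ = + 4 * τ + + 3
    a = constₚ (+ 4 * τ)
    b = constₚ (+ 3)
    u = quad (+ 3)
    open Spectral seidel κ k (X *ₚ u) -1≢0 (parity-* S (skew-of seidel) X u (parity-X S (skew-of seidel)) (parity-quad S (skew-of seidel) (+ 3))) cp
    -- H = q (q - 4τ) = q (x² + 3) and L = q (κ - q) = -x² q. Each contains a factor of f = x (x² +
    -- 3) that completes the other, so their product is a multiple of f q.
    ℓ = negₚ (X *ₚ X *ₚ q)
    H L : Matrix ℤ n
    H i j = (M Z.⊗ M) i j - + 4 * τ * M i j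
    L i j = κ * M i j - (M Z.⊗ M) i j
    H≡ : ∀ i j → H i j ≡ E (q *ₚ u) i j
    H≡ i j = begin
      (M Z.⊗ M) i j - + 4 * τ * M i j
        ≡⟨ cong (_- + 4 * τ * M i j) (trans (sym (eval-* S q q i j)) (eval-cong S (lemma X a b) i j)) ⟩
      E (q *ₚ u +ₚ a *ₚ q) i j - + 4 * τ * M i j
        ≡⟨ cong (_- + 4 * τ * M i j) (trans (eval-+ S (q *ₚ u) (a *ₚ q) i j) (cong (λ z → E (q *ₚ u) i j + z) (trans (eval-cong S (const-* (+ 4 * τ) q) i j) (eval-· S (+ 4 * τ) q i j)))) ⟩
      E (q *ₚ u) i j + + 4 * τ * M i j - + 4 * τ * M i j
        ≡⟨ cancel (E (q *ₚ u) i j) (+ 4 * τ * M i j) ⟩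
      E (q *ₚ u) i j ∎
      where
      lemma : ∀ x a b → (x *ₚ x +ₚ (a +ₚ b)) *ₚ (x *ₚ x +ₚ (a +ₚ b)) ≃ (x *ₚ x +ₚ (a +ₚ b)) *ₚ (x *ₚ x +ₚ b) +ₚ a *ₚ (x *ₚ x +ₚ (a +ₚ b))
      lemma = solve-∀-in polyACR
      cancel : ∀ x y → x + y - y ≡ x
      cancel = solve-∀
    L≡ : ∀ i j → L i j ≡ E ℓ i j
    L≡ i j = begin
      κ * M i j - (M Z.⊗ M) i j
        ≡⟨ cong (λ z → κ * M i j - z) (trans (sym (eval-* S q q i j)) (trans (eval-cong S (lemma X a b) i j) (eval-+ S (constₚ κ *ₚ q) (X *ₚ X *ₚ q) i j))) ⟩
      κ * M i j - (E (constₚ κ *ₚ q) i j + E (X *ₚ X *ₚ q) i j)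
        ≡⟨ cong (λ z → κ * M i j - (z + E (X *ₚ X *ₚ q) i j)) (trans (eval-cong S (const-* κ q) i j) (eval-· S κ q i j)) ⟩
      κ * M i j - (κ * M i j + E (X *ₚ X *ₚ q) i j)
        ≡⟨ cancel (κ * M i j) (E (X *ₚ X *ₚ q) i j) ⟩
      - 1ℤ * E (X *ₚ X *ₚ q) i j
        ≡⟨ eval-· S (- 1ℤ) (X *ₚ X *ₚ q) i j ⟨
      E ℓ i j ∎
      where
      lemma : ∀ x a b → (x *ₚ x +ₚ (a +ₚ b)) *ₚ (x *ₚ x +ₚ (a +ₚ b)) ≃ (a +ₚ b) *ₚ (x *ₚ x +ₚ (a +ₚ b)) +ₚ x *ₚ x *ₚ (x *ₚ x +ₚ (a +ₚ b))
      lemma = solve-∀-in polyACR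
      cancel : ∀ x y → x - (x + y) ≡ - 1ℤ * y
      cancel = solve-∀
    MH : ∀ x a b → (x *ₚ x +ₚ (a +ₚ b)) *ₚ ((x *ₚ x +ₚ (a +ₚ b)) *ₚ (x *ₚ x +ₚ b)) ≃
         (a +ₚ b) *ₚ ((x *ₚ x +ₚ (a +ₚ b)) *ₚ (x *ₚ x +ₚ b)) +ₚ x *ₚ ((x *ₚ (x *ₚ x +ₚ b)) *ₚ (x *ₚ x +ₚ (a +ₚ b)))
    MH = solve-∀-in polyACR
    HH : ∀ x a b → ((x *ₚ x +ₚ (a +ₚ b)) *ₚ (x *ₚ x +ₚ b)) *ₚ ((x *ₚ x +ₚ (a +ₚ b)) *ₚ (x *ₚ x +ₚ b)) ≃
         (b *ₚ (a +ₚ b)) *ₚ ((x *ₚ x +ₚ (a +ₚ b)) *ₚ (x *ₚ x +ₚ b)) +ₚ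
         (x *ₚ ((x *ₚ x +ₚ (a +ₚ b)) +ₚ b)) *ₚ ((x *ₚ (x *ₚ x +ₚ b)) *ₚ (x *ₚ x +ₚ (a +ₚ b)))
    HH = solve-∀-in polyACR
    LL : ∀ x a b → negₚ (x *ₚ x *ₚ (x *ₚ x +ₚ (a +ₚ b))) *ₚ negₚ (x *ₚ x *ₚ (x *ₚ x +ₚ (a +ₚ b))) ≃
         (b *ₚ a) *ₚ negₚ (x *ₚ x *ₚ (x *ₚ x +ₚ (a +ₚ b))) +ₚ
         (x *ₚ (x *ₚ x +ₚ a)) *ₚ ((x *ₚ (x *ₚ x +ₚ b)) *ₚ (x *ₚ x +ₚ (a +ₚ b)))
    LL = solve-∀-in polyACR

  polynomial : ℕ → Poly
  polynomial t = quad (+ (4 ℕ.* t ℕ.+ 3))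

  order : ℕ → ℕ
  order t = (2 ℕ.* t ℕ.+ 2) ℕ.* 2

  extension⇒charPoly : ∀ t {n} → n ≡ order t → Extension (+ (4 ℕ.* t ℕ.+ 3)) n → HasSkewSeidelWithCharPoly (polynomial t ^ₚ (2 ℕ.* t ℕ.+ 2))
  extension⇒charPoly t refl e = order t , matrix , seidel , at (conference-charPoly (2 ℕ.* t ℕ.+ 2) {matrix} {+ (4 ℕ.* t ℕ.+ 3)} (skew-of seidel) conference)
    where open Extension e

  -- `HasSkewSeidelWithCharPoly` hides the order of the matrix; the degree of the characteristic
  -- polynomial recovers it.
  charPoly-order : ∀ {n d} {S : Matrix ℤ n} p → HasTop d 1ℤ p → charPoly n S ≃ p → n ≡ d
  charPoly-order {n} {S = S} p top e = top-unique 1≢0 1≢0 (top-resp e (charPoly-monic n S)) top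

  module _ (m : ℕ) where

    private
      t = suc m
      κ = + (4 ℕ.* t ℕ.+ 3)
      q = polynomial t
      A = HasSkewSeidelWithCharPoly (q ^ₚ (2 ℕ.* t ℕ.+ 2))
      B = HasSkewSeidelWithCharPoly (X *ₚ (q ^ₚ (2 ℕ.* t ℕ.+ 1)))
      C = HasSkewSeidelWithCharPoly ((X *ₚ X +ₚ constₚ (+ 1)) *ₚ (q ^ₚ (2 ℕ.* t)))
      D = HasSkewSeidelWithCharPoly (X *ₚ (X *ₚ X +ₚ constₚ (+ 3)) *ₚ (q ^ₚ (2 ℕ.* t ℕ.∸ 1)))
      top-q : ∀ k → HasTop (k ℕ.* 2) 1ℤ (q ^ₚ k)
      top-q k = top-^ k (top-quad κ)
      nonempty : ∀ {n d} → n ≡ suc d → Fin n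
      nonempty refl = zero
      four≤order : 4 ℕ.≤ order t
      four≤order = ℕₚ.*-monoˡ-≤ 2 (ℕₚ.m≤n+m 2 (2 ℕ.* t))

    shrink : ∀ k r f → k ℕ.≤ 3 → k ℕ.+ r ≡ 2 ℕ.* t ℕ.+ 2 → (∀ {T : Matrix ℤ k} → IsSkewSeidel T → charPoly k T ≃ f) →
             A → HasSkewSeidelWithCharPoly (f *ₚ (q ^ₚ r))
    shrink k r f k≤3 k+r≡ small (n , S , seidel , cp) = proj₁ deleted , proj₁ (proj₂ deleted) , proj₁ (proj₂ (proj₂ deleted)) , at (proj₂ (proj₂ (proj₂ deleted)))
      where
      n≡ : n ≡ order t
      n≡ = charPoly-order {S = S} (q ^ₚ (2 ℕ.* t ℕ.+ 2)) (top-q (2 ℕ.* t ℕ.+ 2)) (mk cp)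
      deleted = delete k {r = r} {S = S} {c = κ} f
        (ℕₚ.≤-trans (ℕₚ.≤-trans k≤3 (ℕₚ.n≤1+n 3)) (subst (4 ℕ.≤_) (sym n≡) four≤order))
        seidel (conference-of κ (ℕ.pred (2 ℕ.* t ℕ.+ 2)) seidel (mk cp)) (≃-trans (mk cp) (^-exponent q (sym k+r≡))) small

    A⇒B : A → B
    A⇒B = shrink 1 (2 ℕ.* t ℕ.+ 1) X (ℕ.s≤s ℕ.z≤n) (lemma t) charPoly₁
      where
      lemma : ∀ t → 1 ℕ.+ (2 ℕ.* t ℕ.+ 1) ≡ 2 ℕ.* t ℕ.+ 2
      lemma = solve-ℕ

    A⇒C : A → C
    A⇒C = shrink 2 (2 ℕ.* t) (X *ₚ X +ₚ constₚ (+ 1)) (ℕ.s≤s (ℕ.s≤s ℕ.z≤n)) (ℕₚ.+-comm 2 (2 ℕ.* t)) charPoly₂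

    -- As t = m + 1, the truncated subtraction is exact, and the exponent takes the successor form
    -- that `extend₃` requires.
    2t∸1 : 2 ℕ.* t ℕ.∸ 1 ≡ suc (2 ℕ.* m)
    2t∸1 = ℕₚ.+-suc m (m ℕ.+ 0)

    A⇒D : A → D
    A⇒D = shrink 3 (2 ℕ.* t ℕ.∸ 1) (X *ₚ (X *ₚ X +ₚ constₚ (+ 3))) ℕₚ.≤-refl (trans (cong (3 ℕ.+_) 2t∸1) (lemma m)) charPoly₃
      where
      lemma : ∀ m → 3 ℕ.+ (1 ℕ.+ 2 ℕ.* m) ≡ 2 ℕ.* (1 ℕ.+ m) ℕ.+ 2
      lemma = solve-ℕ

    B⇒A : B → A
    B⇒A (n , S , seidel , cp) = extension⇒charPoly t (trans (cong suc n≡) (lemma t))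
      (extend₁ κ (ℕ.pred (2 ℕ.* t ℕ.+ 1)) seidel (mk cp) (cong +_ (trans n≡ (lemma₂ t))) (nonempty n≡))
      where
      n≡ : n ≡ 1 ℕ.+ (2 ℕ.* t ℕ.+ 1) ℕ.* 2
      n≡ = charPoly-order {S = S} _ (top-* X (q ^ₚ (2 ℕ.* t ℕ.+ 1)) top-X (top-q (2 ℕ.* t ℕ.+ 1))) (mk cp)
      lemma : ∀ t → 1 ℕ.+ (1 ℕ.+ (2 ℕ.* t ℕ.+ 1) ℕ.* 2) ≡ (2 ℕ.* t ℕ.+ 2) ℕ.* 2
      lemma = solve-ℕ
      lemma₂ : ∀ t → 1 ℕ.+ (2 ℕ.* t ℕ.+ 1) ℕ.* 2 ≡ 4 ℕ.* t ℕ.+ 3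
      lemma₂ = solve-ℕ

    C⇒A : C → A
    C⇒A (n , S , seidel , cp) = extension⇒charPoly t (trans (cong (2 ℕ.+_) n≡) (lemma t))
      (extend₂ κ (ℕ.pred (2 ℕ.* t)) seidel (mk cp) (cong +_ (trans (cong (ℕ._+ 1) n≡) (lemma₂ t))) (2 ℕ.* t) (cong +_ (trans n≡ (lemma₃ t))) (nonempty n≡))
      where
      n≡ : n ≡ 2 ℕ.+ 2 ℕ.* t ℕ.* 2
      n≡ = charPoly-order {S = S} _ (top-* (quad 1ℤ) (q ^ₚ (2 ℕ.* t)) (top-quad 1ℤ) (top-q (2 ℕ.* t))) (mk cp)
      lemma : ∀ t → 2 ℕ.+ (2 ℕ.+ 2 ℕ.* t ℕ.* 2) ≡ (2 ℕ.* t ℕ.+ 2) ℕ.* 2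
      lemma = solve-ℕ
      lemma₂ : ∀ t → 2 ℕ.+ 2 ℕ.* t ℕ.* 2 ℕ.+ 1 ≡ 4 ℕ.* t ℕ.+ 3
      lemma₂ = solve-ℕ
      lemma₃ : ∀ t → 2 ℕ.+ 2 ℕ.* t ℕ.* 2 ≡ 2 ℕ.* (1 ℕ.+ 2 ℕ.* t)
      lemma₃ = solve-ℕ

    D⇒A : D → A
    D⇒A (n , S , seidel , cp) = extension⇒charPoly t (trans (cong (3 ℕ.+_) n≡′) (lemma m))
      (extend₃ m (2 ℕ.* m) seidel (≃-trans (mk cp) (*-congʳ (X *ₚ quad (+ 3)) (^-exponent q 2t∸1))) (cong +_ (trans n≡′ (lemma₂ m))) (nonempty n≡))
      where
      n≡ : n ≡ 3 ℕ.+ (2 ℕ.* t ℕ.∸ 1) ℕ.* 2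
      n≡ = charPoly-order {S = S} _ (top-* (X *ₚ quad (+ 3)) (q ^ₚ (2 ℕ.* t ℕ.∸ 1)) (top-* X (quad (+ 3)) top-X (top-quad (+ 3))) (top-q (2 ℕ.* t ℕ.∸ 1))) (mk cp)
      n≡′ : n ≡ 3 ℕ.+ (1 ℕ.+ 2 ℕ.* m) ℕ.* 2
      n≡′ = trans n≡ (cong (λ z → 3 ℕ.+ z ℕ.* 2) 2t∸1)
      lemma : ∀ m → 3 ℕ.+ (3 ℕ.+ (1 ℕ.+ 2 ℕ.* m) ℕ.* 2) ≡ (2 ℕ.* (1 ℕ.+ m) ℕ.+ 2) ℕ.* 2
      lemma = solve-ℕ
      lemma₂ : ∀ m → 3 ℕ.+ (1 ℕ.+ 2 ℕ.* m) ℕ.* 2 ≡ 4 ℕ.* (1 ℕ.+ m) ℕ.+ 1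
      lemma₂ = solve-ℕ

open Equivalences
open import Data.Nat using (_+_; _*_; _∸_; _≤_)

theorem4p1 : (t : ℕ) → 1 ≤ t → let
    q = X *ₚ X +ₚ constₚ (+ (4 * t + 3))
    A = HasSkewSeidelWithCharPoly (q ^ₚ (2 * t + 2))
    B = HasSkewSeidelWithCharPoly (X *ₚ (q ^ₚ (2 * t + 1)))
    C = HasSkewSeidelWithCharPoly ((X *ₚ X +ₚ constₚ (+ 1)) *ₚ (q ^ₚ (2 * t)))
    D = HasSkewSeidelWithCharPoly (X *ₚ (X *ₚ X +ₚ constₚ (+ 3)) *ₚ (q ^ₚ (2 * t ∸ 1)))
    in (A ⇔ B) × (A ⇔ C) × (A ⇔ D)
theorem4p1 (suc m) _ = mk⇔ (A⇒B m) (B⇒A m) , mk⇔ (A⇒C m) (C⇒A m) , mk⇔ (A⇒D m) (D⇒A m)
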